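{- Let $q$ be a power of $3$, let $L$ be a generic line of $PG(3,q)$, let $S$ be the set of the $q+1$ planes of $PG(3,q)$ containing $L$, and let $r=\jmath(f_L)$. (1) If $f_L\in\mathcal{F}_i$ with $i\in\{1,2,4\}$, then $|S\cap\mathcal{N}_1|=0$, $|S\cap\mathcal{N}_2|=i$, $|S\cap\mathcal{N}_4|=q+1-\frac{\#\mathcal{E}_r(\mathbb{F}_q)+i}{2}$, $|S\cap\mathcal{N}_3|=\frac{\#\mathcal{E}_r(\mathbb{F}_q)-3i}{6}$, and $|S\cap\mathcal{N}_5|=\frac{\#\mathcal{E}_r(\mathbb{F}_q)}{3}$. (2) If $f_L\in\mathcal{F}_2'\cup\mathcal{F}_4'$, then $|S\cap\mathcal{N}_1|=|S\cap\mathcal{N}_2|=0$, $|S\cap\mathcal{N}_4|=q+1-\frac{\#\mathcal{E}_r(\mathbb{F}_q)}{2}$, $|S\cap\mathcal{N}_3|=\frac{\#\mathcal{E}_r(\mathbb{F}_q)}{6}$, and $|S\cap\mathcal{N}_5|=\frac{\#\mathcal{E}_r(\mathbb{F}_q)}{3}$.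
   Context: Points of $PG(3,q)$ are written $(y_0:y_1:y_2:y_3)$; the twisted cubic is $C=\{(s^3:s^2t:st^2:t^3)\}$, with $C(K)$ the analogous set over a field $K\supseteq\mathbb{F}_q$. The osculating plane at $(s^3:s^2t:st^2:t^3)$ is $t^3y_0-s^3y_3=0$. A line is generic if it does not meet $C(\overline{\mathbb{F}_q})$ and is not contained in any osculating plane of $C$. For the line $L$ through distinct points $x,y$, Plücker coordinates are $p_{ij}=x_iy_j-x_jy_i$ and $f_L=p_{23}X^4+p_{13}X^3Y+p_{03}X^2Y^2+p_{02}XY^3+p_{01}Y^4$. For a quartic form $f=\sum z_iX^{4-i}Y^i$, $\Delta(f)=(z_0z_4-z_1z_3)^3+(z_0z_4-z_1z_3)^2z_2^2-z_2^3(z_0z_3^2+z_4z_1^2-z_0z_2z_4)$ and $\jmath(f)=z_2^6/\Delta(f)$ when $\Delta(f)\ne0$. Forms with $\Delta\ne0$ are of type $\mathcal{F}_4$ (four linear factors over $\mathbb{F}_q$), $\mathcal{F}_2$ (two linear and one irreducible quadratic factor), $\mathcal{F}_1$ (one linear and one irreducible cubic factor), $\mathcal{F}_4'$ (two irreducible quadratic factors), $\mathcal{F}_2'$ (irreducible). A plane $a_0y_0+a_1y_1+a_2y_2+a_3y_3=0$ is identified with the binary cubic form $a_0X^3+a_1X^2Y+a_2XY^2+a_3Y^3$ (up to scalar). The plane classes are: $\mathcal{N}_1$: the cubic is the cube of a linear form; $\mathcal{N}_2$: it is $\ell_1^2\ell_2$ with $\ell_1,\ell_2$ independent linear forms over $\mathbb{F}_q$;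 $\mathcal{N}_3$: product of three pairwise independent linear forms over $\mathbb{F}_q$; $\mathcal{N}_4$: product of a linear form and an irreducible quadratic over $\mathbb{F}_q$; $\mathcal{N}_5$: irreducible over $\mathbb{F}_q$. For $r\in\mathbb{F}_q^\times$, $\mathcal{E}_r$ is the elliptic curve $x^2=y^3+y^2-r^{ -1}$ and $\#\mathcal{E}_r(\mathbb{F}_q)$ is the number of its $\mathbb{F}_q$-rational points in the projective plane, including the point at infinity. -}

module Defs where

open import Level using (0ℓ)
open import Data.Nat using (ℕ; zero; suc; _≤_) renaming (_+_ to _+ℕ_)
open import Data.List using (List; []; _∷_; length; map)
open import Data.List.Membership.Propositional using (_∈_)
open import Data.List.Relation.Unary.Unique.Propositional using (Unique)
open import Data.List.Relation.Unary.Any using (Any)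
open import Data.Vec using (Vec; []; _∷_; lookup) renaming (map to vmap)
open import Data.Fin using (Fin)
open import Data.Fin.Patterns using (0F; 1F; 2F; 3F)
open import Data.Product using (Σ; ∃; _×_; _,_)
open import Data.Sum using (_⊎_)
open import Data.Empty using (⊥)
open import Function.Bundles using (_⇔_)
open import Relation.Nullary using (¬_)
open import Relation.Binary.PropositionalEquality using (_≡_)
open import Algebra.Structures using (IsCommutativeRing)

Card : {A : Set} → (A → Set) → ℕ → Set
Card {A} P n = Σ (List A) λ xs → Unique xs × (∀ a → P a ⇔ (a ∈ xs)) × length xs ≡ n

-- Fields (commutative rings with 0 ≠ 1 in which nonzero elements are
-- invertible), with propositional equality.  _⁻¹ is a total operation
-- whose value at 0 is irrelevant.

record Field : Set₁ where
  infixl 7 _*_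
  infixl 6 _+_
  field
    Carrier : Set
    _+_ _*_ : Carrier → Carrier → Carrier
    -_ : Carrier → Carrier
    0# 1# : Carrier
    _⁻¹ : Carrier → Carrier
    isCommutativeRing : IsCommutativeRing _≡_ _+_ _*_ -_ 0# 1#
    0≢1 : ¬ (0# ≡ 1#)
    inverseʳ : ∀ x → ¬ (x ≡ 0#) → x * (x ⁻¹) ≡ 1#

record Hom (F K : Field) : Set where
  module F = Field F
  module K = Field K
  field
    ⟦_⟧ : F.Carrier → K.Carrier
    +-hom : ∀ a b → ⟦ F._+_ a b ⟧ ≡ K._+_ ⟦ a ⟧ ⟦ b ⟧
    *-hom : ∀ a b → ⟦ F._*_ a b ⟧ ≡ K._*_ ⟦ a ⟧ ⟦ b ⟧
    1-hom : ⟦ F.1# ⟧ ≡ K.1#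

module Over (F : Field) where
  open Field F

  infixl 6 _-_
  infixr 8 _^_
  _-_ : Carrier → Carrier → Carrier
  a - b = a + (- b)

  _^_ : Carrier → ℕ → Carrier
  a ^ zero = 1#
  a ^ suc n = a * (a ^ n)

  -- Points / planes of PG(n-1,F) are represented by their unique
  -- normalised coordinate vector: the first nonzero coordinate is 1.
  Normalized : ∀ {n} → Vec Carrier n → Set
  Normalized [] = ⊥
  Normalized (x ∷ xs) = (x ≡ 1#) ⊎ ((x ≡ 0#) × Normalized xs)

  -- Binary forms: the list [c₀, …, c_d] stands for Σ cᵢ X^(d-i) Y^i.

  addF : List Carrier → List Carrier → List Carrier
  addF [] q = q
  addF (a ∷ p) [] = a ∷ p
  addF (a ∷ p) (b ∷ q) = (a + b) ∷ addF p q

  scale : Carrier → List Carrier → List Carrier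
  scale c p = map (c *_) p

  mulF : List Carrier → List Carrier → List Carrier
  mulF [] q = []
  mulF (a ∷ p) q = addF (scale a q) (0# ∷ mulF p q)

  Form : ℕ → List Carrier → Set
  Form d p = length p ≡ suc d

  NonzeroF : List Carrier → Set
  NonzeroF p = Any (λ c → ¬ (c ≡ 0#)) p

  Linear : List Carrier → Set
  Linear p = Form 1 p × NonzeroF p

  Irreducible : ℕ → List Carrier → Set
  Irreducible d p = Form d p × NonzeroF p ×
    (∀ d₁ d₂ g h → 1 ≤ d₁ → 1 ≤ d₂ → d₁ +ℕ d₂ ≡ d → Form d₁ g → Form d₂ h →
       ¬ (p ≡ mulF g h))

  Independent : List Carrier → List Carrier → Set
  Independent ℓ₁ ℓ₂ = ∀ c → ¬ (ℓ₂ ≡ scale c ℓ₁)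

  Δ : List Carrier → Carrier
  Δ (z₀ ∷ z₁ ∷ z₂ ∷ z₃ ∷ z₄ ∷ []) =
    ((z₀ * z₄ - z₁ * z₃) ^ 3) + ((z₀ * z₄ - z₁ * z₃) ^ 2) * (z₂ ^ 2)
      - (z₂ ^ 3) * (z₀ * (z₃ ^ 2) + z₄ * (z₁ ^ 2) - z₀ * z₂ * z₄)
  Δ _ = 0#

  z₂of : List Carrier → Carrier
  z₂of (z₀ ∷ z₁ ∷ z₂ ∷ _) = z₂
  z₂of _ = 0#

  ȷ : List Carrier → Carrier
  ȷ f = (z₂of f ^ 6) * (Δ f ⁻¹)

  NonsingQuartic : List Carrier → Set
  NonsingQuartic f = Form 4 f × ¬ (Δ f ≡ 0#)

  𝓕₄ 𝓕₂ 𝓕₁ 𝓕₄′ 𝓕₂′ : List Carrier → Set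
  𝓕₄ f = NonsingQuartic f × ∃ λ ℓ₁ → ∃ λ ℓ₂ → ∃ λ ℓ₃ → ∃ λ ℓ₄ →
    Linear ℓ₁ × Linear ℓ₂ × Linear ℓ₃ × Linear ℓ₄ ×
    f ≡ mulF ℓ₁ (mulF ℓ₂ (mulF ℓ₃ ℓ₄))
  𝓕₂ f = NonsingQuartic f × ∃ λ ℓ₁ → ∃ λ ℓ₂ → ∃ λ Q →
    Linear ℓ₁ × Linear ℓ₂ × Irreducible 2 Q × f ≡ mulF ℓ₁ (mulF ℓ₂ Q)
  𝓕₁ f = NonsingQuartic f × ∃ λ ℓ → ∃ λ C →
    Linear ℓ × Irreducible 3 C × f ≡ mulF ℓ C
  𝓕₄′ f = NonsingQuartic f × ∃ λ Q₁ → ∃ λ Q₂ →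
    Irreducible 2 Q₁ × Irreducible 2 Q₂ × f ≡ mulF Q₁ Q₂
  𝓕₂′ f = NonsingQuartic f × Irreducible 4 f

  Vec4 : Set
  Vec4 = Vec Carrier 4

  zero4 : Vec4
  zero4 = 0# ∷ 0# ∷ 0# ∷ 0# ∷ []

  scale4 : Carrier → Vec4 → Vec4
  scale4 c v = vmap (c *_) v

  DistinctPoints : Vec4 → Vec4 → Set
  DistinctPoints x y = ¬ (x ≡ zero4) × ¬ (y ≡ zero4) × (∀ c → ¬ (y ≡ scale4 c x))

  p : Vec4 → Vec4 → Fin 4 → Fin 4 → Carrier
  p x y i j = lookup x i * lookup y j - lookup x j * lookup y i

  fL : Vec4 → Vec4 → List Carrier
  fL x y = p x y 2F 3F ∷ p x y 1F 3F ∷ p x y 0F 3F ∷ p x y 0F 2F ∷ p x y 0F 1F ∷ []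

  dot : Vec4 → Vec4 → Carrier
  dot a x = lookup a 0F * lookup x 0F + lookup a 1F * lookup x 1F
          + lookup a 2F * lookup x 2F + lookup a 3F * lookup x 3F

  PlaneThrough : Vec4 → Vec4 → Vec4 → Set
  PlaneThrough x y a = dot a x ≡ 0# × dot a y ≡ 0#

  cubicOf : Vec4 → List Carrier
  cubicOf (a₀ ∷ a₁ ∷ a₂ ∷ a₃ ∷ []) = a₀ ∷ a₁ ∷ a₂ ∷ a₃ ∷ []

  𝓝₁ 𝓝₂ 𝓝₃ 𝓝₄ 𝓝₅ : Vec4 → Set
  𝓝₁ a = ∃ λ c → ∃ λ ℓ → ¬ (c ≡ 0#) × Linear ℓ ×
    cubicOf a ≡ scale c (mulF ℓ (mulF ℓ ℓ))
  𝓝₂ a = ∃ λ c → ∃ λ ℓ₁ → ∃ λ ℓ₂ → ¬ (c ≡ 0#) × Linear ℓ₁ × Linear ℓ₂ ×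
    Independent ℓ₁ ℓ₂ × cubicOf a ≡ scale c (mulF ℓ₁ (mulF ℓ₁ ℓ₂))
  𝓝₃ a = ∃ λ c → ∃ λ ℓ₁ → ∃ λ ℓ₂ → ∃ λ ℓ₃ → ¬ (c ≡ 0#) ×
    Linear ℓ₁ × Linear ℓ₂ × Linear ℓ₃ ×
    Independent ℓ₁ ℓ₂ × Independent ℓ₁ ℓ₃ × Independent ℓ₂ ℓ₃ ×
    cubicOf a ≡ scale c (mulF ℓ₁ (mulF ℓ₂ ℓ₃))
  𝓝₄ a = ∃ λ c → ∃ λ ℓ → ∃ λ Q → ¬ (c ≡ 0#) × Linear ℓ × Irreducible 2 Q ×
    cubicOf a ≡ scale c (mulF ℓ Q)
  𝓝₅ a = Irreducible 3 (cubicOf a)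

  PlanesIn : Vec4 → Vec4 → (Vec4 → Set) → Vec4 → Set
  PlanesIn x y N a = Normalized a × PlaneThrough x y a × N a

  -- The elliptic curve E_r : x² = y³ + y² − r⁻¹, projectively
  -- X²Z = Y³ + Y²Z − r⁻¹Z³ in PG(2,F).

  OnE : Carrier → Vec Carrier 3 → Set
  OnE r (X ∷ Y ∷ Z ∷ []) =
    (X ^ 2) * Z ≡ (Y ^ 3) + (Y ^ 2) * Z - (r ⁻¹) * (Z ^ 3)

  EPoint : Carrier → Vec Carrier 3 → Set
  EPoint r v = Normalized v × OnE r v

-- Genericity of the line through x, y ∈ F⁴ (points over F), tested over
-- every extension field K of F (equivalently over the algebraic closure).

module _ (F : Field) where
  open Over F

  Generic : Vec4 → Vec4 → Set₁
  Generic x y = ∀ (K : Field) (φ : Hom F K) →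
    let open Field K renaming (_+_ to _+K_; _*_ to _*K_; -_ to -K_; 0# to 0K; 1# to 1K)
        open Hom φ
        open Over K using () renaming (_^_ to _^K_; _-_ to _-K_)
        x′ = vmap ⟦_⟧ x
        y′ = vmap ⟦_⟧ y
    in
    -- (i) L does not meet C(K)
    (∀ s t → ¬ (s ≡ 0K × t ≡ 0K) → ∀ λ′ μ →
       ¬ (((s ^K 3) ∷ ((s ^K 2) *K t) ∷ (s *K (t ^K 2)) ∷ (t ^K 3) ∷ [])
          ≡ Data.Vec.zipWith _+K_ (vmap (λ′ *K_) x′) (vmap (μ *K_) y′)))
    ×
    -- (ii) L is not contained in the osculating plane t³y₀ − s³y₃ = 0
    (∀ s t → ¬ (s ≡ 0K × t ≡ 0K) →
       ¬ ( ((t ^K 3) *K lookup x′ 0F) -K ((s ^K 3) *K lookup x′ 3F) ≡ 0K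
         × ((t ^K 3) *K lookup y′ 0F) -K ((s ^K 3) *K lookup y′ 3F) ≡ 0K))

{-# OPTIONS --safe #-}
module Submission where

-- Since Δ(f_L) ≠ 0, the Plücker relation gives p₀₃ ≠ 0; dividing by it turns f_L into a quartic f with middle
-- coefficient 1.  A plane a through L is determined by (X : Y) = (a₂ : a₁).  In characteristic 3 the discriminant
-- of its cubic is f(X, Y), and the value of the cubic at S is −(X f_X(S) + Y f_Y(S)).  Hence a plane is in 𝓝₂, 𝓝₄
-- or 𝓝₃ ∪ 𝓝₅ according to whether f(X, Y) is zero, a nonsquare or a nonzero square, its cubic then having 2, 1,
-- and 3 or 0 zeros.  (On a suitable affine line the cubic is d t³ − e² t − b with d = f(X, Y), and d t³ − e² t is
-- additive.)  As f_X and f_Y have no common zero, every point S lies on exactly one of these cubics, so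
-- n₂ + n₃ + n₄ + n₅ = q + 1 = 2n₂ + 3n₃ + n₄.  The curve Z² = f(X, Y) has n₂ + 2n₃ + 2n₅ points, and it remains
-- to show that this number is #𝓔_r.  If f has a nonzero square value s², move it to infinity and remove the
-- next coefficient, so that f = s²t⁴ + t² + z₃t + z₄; with Z = w + st² the equation becomes quadratic in t, and its
-- discriminant, as a cubic in w, is the equation of 𝓔_r.  If f has no such value, then n₃ = n₅ = 0, hence
-- n₂ = 0, all planes are in 𝓝₄ and the ratio of two members of the pencil permutes the field; its first two
-- power sums then force Δ(f_L) = 0.

-- `Δ` has degree 6 in the coefficients, so dividing f_L by p₀₃ turns ȷ(f_L)⁻¹ into `Δ₁` of the
-- normalised quartic. Translation and reversal of the quartic preserve `Δ₁`, and it reappears as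
-- the constant term of the discriminant cubic in w; this is why the curve obtained is 𝓔_r itself
-- and not a twist of it. The substitution Z = w + st² is defined over the field only if the leading
-- coefficient is a nonzero square, which makes quartics without nonzero square values the one
-- obstacle. They are excluded without any bound on the number of points of a curve: all values
-- would be nonsquares, a rational function φ would permute the field, and Σ φ and Σ φ² reduce to
-- the sums of 1/(t² - n) and 1/(t² - n)² for a nonsquare n. A projectivity preserving t² = n yields
-- a linear equation for each of these two sums. The relations among the counts stay in ℕ, free of
-- subtraction and division, and arise by exchanging sums over the projective line.

open import Defs
open import Level using (0ℓ)
open import Algebra.Bundles using (CommutativeRing; RawRing)
open import Algebra.Structures using (IsCommutativeMonoid; IsCommutativeRing)
open import Data.Bool using (Bool; true; false; T)
open import Data.Empty using (⊥; ⊥-elim)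
import Data.Fin as Fin
open import Data.List using (List; []; _∷_; _++_; length; map; filter; cartesianProduct)
open import Data.List.Membership.Propositional using (_∈_; find; lose)
open import Data.List.Membership.Propositional.Properties using (∈-∃++; ∈-map⁺; ∈-map⁻; ∈-++⁺ˡ; ∈-++⁺ʳ; ∈-++⁻; ∈-filter⁺; ∈-filter⁻; ∈-cartesianProduct⁺)
open import Data.List.Membership.Propositional.Properties.WithK using (unique∧set⇒bag)
open import Data.List.Membership.Setoid.Properties using (index-injective)
open import Data.List.Properties using (length-map; map-∘; map-id-local; ∷-injective)
open import Data.List.Relation.Binary.BagAndSetEquality using (∼bag⇒↭)
open import Data.List.Relation.Binary.Permutation.Propositional as ↭ using (_↭_)
open import Data.List.Relation.Binary.Permutation.Propositional.Properties using (↭-length; shift)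
open import Data.List.Relation.Unary.All as All using (All)
open import Data.List.Relation.Unary.All.Properties using (¬Any⇒All¬; All¬⇒¬Any)
open import Data.List.Relation.Unary.AllPairs using ([]; _∷_)
open import Data.List.Relation.Unary.Any using (here; there; any?; index; satisfied)
open import Data.List.Relation.Unary.Unique.Propositional using (Unique)
import Data.List.Relation.Unary.Unique.Propositional.Properties as Unique
open import Data.Maybe using (nothing)
open import Data.Nat as ℕ using (ℕ; zero; suc; _≤_; z≤n; s≤s)
import Data.Nat.Properties as ℕ
open import Data.Nat.Solver using (module +-*-Solver)
open import Data.Product using (∃; ∃₂; _×_; _,_; proj₁; proj₂)
open import Data.Sum using (_⊎_; inj₁; inj₂; [_,_]′)
open import Data.Unit using (⊤; tt)
open import Data.Vec using (Vec; []; _∷_; tabulate) renaming (map to vmap)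
open import Function using (_∘_; case_of_)
open import Function.Bundles using (mk⇔; Equivalence)
open import Relation.Binary.Definitions using (DecidableEquality)
open import Relation.Binary.PropositionalEquality hiding ([_]; J)
open import Relation.Nullary using (¬_; Dec; yes; no)
open import Relation.Nullary.Decidable using (map′; ¬?; _×-dec_; _⊎-dec_; decidable-stable)
open import Relation.Unary using (Decidable)
open import Tactic.RingSolver.Core.AlmostCommutativeRing using (AlmostCommutativeRing; fromCommutativeRing)
open import Tactic.RingSolver.Core.Expression using (Expr; _⊕_; _⊗_; _⊛_; ⊝_; Κ; Ι; module Eval)
open import Tactic.RingSolver.Core.Polynomial.Parameters using (RawCoeff; Homomorphism)

open +-*-Solver using (con; _:+_; _:*_; _:=_) renaming (solve to solveℕ)

-- Counting by sums of indicators

private variable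
  A B : Set

⊆⇒length≤ : {xs ys : List A} → Unique xs → (∀ {a} → a ∈ xs → a ∈ ys) → length xs ≤ length ys
⊆⇒length≤ {xs = []} u s = z≤n
⊆⇒length≤ {A = A} {xs = x ∷ xs} (x∉xs ∷ u) s with ∈-∃++ (s (here refl))
... | as , bs , refl = ℕ.≤-trans (s≤s (⊆⇒length≤ u xs⊆)) (ℕ.≤-reflexive (sym (↭-length (shift x as bs))))
  where
  xs⊆ : ∀ {a} → a ∈ xs → a ∈ as ++ bs
  xs⊆ a∈xs with ∈-++⁻ as (s (there a∈xs))
  ... | inj₁ a∈as = ∈-++⁺ˡ a∈as
  ... | inj₂ (there a∈bs) = ∈-++⁺ʳ as a∈bs
  ... | inj₂ (here refl) = ⊥-elim (All¬⇒¬Any x∉xs a∈xs)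

-- Two monoids are meant: (ℕ, +) for counts and the additive group of the field for power sums.
module Summation {M : Set} {_∙_ : M → M → M} {ε : M} (isCM : IsCommutativeMonoid _≡_ _∙_ ε) where
  open IsCommutativeMonoid isCM using (assoc; comm; identityˡ)

  ∑ : List A → (A → M) → M
  ∑ []       f = ε
  ∑ (x ∷ xs) f = f x ∙ ∑ xs f

  ∑-cong : ∀ (xs : List A) {f g : A → M} → (∀ x → f x ≡ g x) → ∑ xs f ≡ ∑ xs g
  ∑-cong []       f≗g = refl
  ∑-cong (x ∷ xs) f≗g = cong₂ _∙_ (f≗g x) (∑-cong xs f≗g)

  ∑-ε : ∀ (xs : List A) → ∑ xs (λ _ → ε) ≡ ε
  ∑-ε []       = refl
  ∑-ε (x ∷ xs) = trans (identityˡ _) (∑-ε xs)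

  interchange : ∀ a b c d → (a ∙ b) ∙ (c ∙ d) ≡ (a ∙ c) ∙ (b ∙ d)
  interchange a b c d = begin
    (a ∙ b) ∙ (c ∙ d) ≡⟨ assoc a b (c ∙ d) ⟩
    a ∙ (b ∙ (c ∙ d)) ≡⟨ cong (a ∙_) (assoc b c d) ⟨
    a ∙ ((b ∙ c) ∙ d) ≡⟨ cong (λ e → a ∙ (e ∙ d)) (comm b c) ⟩
    a ∙ ((c ∙ b) ∙ d) ≡⟨ cong (a ∙_) (assoc c b d) ⟩
    a ∙ (c ∙ (b ∙ d)) ≡⟨ assoc a c (b ∙ d) ⟨
    (a ∙ c) ∙ (b ∙ d) ∎
    where open ≡-Reasoning

  ∑-distrib-∙ : ∀ (xs : List A) (f g : A → M) → ∑ xs (λ x → f x ∙ g x) ≡ ∑ xs f ∙ ∑ xs g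
  ∑-distrib-∙ []       f g = sym (identityˡ ε)
  ∑-distrib-∙ (x ∷ xs) f g = trans (cong ((f x ∙ g x) ∙_) (∑-distrib-∙ xs f g)) (interchange _ _ _ _)

  ∑-comm : ∀ (xs : List A) (ys : List B) (f : A → B → M) →
           ∑ xs (λ x → ∑ ys (f x)) ≡ ∑ ys (λ y → ∑ xs (λ x → f x y))
  ∑-comm []       ys f = sym (∑-ε ys)
  ∑-comm (x ∷ xs) ys f = trans (cong (∑ ys (f x) ∙_) (∑-comm xs ys f)) (sym (∑-distrib-∙ ys (f x) _))

  ∑-map : ∀ (h : A → B) xs (f : B → M) → ∑ (map h xs) f ≡ ∑ xs (f ∘ h)
  ∑-map h []       f = refl
  ∑-map h (x ∷ xs) f = cong (f (h x) ∙_) (∑-map h xs f)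

  ∑-↭ : ∀ {xs ys : List A} (f : A → M) → xs ↭ ys → ∑ xs f ≡ ∑ ys f
  ∑-↭ f ↭.refl         = refl
  ∑-↭ f (↭.prep x p)   = cong (f x ∙_) (∑-↭ f p)
  ∑-↭ f (↭.swap x y p) = trans (sym (assoc _ _ _))
    (trans (cong₂ _∙_ (comm (f x) (f y)) (∑-↭ f p)) (assoc _ _ _))
  ∑-↭ f (↭.trans p r)  = trans (∑-↭ f p) (∑-↭ f r)

  -- A monoid has no subtraction, so a change of the function at the single place a is expressed by
  -- exchanging f a and g a. This treats separately the points where a fractional linear map passes
  -- through infinity.
  ∑-except : ∀ {xs : List A} {a} (f g : A → M) → Unique xs → a ∈ xs → (∀ x → x ≢ a → f x ≡ g x) →
             g a ∙ ∑ xs f ≡ f a ∙ ∑ xs g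
  ∑-except {xs = x ∷ xs} f g (x∉xs ∷ u) (here refl) f≗g = begin
    g x ∙ (f x ∙ ∑ xs f) ≡⟨ assoc _ _ _ ⟨
    (g x ∙ f x) ∙ ∑ xs f ≡⟨ cong₂ _∙_ (comm (g x) (f x)) (∑-cong-∉ xs x∉xs) ⟩
    (f x ∙ g x) ∙ ∑ xs g ≡⟨ assoc _ _ _ ⟩
    f x ∙ (g x ∙ ∑ xs g) ∎
    where
    open ≡-Reasoning
    ∑-cong-∉ : ∀ ys → All (x ≢_) ys → ∑ ys f ≡ ∑ ys g
    ∑-cong-∉ []       All.[]       = refl
    ∑-cong-∉ (y ∷ ys) (x≢y All.∷ r) = cong₂ _∙_ (f≗g y (x≢y ∘ sym)) (∑-cong-∉ ys r)
  ∑-except {xs = x ∷ xs} {a} f g (x∉xs ∷ u) (there a∈xs) f≗g = begin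
    g a ∙ (f x ∙ ∑ xs f) ≡⟨ x∙yz≡y∙xz _ _ _ ⟩
    f x ∙ (g a ∙ ∑ xs f) ≡⟨ cong₂ _∙_ (f≗g x λ { refl → All¬⇒¬Any x∉xs a∈xs }) (∑-except f g u a∈xs f≗g) ⟩
    g x ∙ (f a ∙ ∑ xs g) ≡⟨ x∙yz≡y∙xz _ _ _ ⟩
    f a ∙ (g x ∙ ∑ xs g) ∎
    where
    open ≡-Reasoning
    x∙yz≡y∙xz : ∀ x y z → x ∙ (y ∙ z) ≡ y ∙ (x ∙ z)
    x∙yz≡y∙xz x y z = trans (sym (assoc x y z)) (trans (cong (_∙ z) (comm x y)) (assoc y x z))

open Summation ℕ.+-0-isCommutativeMonoid public

𝟙 : {P : Set} → Dec P → ℕ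
𝟙 (yes _) = 1
𝟙 (no  _) = 0

𝟙-cong : {P Q : Set} (P? : Dec P) (Q? : Dec Q) → (P → Q) → (Q → P) → 𝟙 P? ≡ 𝟙 Q?
𝟙-cong (yes p) (yes q) f g = refl
𝟙-cong (yes p) (no ¬q) f g = ⊥-elim (¬q (f p))
𝟙-cong (no ¬p) (yes q) f g = ⊥-elim (¬p (g q))
𝟙-cong (no ¬p) (no ¬q) f g = refl

𝟙-yes : {P : Set} (P? : Dec P) → P → 𝟙 P? ≡ 1
𝟙-yes P? p = 𝟙-cong P? (yes p) (λ x → x) (λ x → x)

𝟙-no : {P : Set} (P? : Dec P) → ¬ P → 𝟙 P? ≡ 0
𝟙-no P? ¬p = 𝟙-cong P? (no ¬p) (λ x → x) (λ x → x)

length-filter-∑ : {P : A → Set} (P? : Decidable P) (xs : List A) → length (filter P? xs) ≡ ∑ xs (𝟙 ∘ P?)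
length-filter-∑ P? []       = refl
length-filter-∑ P? (x ∷ xs) with P? x
... | yes _ = cong suc (length-filter-∑ P? xs)
... | no  _ = length-filter-∑ P? xs

∑-1 : (xs : List A) → ∑ xs (λ _ → 1) ≡ length xs
∑-1 []       = refl
∑-1 (x ∷ xs) = cong suc (∑-1 xs)

∑-0 : (xs : List A) {f : A → ℕ} → (∀ x → f x ≡ 0) → ∑ xs f ≡ 0
∑-0 xs f≗0 = trans (∑-cong xs f≗0) (∑-ε xs)

∑≡0⇒≡0 : {xs : List A} (f : A → ℕ) → ∑ xs f ≡ 0 → ∀ {x} → x ∈ xs → f x ≡ 0
∑≡0⇒≡0 {xs = x ∷ xs} f h (here refl) with f x
... | zero = refl
∑≡0⇒≡0 {xs = x ∷ xs} f h (there p) with f x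
... | zero = ∑≡0⇒≡0 f h p

∑-*ˡ : ∀ k (xs : List A) (f : A → ℕ) → ∑ xs (λ x → k ℕ.* f x) ≡ k ℕ.* ∑ xs f
∑-*ˡ zero    xs f = ∑-ε xs
∑-*ˡ (suc k) xs f = trans (∑-distrib-∙ xs f _) (cong (∑ xs f ℕ.+_) (∑-*ˡ k xs f))

∑-𝟙-singleton : {xs : List A} {P : A → Set} (P? : Decidable P) → Unique xs →
  ∀ {a} → a ∈ xs → P a → (∀ x → P x → x ≡ a) → ∑ xs (𝟙 ∘ P?) ≡ 1
∑-𝟙-singleton {xs = xs} P? u {a} a∈xs Pa only = begin
  ∑ xs (𝟙 ∘ P?)                 ≡⟨ ∑-except (𝟙 ∘ P?) (λ _ → 0) u a∈xs (λ x x≢a → 𝟙-no (P? x) (x≢a ∘ only x)) ⟩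
  𝟙 (P? a) ℕ.+ ∑ xs (λ _ → 0)     ≡⟨ cong₂ ℕ._+_ (𝟙-yes (P? a) Pa) (∑-ε xs) ⟩
  1                             ∎
  where open ≡-Reasoning

module FiniteType {A : Set} (els : List A) (unique : Unique els) (∈els : ∀ a → a ∈ els) where

  infix 4 _≟_

  abstract
    _≟_ : DecidableEquality A
    -- Equality in the field is decided by comparing positions in the enumeration.
    a ≟ b = map′ (index-injective (setoid A) (∈els a) (∈els b)) (cong (λ c → index (∈els c))) (index (∈els a) Fin.≟ index (∈els b))

    ∃? : {P : A → Set} → Decidable P → Dec (∃ P)
    ∃? P? = map′ satisfied (λ (a , Pa) → lose (∈els a) Pa) (any? P? els)

  -- Pigeonhole: a value outside the image, put in front of the image, would give a repetition-free
  -- list longer than the enumeration.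
  injective⇒surjective : (f : A → A) → (∀ {x y} → f x ≡ f y → x ≡ y) → ∀ b → ∃ λ a → f a ≡ b
  injective⇒surjective f inj b with ∃? (λ a → f a ≟ b)
  ... | yes p = p
  ... | no ¬p = ⊥-elim (ℕ.n≮n _ (ℕ.≤-trans (s≤s (ℕ.≤-reflexive (sym (length-map f els)))) (⊆⇒length≤ unique′ (λ {a} _ → ∈els a))))
    where
    unique′ : Unique (b ∷ map f els)
    unique′ = ¬Any⇒All¬ _ (λ b∈ → ¬p (let a , _ , b≡fa = ∈-map⁻ f b∈ in a , sym b≡fa)) ∷ Unique.map⁺ inj unique

  map-↭ : (f : A → A) → (∀ {x y} → f x ≡ f y → x ≡ y) → map f els ↭ els
  map-↭ f inj = ∼bag⇒↭ (unique∧set⇒bag (Unique.map⁺ inj unique) unique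
    λ {b} → mk⇔ (λ _ → ∈els b) (λ _ → let a , fa≡b = injective⇒surjective f inj b in subst (_∈ map f els) fa≡b (∈-map⁺ f (∈els a))))

  module Reindex {M : Set} {_∙_ : M → M → M} {ε : M} (isCM : IsCommutativeMonoid _≡_ _∙_ ε) where
    private module S = Summation isCM

    ∑-reindex : (f : A → A) → (∀ {x y} → f x ≡ f y → x ≡ y) → (g : A → M) → S.∑ els (g ∘ f) ≡ S.∑ els g
    ∑-reindex f inj g = trans (sym (S.∑-map f els g)) (S.∑-↭ g (map-↭ f inj))

  open Reindex ℕ.+-0-isCommutativeMonoid public

Card-list : {P : A → Set} (xs : List A) → Unique xs → (∀ a → P a → a ∈ xs) → (∀ a → a ∈ xs → P a) → Card P (length xs)
Card-list xs u f g = xs , u , (λ a → mk⇔ (f a) (g a)) , refl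

Card-unique : {P : A → Set} {m n : ℕ} → Card P m → Card P n → m ≡ n
Card-unique (xs , u , f , refl) (ys , v , g , refl) = ↭-length (∼bag⇒↭ (unique∧set⇒bag u v
  λ {a} → mk⇔ (λ a∈ → Equivalence.to (g a) (Equivalence.from (f a) a∈)) (λ a∈ → Equivalence.to (f a) (Equivalence.from (g a) a∈))))

∑-++ : ∀ {A : Set} (xs ys : List A) (f : A → ℕ) → ∑ (xs ++ ys) f ≡ ∑ xs f ℕ.+ ∑ ys f
∑-++ []       ys f = refl
∑-++ (x ∷ xs) ys f = trans (cong (f x ℕ.+_) (∑-++ xs ys f)) (sym (ℕ.+-assoc (f x) _ _))

∑-cartesianProduct : ∀ {A B : Set} (xs : List A) (ys : List B) (f : A × B → ℕ) →
  ∑ (cartesianProduct xs ys) f ≡ ∑ xs (λ x → ∑ ys (λ y → f (x , y)))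
∑-cartesianProduct []       ys f = refl
∑-cartesianProduct (x ∷ xs) ys f = trans (∑-++ (map (x ,_) ys) _ f) (cong₂ ℕ._+_ (∑-map (x ,_) ys f) (∑-cartesianProduct xs ys f))

Card-cong : ∀ {A : Set} {P R : A → Set} {k} → (∀ a → P a → R a) → (∀ a → R a → P a) → Card P k → Card R k
Card-cong f g (xs , u , P⇔ , len) = xs , u , (λ a → mk⇔ (Equivalence.to (P⇔ a) ∘ g a) (f a ∘ Equivalence.from (P⇔ a))) , len

Characteristic3 : Field → Set
Characteristic3 F = 1# + 1# + 1# ≡ 0#
  where open Field F

-- A ring solver for characteristic 3

-- With coefficients in F₃ rather than ℤ, the normal forms know that 3 = 0.
data F₃ : Set where
  𝟎 𝟏 𝟐 : F₃

_+₃_ _*₃_ : F₃ → F₃ → F₃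
𝟎 +₃ b = b
𝟏 +₃ 𝟎 = 𝟏
𝟏 +₃ 𝟏 = 𝟐
𝟏 +₃ 𝟐 = 𝟎
𝟐 +₃ 𝟎 = 𝟐
𝟐 +₃ 𝟏 = 𝟎
𝟐 +₃ 𝟐 = 𝟏
𝟎 *₃ b = 𝟎
𝟏 *₃ b = b
𝟐 *₃ 𝟎 = 𝟎
𝟐 *₃ 𝟏 = 𝟐
𝟐 *₃ 𝟐 = 𝟏

-₃_ : F₃ → F₃
-₃ 𝟎 = 𝟎
-₃ 𝟏 = 𝟐
-₃ 𝟐 = 𝟏

isZero₃ : F₃ → Bool
isZero₃ 𝟎 = true
isZero₃ 𝟏 = false
isZero₃ 𝟐 = false

rawF₃ : RawRing 0ℓ 0ℓ
rawF₃ = record { Carrier = F₃ ; _≈_ = _≡_ ; _+_ = _+₃_ ; _*_ = _*₃_ ; -_ = -₃_ ; 0# = 𝟎 ; 1# = 𝟏 }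

coeff₃ : RawCoeff 0ℓ 0ℓ
coeff₃ = record { rawRing = rawF₃ ; isZero = isZero₃ }

module Char3Solver (F : Field) (1+1+1≡0 : Characteristic3 F) where

  open Field F

  commutativeRing : CommutativeRing 0ℓ 0ℓ
  commutativeRing = record { isCommutativeRing = isCommutativeRing }

  open CommutativeRing commutativeRing public using
    (+-assoc; +-comm; +-identityˡ; +-identityʳ; -‿inverseˡ; -‿inverseʳ;
     *-assoc; *-comm; *-identityˡ; *-identityʳ; distribˡ; distribʳ; zeroˡ; zeroʳ; ring; +-commutativeMonoid)

  open import Algebra.Properties.Ring ring public using (-‿distribˡ-*; -0#≈0#; -‿involutive; +-cancelˡ; +-cancelʳ)

  ACR : AlmostCommutativeRing 0ℓ 0ℓ
  ACR = fromCommutativeRing commutativeRing (λ _ → nothing)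

  ⟦_⟧₃ : F₃ → Carrier
  ⟦ 𝟎 ⟧₃ = 0#
  ⟦ 𝟏 ⟧₃ = 1#
  ⟦ 𝟐 ⟧₃ = - 1#

  1+1≡-1 : 1# + 1# ≡ - 1#
  1+1≡-1 = trans (sym (+-identityʳ _)) (trans (cong ((1# + 1#) +_) (sym (-‿inverseʳ 1#)))
    (trans (sym (+-assoc _ _ _)) (trans (cong (_+ - 1#) 1+1+1≡0) (+-identityˡ _))))

  -1-1≡1 : - 1# + - 1# ≡ 1#
  -1-1≡1 = trans (cong (_+ - 1#) (sym 1+1≡-1)) (trans (+-assoc _ _ _) (trans (cong (1# +_) (-‿inverseʳ 1#)) (+-identityʳ _)))

  +₃-homo : ∀ a b → ⟦ a +₃ b ⟧₃ ≡ ⟦ a ⟧₃ + ⟦ b ⟧₃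
  +₃-homo 𝟎 b = sym (+-identityˡ _)
  +₃-homo 𝟏 𝟎 = sym (+-identityʳ _)
  +₃-homo 𝟏 𝟏 = sym 1+1≡-1
  +₃-homo 𝟏 𝟐 = sym (-‿inverseʳ 1#)
  +₃-homo 𝟐 𝟎 = sym (+-identityʳ _)
  +₃-homo 𝟐 𝟏 = sym (-‿inverseˡ 1#)
  +₃-homo 𝟐 𝟐 = sym -1-1≡1

  *₃-homo : ∀ a b → ⟦ a *₃ b ⟧₃ ≡ ⟦ a ⟧₃ * ⟦ b ⟧₃
  *₃-homo 𝟎 b = sym (zeroˡ _)
  *₃-homo 𝟏 b = sym (*-identityˡ _)
  *₃-homo 𝟐 𝟎 = sym (zeroʳ _)
  *₃-homo 𝟐 𝟏 = sym (*-identityʳ _)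
  *₃-homo 𝟐 𝟐 = sym (trans (sym (-‿distribˡ-* 1# (- 1#))) (trans (cong -_ (*-identityˡ _)) (-‿involutive 1#)))

  -₃-homo : ∀ a → ⟦ -₃ a ⟧₃ ≡ - ⟦ a ⟧₃
  -₃-homo 𝟎 = sym -0#≈0#
  -₃-homo 𝟏 = refl
  -₃-homo 𝟐 = sym (-‿involutive 1#)

  isZero₃-homo : ∀ a → T (isZero₃ a) → 0# ≡ ⟦ a ⟧₃
  isZero₃-homo 𝟎 _ = refl

  homo : Homomorphism 0ℓ 0ℓ 0ℓ 0ℓ
  homo = record
    { from = coeff₃ ; to = ACR
    ; morphism = record { ⟦_⟧ = ⟦_⟧₃ ; +-homo = +₃-homo ; *-homo = *₃-homo ; -‿homo = -₃-homo ; 0-homo = refl ; 1-homo = refl }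
    ; Zero-C⟶Zero-R = isZero₃-homo }

  open Eval (CommutativeRing.rawRing commutativeRing) ⟦_⟧₃ public
  open import Tactic.RingSolver.Core.Polynomial.Base coeff₃
  open import Tactic.RingSolver.Core.Polynomial.Semantics homo renaming (⟦_⟧ to ⟦_⟧ₚ)
  open import Tactic.RingSolver.Core.Polynomial.Homomorphism homo
  open Tactic.RingSolver.Core.Expression

  norm : ∀ {n} → Expr F₃ n → Poly n
  norm (Κ x)   = κ x
  norm (Ι x)   = ι x
  norm (x ⊕ y) = norm x ⊞ norm y
  norm (x ⊗ y) = norm x ⊠ norm y
  norm (⊝ x)   = ⊟ norm x
  norm (x ⊛ i) = norm x ⊡ i

  norm-correct : ∀ {n} (e : Expr F₃ n) ρ → ⟦ norm e ⟧ₚ ρ ≡ ⟦ e ⟧ ρ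
  norm-correct (Κ x)   ρ = κ-hom x ρ
  norm-correct (Ι x)   ρ = ι-hom x ρ
  norm-correct (x ⊕ y) ρ = trans (⊞-hom (norm x) (norm y) ρ) (cong₂ _+_ (norm-correct x ρ) (norm-correct y ρ))
  norm-correct (x ⊗ y) ρ = trans (⊠-hom (norm x) (norm y) ρ) (cong₂ _*_ (norm-correct x ρ) (norm-correct y ρ))
  norm-correct (⊝ x)   ρ = trans (⊟-hom (norm x) ρ) (cong -_ (norm-correct x ρ))
  norm-correct (x ⊛ i) ρ = trans (⊡-hom (norm x) i ρ) (cong (λ z → Field-pow z i) (norm-correct x ρ))
    where open import Algebra.Definitions.RawSemiring (AlmostCommutativeRing.rawSemiring ACR) using () renaming (_^′_ to Field-pow)

  isZeroPoly : ∀ {n} → Poly n → Bool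
  isZeroPoly (Κ x ⊐ _) = isZero₃ x
  isZeroPoly (⅀ _ ⊐ _) = false

  isZeroPoly-sound : ∀ {n} (p : Poly n) ρ → T (isZeroPoly p) → ⟦ p ⟧ₚ ρ ≡ 0#
  isZeroPoly-sound (Κ x ⊐ _) ρ t = sym (isZero₃-homo x t)

  x-y≡0⇒x≡y : ∀ x y → x + - y ≡ 0# → x ≡ y
  x-y≡0⇒x≡y x y h = +-cancelʳ (- y) x y (trans h (sym (-‿inverseʳ y)))

  infix 4 _⊜_
  _⊜_ : ∀ {n} → Expr F₃ n → Expr F₃ n → Expr F₃ n × Expr F₃ n
  _⊜_ = _,_

  vars : ∀ n → Vec (Expr F₃ n) n
  vars n = tabulate Ι

  identity : ∀ {n} (e₁ e₂ : Expr F₃ n) → T (isZeroPoly (norm (e₁ ⊕ ⊝ e₂))) → ∀ ρ → ⟦ e₁ ⟧ ρ ≡ ⟦ e₂ ⟧ ρ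
  identity e₁ e₂ t ρ = x-y≡0⇒x≡y _ _ (trans (sym (norm-correct (e₁ ⊕ ⊝ e₂) ρ)) (isZeroPoly-sound (norm (e₁ ⊕ ⊝ e₂)) ρ t))

  Curried : ℕ → Set → Set → Set
  Curried ℕ.zero    A B = B
  Curried (ℕ.suc n) A B = A → Curried n A B

  apply : ∀ {n} {A B : Set} → Curried n A B → Vec A n → B
  apply b []       = b
  apply f (x ∷ xs) = apply (f x) xs

  ∀ⁿ : ∀ n → (Vec Carrier n → Set) → Set
  ∀ⁿ ℕ.zero    P = P []
  ∀ⁿ (ℕ.suc n) P = ∀ x → ∀ⁿ n (λ xs → P (x ∷ xs))

  curry∀ : ∀ n {P : Vec Carrier n → Set} → (∀ ρ → P ρ) → ∀ⁿ n P
  curry∀ ℕ.zero    h   = h []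
  curry∀ (ℕ.suc n) h x = curry∀ n (λ xs → h (x ∷ xs))

  Sides : ℕ → Set
  Sides n = Curried n (Expr F₃ n) (Expr F₃ n × Expr F₃ n)

  lhs rhs : ∀ n → Sides n → Expr F₃ n
  lhs n f = proj₁ (apply f (vars n))
  rhs n f = proj₂ (apply f (vars n))

  -- For a true identity the condition computes to the unit type and is inferred, so that no proof
  -- is written at a call. The sides are subtracted first, which leaves only a test for the zero
  -- polynomial.
  solve : ∀ n (f : Sides n) → {T (isZeroPoly (norm (lhs n f ⊕ ⊝ rhs n f)))} →
          ∀ⁿ n (λ ρ → ⟦ lhs n f ⟧ ρ ≡ ⟦ rhs n f ⟧ ρ)
  solve n f {t} = curry∀ n (identity (lhs n f) (rhs n f) t)

#0 #1 : ∀ {n} → Expr F₃ n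
#0 = Κ 𝟎
#1 = Κ 𝟏

infixl 6 _⊖_
_⊖_ : ∀ {n} → Expr F₃ n → Expr F₃ n → Expr F₃ n
x ⊖ y = x ⊕ ⊝ y

𝟙-⊎ : {P Q R : Set} (P? : Dec P) (Q? : Dec Q) (R? : Dec R) →
      (P → Q ⊎ R) → (Q → P) → (R → P) → ¬ (Q × R) → 𝟙 P? ≡ 𝟙 Q? ℕ.+ 𝟙 R?
𝟙-⊎ P? (yes q) (yes r) f g h n = ⊥-elim (n (q , r))
𝟙-⊎ P? (yes q) (no ¬r) f g h n = 𝟙-yes P? (g q)
𝟙-⊎ P? (no ¬q) (yes r) f g h n = 𝟙-yes P? (h r)
𝟙-⊎ P? (no ¬q) (no ¬r) f g h n = 𝟙-no P? λ p → case f p of λ { (inj₁ q) → ¬q q ; (inj₂ r) → ¬r r }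

module _ {n : ℕ} where
  quarticᴱ : (z₀ z₁ z₂ z₃ z₄ X Y : Expr F₃ n) → Expr F₃ n
  quarticᴱ z₀ z₁ z₂ z₃ z₄ X Y = z₀ ⊗ (X ⊗ X ⊗ (X ⊗ X)) ⊕ z₁ ⊗ (X ⊗ X ⊗ (X ⊗ Y)) ⊕ z₂ ⊗ (X ⊗ X ⊗ (Y ⊗ Y)) ⊕ z₃ ⊗ (X ⊗ Y ⊗ (Y ⊗ Y)) ⊕ z₄ ⊗ (Y ⊗ Y ⊗ (Y ⊗ Y))

  -- The unit factors mirror the definition of _^_, so that Δᴱ evaluates to Δ on the nose.
  _²ᴱ _³ᴱ _⁶ᴱ : Expr F₃ n → Expr F₃ n
  a ²ᴱ = a ⊗ (a ⊗ #1)
  a ³ᴱ = a ⊗ a ²ᴱ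
  a ⁶ᴱ = a ⊗ (a ⊗ (a ⊗ a ³ᴱ))

  Δᴱ : (z₀ z₁ z₂ z₃ z₄ : Expr F₃ n) → Expr F₃ n
  Δᴱ z₀ z₁ z₂ z₃ z₄ = (z₀ ⊗ z₄ ⊖ z₁ ⊗ z₃) ³ᴱ ⊕ (z₀ ⊗ z₄ ⊖ z₁ ⊗ z₃) ²ᴱ ⊗ z₂ ²ᴱ ⊖ z₂ ³ᴱ ⊗ (z₀ ⊗ z₃ ²ᴱ ⊕ z₄ ⊗ z₁ ²ᴱ ⊖ z₀ ⊗ z₂ ⊗ z₄)

-- The four kinds of planes and their weighted counts

data Kind : Set where
  tangentᴷ splitᴷ mixedᴷ rootlessᴷ : Kind

infix 4 _≟ᴷ_
_≟ᴷ_ : (j k : Kind) → Dec (j ≡ k)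
tangentᴷ  ≟ᴷ tangentᴷ  = yes refl
tangentᴷ  ≟ᴷ splitᴷ    = no λ ()
tangentᴷ  ≟ᴷ mixedᴷ    = no λ ()
tangentᴷ  ≟ᴷ rootlessᴷ = no λ ()
splitᴷ    ≟ᴷ tangentᴷ  = no λ ()
splitᴷ    ≟ᴷ splitᴷ    = yes refl
splitᴷ    ≟ᴷ mixedᴷ    = no λ ()
splitᴷ    ≟ᴷ rootlessᴷ = no λ ()
mixedᴷ    ≟ᴷ tangentᴷ  = no λ ()
mixedᴷ    ≟ᴷ splitᴷ    = no λ ()
mixedᴷ    ≟ᴷ mixedᴷ    = yes refl
mixedᴷ    ≟ᴷ rootlessᴷ = no λ ()
rootlessᴷ ≟ᴷ tangentᴷ  = no λ ()
rootlessᴷ ≟ᴷ splitᴷ    = no λ ()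
rootlessᴷ ≟ᴷ mixedᴷ    = no λ ()
rootlessᴷ ≟ᴷ rootlessᴷ = yes refl

-- For a plane of the given kind: the zeros of its cubic on the projective line, and the square
-- roots of its discriminant, which are the points of Z² = f(X, Y) above it.
zerosᴷ sqrtsᴷ : Kind → ℕ
zerosᴷ tangentᴷ  = 2
zerosᴷ splitᴷ    = 3
zerosᴷ mixedᴷ    = 1
zerosᴷ rootlessᴷ = 0
sqrtsᴷ tangentᴷ  = 1
sqrtsᴷ splitᴷ    = 2
sqrtsᴷ mixedᴷ    = 0
sqrtsᴷ rootlessᴷ = 2

module _ {A : Set} (kind : A → Kind) (xs : List A) where

  count : Kind → ℕ
  count k = ∑ xs (λ x → 𝟙 (kind x ≟ᴷ k))

  -- Each relation among the four counts comes from a pointwise weight: 1 counts planes, `zerosᴷ`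
  -- incidences and `sqrtsᴷ` points of the double cover.
  ∑-kind : ∀ (w : Kind → ℕ) → ∑ xs (w ∘ kind) ≡
    w tangentᴷ ℕ.* count tangentᴷ ℕ.+ w splitᴷ ℕ.* count splitᴷ ℕ.+ w mixedᴷ ℕ.* count mixedᴷ ℕ.+ w rootlessᴷ ℕ.* count rootlessᴷ
  ∑-kind w = begin
    ∑ xs (w ∘ kind)                                             ≡⟨ ∑-cong xs (pointwise ∘ kind) ⟩
    ∑ xs (λ x → f tangentᴷ x ℕ.+ f splitᴷ x ℕ.+ f mixedᴷ x ℕ.+ f rootlessᴷ x)
      ≡⟨ ∑-distrib-∙ xs (λ x → f tangentᴷ x ℕ.+ f splitᴷ x ℕ.+ f mixedᴷ x) (f rootlessᴷ) ⟩
    ∑ xs (λ x → f tangentᴷ x ℕ.+ f splitᴷ x ℕ.+ f mixedᴷ x) ℕ.+ ∑ xs (f rootlessᴷ)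
      ≡⟨ cong (ℕ._+ ∑ xs (f rootlessᴷ)) (trans (∑-distrib-∙ xs (λ x → f tangentᴷ x ℕ.+ f splitᴷ x) (f mixedᴷ))
           (cong (ℕ._+ ∑ xs (f mixedᴷ)) (∑-distrib-∙ xs (f tangentᴷ) (f splitᴷ)))) ⟩
    ∑ xs (f tangentᴷ) ℕ.+ ∑ xs (f splitᴷ) ℕ.+ ∑ xs (f mixedᴷ) ℕ.+ ∑ xs (f rootlessᴷ)
      ≡⟨ cong₂ ℕ._+_ (cong₂ ℕ._+_ (cong₂ ℕ._+_ (total tangentᴷ) (total splitᴷ)) (total mixedᴷ)) (total rootlessᴷ) ⟩
    w tangentᴷ ℕ.* count tangentᴷ ℕ.+ w splitᴷ ℕ.* count splitᴷ ℕ.+ w mixedᴷ ℕ.* count mixedᴷ ℕ.+ w rootlessᴷ ℕ.* count rootlessᴷ ∎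
    where
    open ≡-Reasoning
    f : Kind → A → ℕ
    f k x = w k ℕ.* 𝟙 (kind x ≟ᴷ k)
    total : ∀ k → ∑ xs (f k) ≡ w k ℕ.* count k
    total k = ∑-*ˡ (w k) xs (λ x → 𝟙 (kind x ≟ᴷ k))
    pointwise : ∀ j → w j ≡ w tangentᴷ ℕ.* 𝟙 (j ≟ᴷ tangentᴷ) ℕ.+ w splitᴷ ℕ.* 𝟙 (j ≟ᴷ splitᴷ) ℕ.+ w mixedᴷ ℕ.* 𝟙 (j ≟ᴷ mixedᴷ) ℕ.+ w rootlessᴷ ℕ.* 𝟙 (j ≟ᴷ rootlessᴷ)
    pointwise tangentᴷ  = solveℕ 4 (λ a b c d → a := a :* con 1 :+ b :* con 0 :+ c :* con 0 :+ d :* con 0) refl (w tangentᴷ) (w splitᴷ) (w mixedᴷ) (w rootlessᴷ)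
    pointwise splitᴷ    = solveℕ 4 (λ a b c d → b := a :* con 0 :+ b :* con 1 :+ c :* con 0 :+ d :* con 0) refl (w tangentᴷ) (w splitᴷ) (w mixedᴷ) (w rootlessᴷ)
    pointwise mixedᴷ    = solveℕ 4 (λ a b c d → c := a :* con 0 :+ b :* con 0 :+ c :* con 1 :+ d :* con 0) refl (w tangentᴷ) (w splitᴷ) (w mixedᴷ) (w rootlessᴷ)
    pointwise rootlessᴷ = solveℕ 4 (λ a b c d → d := a :* con 0 :+ b :* con 0 :+ c :* con 0 :+ d :* con 1) refl (w tangentᴷ) (w splitᴷ) (w mixedᴷ) (w rootlessᴷ)

-- The characteristic from the cardinality

module Characteristic (F : Field) (els : List (Field.Carrier F)) (unique : Unique els) (∈els : ∀ a → a ∈ els) where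

  open Field F
  open FiniteType els unique ∈els
  private
    module R = IsCommutativeRing isCommutativeRing
    module Σ = Summation R.+-isCommutativeMonoid
    module ΣR = Reindex R.+-isCommutativeMonoid

  fromℕ : ℕ → Carrier
  fromℕ zero    = 0#
  fromℕ (suc k) = 1# + fromℕ k

  fromℕ-+ : ∀ k l → fromℕ (k ℕ.+ l) ≡ fromℕ k + fromℕ l
  fromℕ-+ zero    l = sym (R.+-identityˡ _)
  fromℕ-+ (suc k) l = trans (cong (1# +_) (fromℕ-+ k l)) (sym (R.+-assoc _ _ _))

  +1-injective : ∀ {a b} → a + 1# ≡ b + 1# → a ≡ b
  +1-injective {a} {b} e = trans (sym (cancel a)) (trans (cong (_+ - 1#) e) (cancel b))
    where
    cancel : ∀ a → a + 1# + - 1# ≡ a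
    cancel a = trans (R.+-assoc _ _ _) (trans (cong (a +_) (R.-‿inverseʳ 1#)) (R.+-identityʳ a))

  ∑1≡fromℕ : ∀ (xs : List Carrier) → Σ.∑ xs (λ _ → 1#) ≡ fromℕ (length xs)
  ∑1≡fromℕ []       = refl
  ∑1≡fromℕ (x ∷ xs) = cong (1# +_) (∑1≡fromℕ xs)

  -- Translation by 1 permutes the field, so the sum of all elements does not change when 1 is added to each.
  fromℕ-card≡0 : fromℕ (length els) ≡ 0#
  fromℕ-card≡0 = begin
    fromℕ (length els)                 ≡⟨ ∑1≡fromℕ els ⟨
    Σ.∑ els (λ _ → 1#)                 ≡⟨ R.+-identityˡ _ ⟨
    0# + Σ.∑ els (λ _ → 1#)            ≡⟨ cong (_+ Σ.∑ els (λ _ → 1#)) (R.-‿inverseˡ ∑els) ⟨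
    - ∑els + ∑els + Σ.∑ els (λ _ → 1#)       ≡⟨ R.+-assoc _ _ _ ⟩
    - ∑els + (∑els + Σ.∑ els (λ _ → 1#))     ≡⟨ cong (- ∑els +_) (Σ.∑-distrib-∙ els (λ a → a) (λ _ → 1#)) ⟨
    - ∑els + Σ.∑ els (_+ 1#)              ≡⟨ cong (- ∑els +_) (ΣR.∑-reindex (_+ 1#) +1-injective (λ a → a)) ⟩
    - ∑els + ∑els                            ≡⟨ R.-‿inverseˡ ∑els ⟩
    0#                                 ∎
    where
    open ≡-Reasoning
    ∑els : Carrier
    ∑els = Σ.∑ els (λ a → a)

  abstract
    -- If 3 were nonzero, it could be cancelled from 3^k · 1 = 0 again and again until 1 = 0 is
    -- left.
    1+1+1≡0 : ∀ k → fromℕ (3 ℕ.^ k) ≡ 0# → Characteristic3 F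
    1+1+1≡0 zero    e = ⊥-elim (0≢1 (sym (trans (sym (R.+-identityʳ 1#)) e)))
    1+1+1≡0 (suc k) e with 1# + 1# + 1# ≟ 0#
    ... | yes 3≡0 = 3≡0
    ... | no  3≢0 = 1+1+1≡0 k (begin
      x                   ≡⟨ R.*-identityˡ x ⟨
      1# * x              ≡⟨ cong (_* x) (inverseʳ three 3≢0) ⟨
      three * three ⁻¹ * x ≡⟨ cong (_* x) (R.*-comm three (three ⁻¹)) ⟩
      three ⁻¹ * three * x ≡⟨ R.*-assoc _ _ _ ⟩
      three ⁻¹ * (three * x) ≡⟨ cong (three ⁻¹ *_) 3x≡ ⟨
      three ⁻¹ * fromℕ (3 ℕ.^ suc k) ≡⟨ cong (three ⁻¹ *_) e ⟩
      three ⁻¹ * 0#       ≡⟨ R.zeroʳ _ ⟩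
      0#                  ∎)
      where
      open ≡-Reasoning
      three x : Carrier
      three = 1# + 1# + 1#
      x = fromℕ (3 ℕ.^ k)
      3x≡ : fromℕ (3 ℕ.^ suc k) ≡ three * x
      3x≡ = begin
        fromℕ (3 ℕ.^ k ℕ.+ (3 ℕ.^ k ℕ.+ (3 ℕ.^ k ℕ.+ 0))) ≡⟨ cong (λ l → fromℕ (3 ℕ.^ k ℕ.+ (3 ℕ.^ k ℕ.+ l))) (ℕ.+-identityʳ _) ⟩
        fromℕ (3 ℕ.^ k ℕ.+ (3 ℕ.^ k ℕ.+ 3 ℕ.^ k)) ≡⟨ trans (fromℕ-+ (3 ℕ.^ k) _) (cong (x +_) (fromℕ-+ (3 ℕ.^ k) _)) ⟩
        x + (x + x) ≡⟨ R.+-assoc x x x ⟨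
        x + x + x ≡⟨ cong₂ _+_ (cong₂ _+_ (R.*-identityˡ x) (R.*-identityˡ x)) (R.*-identityˡ x) ⟨
        1# * x + 1# * x + 1# * x ≡⟨ cong (_+ 1# * x) (R.distribʳ x 1# 1#) ⟨
        (1# + 1#) * x + 1# * x ≡⟨ R.distribʳ x (1# + 1#) 1# ⟨
        three * x ∎

-- Squares and the projective line in characteristic 3

module FiniteField₃ (F : Field) (1+1+1≡0 : Characteristic3 F)
  (els : List (Field.Carrier F)) (unique : Unique els) (∈els : ∀ a → a ∈ els) where

  open Field F
  open Over F
  open Char3Solver F 1+1+1≡0
  open FiniteType els unique ∈els

  1≢0 : 1# ≢ 0#
  1≢0 = 0≢1 ∘ sym

  -- Linear-combination steps: what is left to prove is a pure ring identity, the task of solve.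
  by : ∀ {a b k x y} → x ≡ y → a + k * y ≡ b + k * x → a ≡ b
  by {a} {b} {k} {x} refl e = +-cancelʳ (k * x) a b e

  by₂ : ∀ {a b k x y l u v} → x ≡ y → u ≡ v → a + k * y + l * v ≡ b + k * x + l * u → a ≡ b
  by₂ refl h e = by refl (by h e)

  a+-b≡0 : ∀ {a b} → a ≡ b → a + - b ≡ 0#
  a+-b≡0 {a} refl = -‿inverseʳ a

  inverseˡ : ∀ {x} → x ≢ 0# → x ⁻¹ * x ≡ 1#
  inverseˡ {x} x≢0 = trans (*-comm _ _) (inverseʳ x x≢0)

  xy≡0⇒y≡0 : ∀ {x y} → x ≢ 0# → x * y ≡ 0# → y ≡ 0#
  xy≡0⇒y≡0 {x} {y} x≢0 xy≡0 = by₂ (inverseʳ x x≢0) xy≡0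
    (solve 3 (λ x x⁻¹ y → y ⊕ ⊝ y ⊗ #1 ⊕ x⁻¹ ⊗ #0 ⊜ #0 ⊕ ⊝ y ⊗ (x ⊗ x⁻¹) ⊕ x⁻¹ ⊗ (x ⊗ y)) x (x ⁻¹) y)

  xy≡0⇒ : ∀ {x y} → x * y ≡ 0# → x ≡ 0# ⊎ y ≡ 0#
  xy≡0⇒ {x} h with x ≟ 0#
  ... | yes x≡0 = inj₁ x≡0
  ... | no x≢0 = inj₂ (xy≡0⇒y≡0 x≢0 h)

  *-≢0 : ∀ {x y} → x ≢ 0# → y ≢ 0# → x * y ≢ 0#
  *-≢0 x≢0 y≢0 h = y≢0 (xy≡0⇒y≡0 x≢0 h)

  *-cancelˡ-≢0 : ∀ {x y z} → x ≢ 0# → x * y ≡ x * z → y ≡ z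
  *-cancelˡ-≢0 {x} {y} {z} x≢0 h = x-y≡0⇒x≡y y z (xy≡0⇒y≡0 x≢0
    (by h (solve 3 (λ x y z → x ⊗ (y ⊖ z) ⊕ #1 ⊗ (x ⊗ z) ⊜ #0 ⊕ #1 ⊗ (x ⊗ y)) x y z)))

  ⁻¹-≢0 : ∀ {x} → x ≢ 0# → x ⁻¹ ≢ 0#
  ⁻¹-≢0 {x} x≢0 h = 1≢0 (trans (sym (inverseʳ x x≢0)) (trans (cong (x *_) h) (zeroʳ x)))

  -≢0 : ∀ {x} → x ≢ 0# → - x ≢ 0#
  -≢0 {x} x≢0 h = x≢0 (trans (sym (-‿involutive x)) (trans (cong -_ h) -0#≈0#))

  x²≡0⇒x≡0 : ∀ {x} → x * x ≡ 0# → x ≡ 0#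
  x²≡0⇒x≡0 h with xy≡0⇒ h
  ... | inj₁ e = e
  ... | inj₂ e = e

  x≡-x⇒x≡0 : ∀ {x} → x ≡ - x → x ≡ 0#
  x≡-x⇒x≡0 {x} h = by h (solve 1 (λ x → x ⊕ ⊝ #1 ⊗ ⊝ x ⊜ #0 ⊕ ⊝ #1 ⊗ x) x)

  *-injective : ∀ {c} → c ≢ 0# → ∀ {x y} → c * x ≡ c * y → x ≡ y
  *-injective c≢0 = *-cancelˡ-≢0 c≢0

  IsSquare : Carrier → Set
  IsSquare d = ∃ λ s → s * s ≡ d

  IsSquare? : Decidable IsSquare
  IsSquare? d = ∃? (λ s → s * s ≟ d)

  IsSquare-scale : ∀ {c d} → c ≢ 0# → IsSquare (c * c * d) → IsSquare d
  IsSquare-scale {c} {d} c≢0 (s , s²≡c²d) = s * c ⁻¹ ,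
    by₂ s²≡c²d (inverseʳ c c≢0) (solve 4 (λ s c c⁻¹ d →
      s ⊗ c⁻¹ ⊗ (s ⊗ c⁻¹) ⊕ c⁻¹ ⊗ c⁻¹ ⊗ (c ⊗ c ⊗ d) ⊕ (d ⊗ (c ⊗ c⁻¹) ⊕ d) ⊗ #1
        ⊜ d ⊕ c⁻¹ ⊗ c⁻¹ ⊗ (s ⊗ s) ⊕ (d ⊗ (c ⊗ c⁻¹) ⊕ d) ⊗ (c ⊗ c⁻¹)) s c (c ⁻¹) d)

  ∑F-singleton : {P : Carrier → Set} (P? : Decidable P) → ∀ {a} → P a → (∀ x → P x → x ≡ a) → ∑ els (𝟙 ∘ P?) ≡ 1
  ∑F-singleton P? {a} = ∑-𝟙-singleton P? unique (∈els a)

  sqrts : Carrier → ℕ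
  sqrts d = ∑ els (λ s → 𝟙 (s * s ≟ d))

  sqrts-0 : sqrts 0# ≡ 1
  sqrts-0 = ∑F-singleton (λ s → s * s ≟ 0#) (zeroˡ 0#) (λ _ → x²≡0⇒x≡0)

  x²≡y²⇒ : ∀ {x y} → x * x ≡ y * y → x ≡ y ⊎ x ≡ - y
  x²≡y²⇒ {x} {y} h with xy≡0⇒ {x + - y} {x + y}
    (by h (solve 2 (λ x y → (x ⊖ y) ⊗ (x ⊕ y) ⊕ #1 ⊗ (y ⊗ y) ⊜ #0 ⊕ #1 ⊗ (x ⊗ x)) x y))
  ... | inj₁ e = inj₁ (x-y≡0⇒x≡y x y e)
  ... | inj₂ e = inj₂ (x-y≡0⇒x≡y x (- y) (trans (cong (x +_) (-‿involutive y)) e))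

  sqrts-square : ∀ {s} → s ≢ 0# → sqrts (s * s) ≡ 2
  sqrts-square {s} s≢0 = begin
    sqrts (s * s) ≡⟨ ∑-cong els (λ x → 𝟙-⊎ (x * x ≟ s * s) (x ≟ s) (x ≟ - s) x²≡y²⇒
      (λ { refl → refl }) (λ { refl → solve 1 (λ s → ⊝ s ⊗ ⊝ s ⊜ s ⊗ s) s })
      λ { (refl , e) → s≢0 (x≡-x⇒x≡0 e) }) ⟩
    ∑ els (λ x → 𝟙 (x ≟ s) ℕ.+ 𝟙 (x ≟ - s)) ≡⟨ ∑-distrib-∙ els _ _ ⟩
    ∑ els (λ x → 𝟙 (x ≟ s)) ℕ.+ ∑ els (λ x → 𝟙 (x ≟ - s))
      ≡⟨ cong₂ ℕ._+_ (∑F-singleton (_≟ s) refl (λ _ e → e)) (∑F-singleton (_≟ - s) refl (λ _ e → e)) ⟩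
    2 ∎
    where open ≡-Reasoning

  sqrts-nonsquare : ∀ {d} → ¬ IsSquare d → sqrts d ≡ 0
  sqrts-nonsquare {d} ¬sq = ∑-0 els (λ s → 𝟙-no (s * s ≟ d) (λ e → ¬sq (s , e)))

  sqrts-scale : ∀ {c} d → c ≢ 0# → sqrts (c * c * d) ≡ sqrts d
  sqrts-scale {c} d c≢0 = trans (sym (∑-reindex (c *_) (*-injective c≢0) (λ s → 𝟙 (s * s ≟ c * c * d))))
    (∑-cong els λ s → 𝟙-cong (c * s * (c * s) ≟ c * c * d) (s * s ≟ d)
      (λ e → *-cancelˡ-≢0 (*-≢0 c≢0 c≢0) (trans (solve 2 (λ c s → c ⊗ c ⊗ (s ⊗ s) ⊜ c ⊗ s ⊗ (c ⊗ s)) c s) e))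
      (λ { refl → solve 2 (λ c s → c ⊗ s ⊗ (c ⊗ s) ⊜ c ⊗ c ⊗ (s ⊗ s)) c s }))

  +-injective : ∀ a {x y} → x + a ≡ y + a → x ≡ y
  +-injective a = +-cancelʳ a _ _

  Nonzero₂ : Carrier → Carrier → Set
  Nonzero₂ X Y = ¬ (X ≡ 0# × Y ≡ 0#)

  -- The projective line.
  points : List (Carrier × Carrier)
  points = (1# , 0#) ∷ map (_, 1#) els

  points-unique : Unique points
  points-unique = ¬Any⇒All¬ _ (λ p → 0≢1 (cong proj₂ (proj₂ (proj₂ (∈-map⁻ (_, 1#) p))))) ∷ Unique.map⁺ (cong proj₁) unique

  ∑ℙ : (Carrier → Carrier → ℕ) → ℕ
  ∑ℙ f = f 1# 0# ℕ.+ ∑ els (λ t → f t 1#)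

  ∑-points : ∀ f → ∑ points (λ (X , Y) → f X Y) ≡ ∑ℙ f
  ∑-points f = cong (f 1# 0# ℕ.+_) (∑-map (_, 1#) els _)

  ∑ℙ-cong : ∀ {f g : Carrier → Carrier → ℕ} → (∀ X Y → Nonzero₂ X Y → f X Y ≡ g X Y) → ∑ℙ f ≡ ∑ℙ g
  ∑ℙ-cong f≗g = cong₂ ℕ._+_ (f≗g 1# 0# (1≢0 ∘ proj₁)) (∑-cong els (λ t → f≗g t 1# (1≢0 ∘ proj₂)))

  ∑ℙ-+ : ∀ f g → ∑ℙ (λ X Y → f X Y ℕ.+ g X Y) ≡ ∑ℙ f ℕ.+ ∑ℙ g
  ∑ℙ-+ f g = trans (cong (f 1# 0# ℕ.+ g 1# 0# ℕ.+_) (∑-distrib-∙ els _ _)) (interchange (f 1# 0#) (g 1# 0#) _ _)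

  zeros : (Carrier → Carrier → Carrier) → ℕ
  zeros f = ∑ℙ (λ X Y → 𝟙 (f X Y ≟ 0#))

  zeros-* : ∀ {f g h} → (∀ X Y → f X Y ≡ g X Y * h X Y) →
            (∀ X Y → Nonzero₂ X Y → ¬ (g X Y ≡ 0# × h X Y ≡ 0#)) → zeros f ≡ zeros g ℕ.+ zeros h
  zeros-* {f} {g} {h} f≗gh disjoint = trans
    (∑ℙ-cong λ X Y nz → 𝟙-⊎ (f X Y ≟ 0#) (g X Y ≟ 0#) (h X Y ≟ 0#)
      (λ e → xy≡0⇒ (trans (sym (f≗gh X Y)) e))
      (λ e → trans (f≗gh X Y) (trans (cong (_* h X Y) e) (zeroˡ _)))
      (λ e → trans (f≗gh X Y) (trans (cong (g X Y *_) e) (zeroʳ _)))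
      (disjoint X Y nz))
    (∑ℙ-+ (λ X Y → 𝟙 (g X Y ≟ 0#)) (λ X Y → 𝟙 (h X Y ≟ 0#)))

  zeros-none : ∀ {f} → (∀ X Y → Nonzero₂ X Y → f X Y ≢ 0#) → zeros f ≡ 0
  zeros-none {f} none = cong₂ ℕ._+_ (𝟙-no (f 1# 0# ≟ 0#) (none 1# 0# (1≢0 ∘ proj₁)))
    (∑-0 els (λ t → 𝟙-no (f t 1# ≟ 0#) (none t 1# (1≢0 ∘ proj₂))))

  linear : Carrier → Carrier → Carrier → Carrier → Carrier
  linear l m X Y = l * X + m * Y

  zeros-linear : ∀ {l m} → Nonzero₂ l m → zeros (linear l m) ≡ 1
  zeros-linear {l} {m} nz with l ≟ 0#
  ... | yes refl = cong₂ ℕ._+_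
    (𝟙-yes (0# * 1# + m * 0# ≟ 0#) (solve 1 (λ m → #0 ⊗ #1 ⊕ m ⊗ #0 ⊜ #0) m))
    (∑-0 els λ t → 𝟙-no (0# * t + m * 1# ≟ 0#) λ e → nz (refl ,
      by e (solve 2 (λ m t → m ⊕ #1 ⊗ #0 ⊜ #0 ⊕ #1 ⊗ (#0 ⊗ t ⊕ m ⊗ #1)) m t)))
  ... | no l≢0 = cong₂ ℕ._+_
    (𝟙-no (l * 1# + m * 0# ≟ 0#) λ e → l≢0
      (by e (solve 2 (λ l m → l ⊕ #1 ⊗ #0 ⊜ #0 ⊕ #1 ⊗ (l ⊗ #1 ⊕ m ⊗ #0)) l m)))
    (∑F-singleton (λ t → l * t + m * 1# ≟ 0#) { - (l ⁻¹) * m}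
      (by (inverseʳ l l≢0) (solve 3 (λ l l⁻¹ m → l ⊗ (⊝ l⁻¹ ⊗ m) ⊕ m ⊗ #1 ⊕ ⊝ m ⊗ #1 ⊜ #0 ⊕ ⊝ m ⊗ (l ⊗ l⁻¹)) l (l ⁻¹) m))
      (λ t e → by₂ (inverseʳ l l≢0) e (solve 4 (λ l l⁻¹ m t →
        t ⊕ ⊝ t ⊗ #1 ⊕ l⁻¹ ⊗ #0 ⊜ ⊝ l⁻¹ ⊗ m ⊕ ⊝ t ⊗ (l ⊗ l⁻¹) ⊕ l⁻¹ ⊗ (l ⊗ t ⊕ m ⊗ #1)) l (l ⁻¹) m t)))

  -- Binary quartics, their double covers and the elliptic curve

  quartic : (z₀ z₁ z₂ z₃ z₄ X Y : Carrier) → Carrier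
  quartic z₀ z₁ z₂ z₃ z₄ X Y = z₀ * (X * X * (X * X)) + z₁ * (X * X * (X * Y)) + z₂ * (X * X * (Y * Y)) + z₃ * (X * Y * (Y * Y)) + z₄ * (Y * Y * (Y * Y))

  Δ₁ : (z₀ z₁ z₃ z₄ : Carrier) → Carrier
  Δ₁ z₀ z₁ z₃ z₄ = Δ (z₀ ∷ z₁ ∷ 1# ∷ z₃ ∷ z₄ ∷ [])

  -- Completing the square: (β - αt)² = α(αt² + βt + γ) + β² - αγ because -2 = 1, and t ↦ β - αt is
  -- a bijection.
  sqrts-quadratic : ∀ {α} β γ → α ≢ 0# → ∑ els (λ t → 𝟙 (α * (t * t) + β * t + γ ≟ 0#)) ≡ sqrts (β * β + - (α * γ))
  sqrts-quadratic {α} β γ α≢0 = sym (trans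
    (sym (∑-reindex (λ t → β + - (α * t)) inj (λ Z → 𝟙 (Z * Z ≟ β * β + - (α * γ)))))
    (∑-cong els λ t → 𝟙-cong (_ ≟ _) (_ ≟ _)
      (λ e → xy≡0⇒y≡0 α≢0 (by e (solve 4 (λ α β γ t →
        α ⊗ (α ⊗ (t ⊗ t) ⊕ β ⊗ t ⊕ γ) ⊕ #1 ⊗ (β ⊗ β ⊖ α ⊗ γ) ⊜ #0 ⊕ #1 ⊗ ((β ⊖ α ⊗ t) ⊗ (β ⊖ α ⊗ t))) α β γ t)))
      (λ e → by e (solve 4 (λ α β γ t →
        (β ⊖ α ⊗ t) ⊗ (β ⊖ α ⊗ t) ⊕ α ⊗ #0 ⊜ β ⊗ β ⊖ α ⊗ γ ⊕ α ⊗ (α ⊗ (t ⊗ t) ⊕ β ⊗ t ⊕ γ)) α β γ t))))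
    where
    inj : ∀ {x y} → β + - (α * x) ≡ β + - (α * y) → x ≡ y
    inj {x} {y} e = *-cancelˡ-≢0 α≢0 (by e (solve 4 (λ α β x y →
      α ⊗ x ⊕ ⊝ #1 ⊗ (β ⊖ α ⊗ y) ⊜ α ⊗ y ⊕ ⊝ #1 ⊗ (β ⊖ α ⊗ x)) α β x y))

  -- Affine points of x² = y³ + y² − δ.
  cubicPoints : Carrier → ℕ
  cubicPoints δ = ∑ els (λ y → sqrts (y * (y * y) + y * y + - δ))

  -- Points of Z² = f(X, Y), f being the quartic with middle coefficient 1.
  doubleCover : (z₀ z₁ z₃ z₄ : Carrier) → ℕ
  doubleCover z₀ z₁ z₃ z₄ = ∑ℙ (λ X Y → sqrts (quartic z₀ z₁ 1# z₃ z₄ X Y))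

  -- Z² = s²t⁴ + t² + z₃t + z₄ becomes quadratic in t after Z = w + s t²; its discriminant in t,
  -- a cubic in w, is the right-hand side of the elliptic curve.
  module NormalForm (s z₃ z₄ : Carrier) (s≢0 : s ≢ 0#) (Δ≢0 : Δ₁ (s * s) 0# z₃ z₄ ≢ 0#) where
    -- The substitution leads to (2sw - 1)t² - z₃t + w² - z₄ = 0. These are its outer coefficients,
    -- with 2 = -1, and its discriminant, with 4 = 1.
    α γ disc : Carrier → Carrier
    α w = - (s * w) + - 1#
    γ w = w * w + - z₄
    disc w = (- z₃) * (- z₃) + - (α w * γ w)

    q : Carrier → Carrier
    q t = quartic (s * s) 0# 1# z₃ z₄ t 1#

    fibre : Carrier → ℕ
    fibre w = ∑ els (λ t → 𝟙 (α w * (t * t) + (- z₃) * t + γ w ≟ 0#))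

    ∑sqrts : ∑ els (λ t → sqrts (q t)) ≡ ∑ els fibre
    ∑sqrts = trans (∑-cong els λ t → trans
        (sym (∑-reindex (_+ s * (t * t)) (+-injective (s * (t * t))) (λ Z → 𝟙 (Z * Z ≟ q t))))
        (∑-cong els λ w → 𝟙-cong (_ ≟ q t) (α w * (t * t) + (- z₃) * t + γ w ≟ 0#)
          (λ e → by e (solve 5 (λ s z₃ z₄ t w →
             (⊝ (s ⊗ w) ⊖ #1) ⊗ (t ⊗ t) ⊕ ⊝ z₃ ⊗ t ⊕ (w ⊗ w ⊖ z₄) ⊕ #1 ⊗ quarticᴱ (s ⊗ s) #0 #1 z₃ z₄ t #1
             ⊜ #0 ⊕ #1 ⊗ ((w ⊕ s ⊗ (t ⊗ t)) ⊗ (w ⊕ s ⊗ (t ⊗ t)))) s z₃ z₄ t w))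
          (λ e → by e (solve 5 (λ s z₃ z₄ t w →
             (w ⊕ s ⊗ (t ⊗ t)) ⊗ (w ⊕ s ⊗ (t ⊗ t)) ⊕ #1 ⊗ #0
             ⊜ quarticᴱ (s ⊗ s) #0 #1 z₃ z₄ t #1 ⊕ #1 ⊗ ((⊝ (s ⊗ w) ⊖ #1) ⊗ (t ⊗ t) ⊕ ⊝ z₃ ⊗ t ⊕ (w ⊗ w ⊖ z₄))) s z₃ z₄ t w))))
      (∑-comm els els _)

    -- α vanishes for a single w. There the equation in t becomes linear: it has one solution
    -- against the two square roots of z₃², or, if z₃ = 0, none against the one square root of 0,
    -- because Δ ≠ 0 keeps γ ≠ 0. Either way exactly one is missing.
    fibre-count : ∀ w → fibre w ℕ.+ 𝟙 (α w ≟ 0#) ≡ sqrts (disc w)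
    fibre-count w with α w ≟ 0#
    ... | no α≢0 = trans (ℕ.+-identityʳ _) (sqrts-quadratic (- z₃) (γ w) α≢0)
    ... | yes α≡0 with z₃ ≟ 0#
    ... | no z₃≢0 = trans (cong (ℕ._+ 1)
        (∑F-singleton (λ t → α w * (t * t) + (- z₃) * t + γ w ≟ 0#) {z₃ ⁻¹ * γ w}
          (by₂ (inverseʳ z₃ z₃≢0) α≡0 (solve 4 (λ a c z r → a ⊗ (r ⊗ c ⊗ (r ⊗ c)) ⊕ ⊝ z ⊗ (r ⊗ c) ⊕ c ⊕ ⊝ c ⊗ #1 ⊕ r ⊗ c ⊗ (r ⊗ c) ⊗ #0
             ⊜ #0 ⊕ ⊝ c ⊗ (z ⊗ r) ⊕ r ⊗ c ⊗ (r ⊗ c) ⊗ a) (α w) (γ w) z₃ (z₃ ⁻¹)))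
          λ t e → by (inverseʳ z₃ z₃≢0) (by₂ α≡0 e (solve 5 (λ a c z r t →
              t ⊕ ⊝ t ⊗ #1 ⊕ r ⊗ t ⊗ t ⊗ #0 ⊕ ⊝ r ⊗ #0 ⊜ r ⊗ c ⊕ ⊝ t ⊗ (z ⊗ r) ⊕ r ⊗ t ⊗ t ⊗ a ⊕ ⊝ r ⊗ (a ⊗ (t ⊗ t) ⊕ ⊝ z ⊗ t ⊕ c)) (α w) (γ w) z₃ (z₃ ⁻¹) t))))
        (sym (trans (cong sqrts (by α≡0 (solve 3 (λ a c z → ⊝ z ⊗ ⊝ z ⊖ a ⊗ c ⊕ ⊝ c ⊗ #0 ⊜ z ⊗ z ⊕ ⊝ c ⊗ a) (α w) (γ w) z₃))) (sqrts-square z₃≢0)))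
    ... | yes refl = trans (cong (ℕ._+ 1)
        (∑-0 els λ t → 𝟙-no (_ ≟ 0#) λ e → Δ≢0 (Δ≡0 (γ≡0 t e))))
        (sym (trans (cong sqrts (by α≡0 (solve 2 (λ a c → ⊝ #0 ⊗ ⊝ #0 ⊖ a ⊗ c ⊕ ⊝ c ⊗ #0 ⊜ #0 ⊕ ⊝ c ⊗ a) (α w) (γ w)))) sqrts-0))
      where
      γ≡0 : ∀ t → α w * (t * t) + (- 0#) * t + γ w ≡ 0# → γ w ≡ 0#
      γ≡0 t e = by₂ e α≡0 (solve 3 (λ a c t → c ⊕ #1 ⊗ #0 ⊕ ⊝ (t ⊗ t) ⊗ #0 ⊜ #0 ⊕ #1 ⊗ (a ⊗ (t ⊗ t) ⊕ ⊝ #0 ⊗ t ⊕ c) ⊕ ⊝ (t ⊗ t) ⊗ a) (α w) (γ w) t)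
      s²z₄≡1 : γ w ≡ 0# → s * s * z₄ ≡ 1#
      s²z₄≡1 g = by₂ α≡0 g (solve 3 (λ s z₄ w →
        s ⊗ s ⊗ z₄ ⊕ (#1 ⊖ s ⊗ w) ⊗ #0 ⊕ ⊝ (s ⊗ s) ⊗ #0 ⊜ #1 ⊕ (#1 ⊖ s ⊗ w) ⊗ (⊝ (s ⊗ w) ⊖ #1) ⊕ ⊝ (s ⊗ s) ⊗ (w ⊗ w ⊖ z₄)) s z₄ w)
      -- Here z₁ = z₃ = 0. With d = s²z₄ this gives Δ₁ = d³ + d² + d = d(d - 1)², while α w = γ w =
      -- 0 forces d = 1.
      Δ≡0 : γ w ≡ 0# → Δ₁ (s * s) 0# 0# z₄ ≡ 0#
      Δ≡0 g = by (s²z₄≡1 g) (solve 2 (λ s z₄ → let d = s ⊗ s ⊗ z₄ in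
        Δᴱ (s ⊗ s) #0 #1 #0 z₄ ⊕ d ⊗ (d ⊖ #1) ⊗ #1 ⊜ #0 ⊕ d ⊗ (d ⊖ #1) ⊗ d) s z₄)

    ∑α : ∑ els (λ w → 𝟙 (α w ≟ 0#)) ≡ 1
    ∑α = ∑F-singleton (λ w → α w ≟ 0#) { - (s ⁻¹)}
      (by (inverseʳ s s≢0) (solve 2 (λ s r → ⊝ (s ⊗ ⊝ r) ⊖ #1 ⊕ #1 ⊗ #1 ⊜ #0 ⊕ #1 ⊗ (s ⊗ r)) s (s ⁻¹)))
      (λ w e → by₂ (inverseʳ s s≢0) e (solve 3 (λ s r w →
        w ⊕ (⊝ w) ⊗ #1 ⊕ (⊝ r) ⊗ #0 ⊜ ⊝ r ⊕ (⊝ w) ⊗ (s ⊗ r) ⊕ (⊝ r) ⊗ (⊝ (s ⊗ w) ⊖ #1)) s (s ⁻¹) w))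

    shift-injective : ∀ {x y} → s ⁻¹ * (x + - (s * s * z₄)) ≡ s ⁻¹ * (y + - (s * s * z₄)) → x ≡ y
    shift-injective e = +-injective _ (*-cancelˡ-≢0 (⁻¹-≢0 s≢0) e)

    -- With v = sw and d = s²z₄ one has s² disc = s²z₃² + (v + 1)(v² - d). The translation v = y - d
    -- leaves the linear coefficient -3d = 0 and the constant term -Δ₁.
    disc-cubic : ∀ y → s * s * disc (s ⁻¹ * (y + - (s * s * z₄))) ≡ y * (y * y) + y * y + - Δ₁ (s * s) 0# z₃ z₄
    disc-cubic y = trans (cong (λ v → s * s * (- z₃ * - z₃ + - (((- v) + - 1#) * (w * w + - z₄)))) sw)
      (trans (solve 5 (λ s z₃ z₄ v w →
         s ⊗ s ⊗ (⊝ z₃ ⊗ ⊝ z₃ ⊖ (⊝ v ⊖ #1) ⊗ (w ⊗ w ⊖ z₄)) ⊜ s ⊗ s ⊗ (⊝ z₃ ⊗ ⊝ z₃) ⊕ (v ⊕ #1) ⊗ (s ⊗ w ⊗ (s ⊗ w) ⊖ s ⊗ s ⊗ z₄)) s z₃ z₄ v w)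
      (trans (cong (λ u → s * s * (- z₃ * - z₃) + (v + 1#) * (u * u + - (s * s * z₄))) sw)
         (solve 4 (λ s z₃ z₄ y → let v = y ⊖ s ⊗ s ⊗ z₄ in
           s ⊗ s ⊗ (⊝ z₃ ⊗ ⊝ z₃) ⊕ (v ⊕ #1) ⊗ (v ⊗ v ⊖ s ⊗ s ⊗ z₄) ⊜ y ⊗ (y ⊗ y) ⊕ y ⊗ y ⊖ Δᴱ (s ⊗ s) #0 #1 z₃ z₄) s z₃ z₄ y)))
      where
      v w : Carrier
      v = y + - (s * s * z₄)
      w = s ⁻¹ * v
      sw : s * w ≡ v
      sw = by (inverseʳ s s≢0) (solve 3 (λ s r v → s ⊗ (r ⊗ v) ⊕ v ⊗ #1 ⊜ v ⊕ v ⊗ (s ⊗ r)) s (s ⁻¹) v)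

    ∑disc : ∑ els (λ w → sqrts (disc w)) ≡ cubicPoints (Δ₁ (s * s) 0# z₃ z₄)
    ∑disc = trans (sym (∑-reindex (λ y → s ⁻¹ * (y + - (s * s * z₄))) shift-injective (λ w → sqrts (disc w))))
      (∑-cong els λ y → trans (sym (sqrts-scale (disc (s ⁻¹ * (y + - (s * s * z₄)))) s≢0)) (cong sqrts (disc-cubic y)))

    doubleCover-normal : doubleCover (s * s) 0# z₃ z₄ ≡ 1 ℕ.+ cubicPoints (Δ₁ (s * s) 0# z₃ z₄)
    doubleCover-normal = begin
      sqrts (quartic (s * s) 0# 1# z₃ z₄ 1# 0#) ℕ.+ ∑ els (λ t → sqrts (q t))
        ≡⟨ cong₂ ℕ._+_ (trans (cong sqrts (solve 3 (λ s z₃ z₄ → quarticᴱ (s ⊗ s) #0 #1 z₃ z₄ #1 #0 ⊜ s ⊗ s) s z₃ z₄)) (sqrts-square s≢0)) ∑sqrts ⟩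
      -- One of the two points above (1 : 0) makes up for the solution missing at the zero of α; the
      -- other plays the point at infinity of the elliptic curve.
      2 ℕ.+ ∑ els fibre ≡⟨ cong ℕ.suc (ℕ.+-comm 1 _) ⟩
      1 ℕ.+ (∑ els fibre ℕ.+ 1) ≡⟨ cong (λ k → 1 ℕ.+ (∑ els fibre ℕ.+ k)) ∑α ⟨
      1 ℕ.+ (∑ els fibre ℕ.+ ∑ els (λ w → 𝟙 (α w ≟ 0#))) ≡⟨ cong ℕ.suc (∑-distrib-∙ els _ _) ⟨
      1 ℕ.+ ∑ els (λ w → fibre w ℕ.+ 𝟙 (α w ≟ 0#)) ≡⟨ cong ℕ.suc (∑-cong els fibre-count) ⟩
      1 ℕ.+ ∑ els (λ w → sqrts (disc w)) ≡⟨ cong ℕ.suc ∑disc ⟩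
      1 ℕ.+ cubicPoints (Δ₁ (s * s) 0# z₃ z₄) ∎
      where open ≡-Reasoning

  module _ {n : ℕ} where
    shift₁ᴱ : (z₀ z₁ ε : Expr F₃ n) → Expr F₃ n
    shift₁ᴱ z₀ z₁ ε = z₁ ⊕ ε ⊗ z₀

    shift₃ᴱ : (z₀ z₃ ε : Expr F₃ n) → Expr F₃ n
    shift₃ᴱ z₀ z₃ ε = z₃ ⊖ ε ⊕ ε ⊗ ε ⊗ ε ⊗ z₀

    shift₄ᴱ : (z₀ z₁ z₃ z₄ ε : Expr F₃ n) → Expr F₃ n
    shift₄ᴱ z₀ z₁ z₃ z₄ ε = quarticᴱ z₀ z₁ #1 z₃ z₄ ε #1

  shift₁ : (z₀ z₁ ε : Carrier) → Carrier
  shift₁ z₀ z₁ ε = z₁ + ε * z₀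

  shift₃ : (z₀ z₃ ε : Carrier) → Carrier
  shift₃ z₀ z₃ ε = z₃ + - ε + ε * ε * ε * z₀

  shift₄ : (z₀ z₁ z₃ z₄ ε : Carrier) → Carrier
  shift₄ z₀ z₁ z₃ z₄ ε = quartic z₀ z₁ 1# z₃ z₄ ε 1#

  -- (z₀, z₁, 1, z₃, z₄) ∘ (X, Y) ↦ (X + ε Y, Y); in characteristic 3 the middle coefficient does not move.
  quartic-shift : ∀ z₀ z₁ z₃ z₄ ε X Y →
    quartic z₀ (shift₁ z₀ z₁ ε) 1# (shift₃ z₀ z₃ ε) (shift₄ z₀ z₁ z₃ z₄ ε) X Y ≡ quartic z₀ z₁ 1# z₃ z₄ (X + ε * Y) Y
  quartic-shift = solve 7 (λ z₀ z₁ z₃ z₄ ε X Y →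
    quarticᴱ z₀ (shift₁ᴱ z₀ z₁ ε) #1 (shift₃ᴱ z₀ z₃ ε) (shift₄ᴱ z₀ z₁ z₃ z₄ ε) X Y ⊜ quarticᴱ z₀ z₁ #1 z₃ z₄ (X ⊕ ε ⊗ Y) Y)

  Δ-shift : ∀ z₀ z₁ z₃ z₄ ε → Δ₁ z₀ (shift₁ z₀ z₁ ε) (shift₃ z₀ z₃ ε) (shift₄ z₀ z₁ z₃ z₄ ε) ≡ Δ₁ z₀ z₁ z₃ z₄
  Δ-shift = solve 5 (λ z₀ z₁ z₃ z₄ ε →
    Δᴱ z₀ (shift₁ᴱ z₀ z₁ ε) #1 (shift₃ᴱ z₀ z₃ ε) (shift₄ᴱ z₀ z₁ z₃ z₄ ε) ⊜ Δᴱ z₀ z₁ #1 z₃ z₄)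

  doubleCover-shift : ∀ z₀ z₁ z₃ z₄ ε →
    doubleCover z₀ (shift₁ z₀ z₁ ε) (shift₃ z₀ z₃ ε) (shift₄ z₀ z₁ z₃ z₄ ε) ≡ doubleCover z₀ z₁ z₃ z₄
  doubleCover-shift z₀ z₁ z₃ z₄ ε = cong₂ ℕ._+_
    (cong sqrts (trans (quartic-shift z₀ z₁ z₃ z₄ ε 1# 0#)
      (cong (λ x → quartic z₀ z₁ 1# z₃ z₄ x 0#) (solve 1 (λ ε → #1 ⊕ ε ⊗ #0 ⊜ #1) ε))))
    (trans (∑-cong els λ t → cong sqrts (quartic-shift z₀ z₁ z₃ z₄ ε t 1#))
      (∑-reindex (_+ ε * 1#) (+-injective _) (λ t → sqrts (quartic z₀ z₁ 1# z₃ z₄ t 1#))))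

  quartic-reverse : ∀ z₀ z₁ z₃ z₄ X Y → quartic z₄ z₃ 1# z₁ z₀ X Y ≡ quartic z₀ z₁ 1# z₃ z₄ Y X
  quartic-reverse = solve 6 (λ z₀ z₁ z₃ z₄ X Y → quarticᴱ z₄ z₃ #1 z₁ z₀ X Y ⊜ quarticᴱ z₀ z₁ #1 z₃ z₄ Y X)

  quartic-homogeneous : ∀ z₀ z₁ z₂ z₃ z₄ c X Y → quartic z₀ z₁ z₂ z₃ z₄ (c * X) (c * Y) ≡ c * c * (c * c) * quartic z₀ z₁ z₂ z₃ z₄ X Y
  quartic-homogeneous = solve 8 (λ z₀ z₁ z₂ z₃ z₄ c X Y →
    quarticᴱ z₀ z₁ z₂ z₃ z₄ (c ⊗ X) (c ⊗ Y) ⊜ c ⊗ c ⊗ (c ⊗ c) ⊗ quarticᴱ z₀ z₁ z₂ z₃ z₄ X Y)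

  Δ-reverse : ∀ z₀ z₁ z₃ z₄ → Δ₁ z₄ z₃ z₁ z₀ ≡ Δ₁ z₀ z₁ z₃ z₄
  Δ-reverse = solve 4 (λ z₀ z₁ z₃ z₄ → Δᴱ z₄ z₃ #1 z₁ z₀ ⊜ Δᴱ z₀ z₁ #1 z₃ z₄)

  -- Inversion extended by 0 ↦ 0, which makes it a permutation of the field.
  inv₀ : Carrier → Carrier
  inv₀ x with x ≟ 0#
  ... | yes _ = 0#
  ... | no  _ = x ⁻¹

  inv₀-0 : inv₀ 0# ≡ 0#
  inv₀-0 with 0# ≟ 0#
  ... | yes _ = refl
  ... | no n = ⊥-elim (n refl)

  inv₀-≢0 : ∀ {x} → x ≢ 0# → inv₀ x ≡ x ⁻¹
  inv₀-≢0 {x} x≢0 with x ≟ 0#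
  ... | yes e = ⊥-elim (x≢0 e)
  ... | no _ = refl

  inv₀-injective : ∀ {x y} → inv₀ x ≡ inv₀ y → x ≡ y
  inv₀-injective {x} {y} e with x ≟ 0# | y ≟ 0#
  ... | yes p | yes r = trans p (sym r)
  ... | yes p | no r  = ⊥-elim (⁻¹-≢0 r (sym e))
  ... | no p  | yes r = ⊥-elim (⁻¹-≢0 p e)
  ... | no p  | no r  = by₂ (inverseʳ x p) (trans (cong (y *_) e) (inverseʳ y r))
    (solve 3 (λ x y i → x ⊕ y ⊗ #1 ⊕ ⊝ x ⊗ #1 ⊜ y ⊕ y ⊗ (x ⊗ i) ⊕ ⊝ x ⊗ (y ⊗ i)) x y (x ⁻¹))

  doubleCover-reverse : ∀ z₀ z₁ z₃ z₄ → doubleCover z₄ z₃ z₁ z₀ ≡ doubleCover z₀ z₁ z₃ z₄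
  doubleCover-reverse z₀ z₁ z₃ z₄ = begin
    g 1# 0# ℕ.+ ∑ els (λ t → g t 1#)
      ≡⟨ cong (g 1# 0# ℕ.+_) (∑-reindex inv₀ inv₀-injective (λ t → g t 1#)) ⟨
    g 1# 0# ℕ.+ ∑ els (λ t → g (inv₀ t) 1#)
      ≡⟨ cong₂ ℕ._+_ (g-swap 1# 0#) (refl {x = ∑ els (λ t → g (inv₀ t) 1#)}) ⟩
    f 0# 1# ℕ.+ ∑ els (λ t → g (inv₀ t) 1#)
      -- `inv₀` fixes 0, where t ↦ 1/t would give ∞, so the summands at 0 and ∞ are exchanged
      -- separately.
      ≡⟨ ∑-except (λ t → g (inv₀ t) 1#) (λ t → f t 1#) unique (∈els 0#) agree ⟩
    g (inv₀ 0#) 1# ℕ.+ ∑ els (λ t → f t 1#)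
      ≡⟨ cong (ℕ._+ ∑ els (λ t → f t 1#)) (trans (cong (λ x → g x 1#) inv₀-0) (g-swap 0# 1#)) ⟩
    f 1# 0# ℕ.+ ∑ els (λ t → f t 1#) ∎
    where
    open ≡-Reasoning
    f g : Carrier → Carrier → ℕ
    f X Y = sqrts (quartic z₀ z₁ 1# z₃ z₄ X Y)
    g X Y = sqrts (quartic z₄ z₃ 1# z₁ z₀ X Y)
    g-swap : ∀ X Y → g X Y ≡ f Y X
    g-swap X Y = cong sqrts (quartic-reverse z₀ z₁ z₃ z₄ X Y)
    agree : ∀ t → t ≢ 0# → g (inv₀ t) 1# ≡ f t 1#
    agree t t≢0 = trans (cong (λ x → g x 1#) (inv₀-≢0 t≢0)) (trans (g-swap (t ⁻¹) 1#)
      (trans (sym (sqrts-scale _ (*-≢0 t≢0 t≢0))) (cong sqrts (trans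
        (sym (quartic-homogeneous z₀ z₁ 1# z₃ z₄ t 1# (t ⁻¹)))
        (cong₂ (quartic z₀ z₁ 1# z₃ z₄) (*-identityʳ t) (inverseʳ t t≢0))))))

  -- Moving a nonzero square value to infinity and completing the quartic brings it to normal form.
  doubleCover-count : ∀ z₀ z₁ z₃ z₄ → Δ₁ z₀ z₁ z₃ z₄ ≢ 0# →
    ∀ {s} X Y → s ≢ 0# → s * s ≡ quartic z₀ z₁ 1# z₃ z₄ X Y → Y ≡ 1# ⊎ (X ≡ 1# × Y ≡ 0#) →
    doubleCover z₀ z₁ z₃ z₄ ≡ 1 ℕ.+ cubicPoints (Δ₁ z₀ z₁ z₃ z₄)
  doubleCover-count z₀ z₁ z₃ z₄ Δ≢0 {s} _ _ s≢0 s²≡ (inj₂ (refl , refl)) = begin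
    doubleCover z₀ z₁ z₃ z₄                   ≡⟨ doubleCover-shift z₀ z₁ z₃ z₄ ε ⟨
    doubleCover z₀ (shift₁ z₀ z₁ ε) z₃′ z₄′   ≡⟨ cong₂ (λ a b → doubleCover a b z₃′ z₄′) z₀≡s² z₁′≡0 ⟩
    doubleCover (s * s) 0# z₃′ z₄′            ≡⟨ NormalForm.doubleCover-normal s z₃′ z₄′ s≢0 (λ e → Δ≢0 (trans (sym Δ≡) e)) ⟩
    1 ℕ.+ cubicPoints (Δ₁ (s * s) 0# z₃′ z₄′) ≡⟨ cong (λ d → 1 ℕ.+ cubicPoints d) Δ≡ ⟩
    1 ℕ.+ cubicPoints (Δ₁ z₀ z₁ z₃ z₄)        ∎
    where
    open ≡-Reasoning
    z₀≡s² : z₀ ≡ s * s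
    z₀≡s² = by s²≡ (solve 5 (λ z₀ z₁ z₃ z₄ s² → z₀ ⊕ ⊝ #1 ⊗ quarticᴱ z₀ z₁ #1 z₃ z₄ #1 #0 ⊜ s² ⊕ ⊝ #1 ⊗ s²) z₀ z₁ z₃ z₄ (s * s))
    z₀≢0 : z₀ ≢ 0#
    z₀≢0 e = *-≢0 s≢0 s≢0 (trans (sym z₀≡s²) e)
    ε z₃′ z₄′ : Carrier
    ε = - (z₁ * z₀ ⁻¹)
    z₃′ = shift₃ z₀ z₃ ε
    z₄′ = shift₄ z₀ z₁ z₃ z₄ ε
    z₁′≡0 : shift₁ z₀ z₁ ε ≡ 0#
    z₁′≡0 = by (inverseʳ z₀ z₀≢0) (solve 3 (λ z₀ z₁ r → z₁ ⊕ ⊝ (z₁ ⊗ r) ⊗ z₀ ⊕ ⊝ z₁ ⊗ #1 ⊜ #0 ⊕ ⊝ z₁ ⊗ (z₀ ⊗ r)) z₀ z₁ (z₀ ⁻¹))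
    Δ≡ : Δ₁ (s * s) 0# z₃′ z₄′ ≡ Δ₁ z₀ z₁ z₃ z₄
    Δ≡ = trans (cong₂ (λ a b → Δ₁ a b z₃′ z₄′) (sym z₀≡s²) (sym z₁′≡0)) (Δ-shift z₀ z₁ z₃ z₄ ε)
  -- Translation by t makes the square value s² = f(t, 1) the last coefficient, and reversal makes
  -- it the leading one; both preserve the double cover and `Δ₁`.
  doubleCover-count z₀ z₁ z₃ z₄ Δ≢0 {s} t _ s≢0 s²≡ (inj₁ refl) = begin
    doubleCover z₀ z₁ z₃ z₄       ≡⟨ doubleCover-shift z₀ z₁ z₃ z₄ t ⟨
    doubleCover z₀ z₁′ z₃′ z₄′    ≡⟨ doubleCover-reverse z₀ z₁′ z₃′ z₄′ ⟨
    doubleCover z₄′ z₃′ z₁′ z₀    ≡⟨ doubleCover-count z₄′ z₃′ z₁′ z₀ (λ e → Δ≢0 (trans (sym Δ≡) e)) 1# 0# s≢0 s²≡′ (inj₂ (refl , refl)) ⟩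
    1 ℕ.+ cubicPoints (Δ₁ z₄′ z₃′ z₁′ z₀) ≡⟨ cong (λ d → 1 ℕ.+ cubicPoints d) Δ≡ ⟩
    1 ℕ.+ cubicPoints (Δ₁ z₀ z₁ z₃ z₄)    ∎
    where
    open ≡-Reasoning
    z₁′ z₃′ z₄′ : Carrier
    z₁′ = shift₁ z₀ z₁ t
    z₃′ = shift₃ z₀ z₃ t
    z₄′ = shift₄ z₀ z₁ z₃ z₄ t
    Δ≡ : Δ₁ z₄′ z₃′ z₁′ z₀ ≡ Δ₁ z₀ z₁ z₃ z₄
    Δ≡ = trans (Δ-reverse z₀ z₁′ z₃′ z₄′) (Δ-shift z₀ z₁ z₃ z₄ t)
    s²≡′ : s * s ≡ quartic z₄′ z₃′ 1# z₁′ z₀ 1# 0#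
    s²≡′ = trans s²≡ (sym (solve 4 (λ z₄ z₃ z₁ z₀ → quarticᴱ z₄ z₃ #1 z₁ z₀ #1 #0 ⊜ z₄) z₄′ z₃′ z₁′ z₀))

  -- Power sums over the field

  private
    +-isCM = IsCommutativeRing.+-isCommutativeMonoid isCommutativeRing
    module Σ = Summation +-isCM
    module ΣR = Reindex +-isCM

  S : (Carrier → Carrier) → Carrier
  S = Σ.∑ els

  S-cong : ∀ {f g} → (∀ t → f t ≡ g t) → S f ≡ S g
  S-cong = Σ.∑-cong els

  S-+ : ∀ f g → S (λ t → f t + g t) ≡ S f + S g
  S-+ = Σ.∑-distrib-∙ els

  S-* : ∀ c f → S (λ t → c * f t) ≡ c * S f
  S-* c f = go els
    where
    go : ∀ xs → Σ.∑ xs (λ t → c * f t) ≡ c * Σ.∑ xs f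
    go []       = sym (zeroʳ c)
    go (x ∷ xs) = trans (cong (c * f x +_) (go xs)) (sym (distribˡ c _ _))

  S-linear : ∀ a b f g → S (λ t → a * f t + b * g t) ≡ a * S f + b * S g
  S-linear a b f g = trans (S-+ _ _) (cong₂ _+_ (S-* a f) (S-* b g))

  S-reindex : ∀ σ → (∀ {x y} → σ x ≡ σ y → x ≡ y) → ∀ f → S (f ∘ σ) ≡ S f
  S-reindex σ inj f = ΣR.∑-reindex σ inj f

  S-odd : ∀ f → (∀ t → f (- t) ≡ - f t) → S f ≡ 0#
  S-odd f odd = x≡-x⇒x≡0 (begin
    S f                   ≡⟨ S-reindex -_ (λ e → trans (sym (-‿involutive _)) (trans (cong -_ e) (-‿involutive _))) f ⟨
    S (λ t → f (- t))     ≡⟨ S-cong (λ t → trans (odd t) (solve 1 (λ x → ⊝ x ⊜ ⊝ #1 ⊗ x) (f t))) ⟩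
    S (λ t → - 1# * f t)  ≡⟨ S-* (- 1#) f ⟩
    - 1# * S f            ≡⟨ solve 1 (λ x → ⊝ #1 ⊗ x ⊜ ⊝ x) (S f) ⟩
    - S f                 ∎)
    where open ≡-Reasoning

  S-1 : S (λ _ → 1#) ≡ 0#
  S-1 = +-cancelˡ (S (λ t → t)) _ _ (trans (sym (S-+ (λ t → t) (λ _ → 1#)))
    (trans (S-reindex (_+ 1#) (+-injective 1#) (λ t → t)) (sym (+-identityʳ _))))

  module _ (n : Carrier) (n-nonsquare : ¬ IsSquare n) where

    n≢0 : n ≢ 0#
    n≢0 e = n-nonsquare (0# , trans (zeroˡ 0#) (sym e))

    t²-n≢0 : ∀ t → t * t + - n ≢ 0#
    t²-n≢0 t e = n-nonsquare (t , x-y≡0⇒x≡y _ _ e)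

    -- 1/(t² - n) is defined on the whole field as n is a nonsquare. With n = z₄, its sum and the
    -- sum of its squares are what Σ φ and Σ φ² reduce to.
    i : Carrier → Carrier
    i t = (t * t + - n) ⁻¹

    i-inverse : ∀ t → (t * t + - n) * i t ≡ 1#
    i-inverse t = inverseʳ _ (t²-n≢0 t)

    i-unique : ∀ {t u} → (t * t + - n) * u ≡ 1# → i t ≡ u
    i-unique {t} {u} e = *-cancelˡ-≢0 (t²-n≢0 t) (trans (i-inverse t) (sym e))

    i-even : ∀ t → i (- t) ≡ i t
    i-even t = cong (λ x → (x + - n) ⁻¹) (solve 1 (λ t → ⊝ t ⊗ ⊝ t ⊜ t ⊗ t) t)

    t²i≡1+ni : ∀ t → t * t * i t ≡ 1# + n * i t
    t²i≡1+ni t = by (i-inverse t) (solve 3 (λ t n i → t ⊗ t ⊗ i ⊕ #1 ⊗ #1 ⊜ #1 ⊕ n ⊗ i ⊕ #1 ⊗ ((t ⊗ t ⊖ n) ⊗ i)) t n (i t))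

    S₁ S₂ : Carrier
    S₁ = S i
    S₂ = S (λ t → i t * i t)

    S-ti : S (λ t → t * i t) ≡ 0#
    S-ti = S-odd _ (λ t → trans (cong (- t *_) (i-even t)) (solve 2 (λ t i → ⊝ t ⊗ i ⊜ ⊝ (t ⊗ i)) t (i t)))

    S-ti² : S (λ t → t * i t * i t) ≡ 0#
    S-ti² = S-odd _ (λ t → trans (cong (λ x → - t * x * x) (i-even t)) (solve 2 (λ t i → ⊝ t ⊗ i ⊗ i ⊜ ⊝ (t ⊗ i ⊗ i)) t (i t)))

    S-t²i : S (λ t → t * t * i t) ≡ n * S₁
    S-t²i = trans (S-cong t²i≡1+ni) (trans (S-+ _ _) (trans (cong₂ _+_ S-1 (S-* n i)) (+-identityˡ _)))

    u : Carrier
    u = (1# + - n) ⁻¹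

    1-n≢0 : 1# + - n ≢ 0#
    1-n≢0 e = n-nonsquare (1# , trans (*-identityˡ 1#) (x-y≡0⇒x≡y _ _ e))

    [1-n]u≡1 : (1# + - n) * u ≡ 1#
    [1-n]u≡1 = inverseʳ _ 1-n≢0

    i1≡u : i 1# ≡ u
    i1≡u = cong (λ x → (x + - n) ⁻¹) (*-identityˡ 1#)

    -- A projectivity of the line preserving the quadric t² = n.
    σ : Carrier → Carrier
    σ t with t ≟ - 1#
    -- The map t ↦ (t + n)/(t + 1) sends -1 to ∞ and ∞ to 1; bypassing ∞ leaves a permutation of the
    -- field.
    ... | yes _ = 1#
    ... | no  _ = (t + n) * (t + 1#) ⁻¹

    σ-1 : σ (- 1#) ≡ 1#
    σ-1 with - 1# ≟ - 1#
    ... | yes _ = refl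
    ... | no ¬p = ⊥-elim (¬p refl)

    t+1≢0 : ∀ {t} → t ≢ - 1# → t + 1# ≢ 0#
    t+1≢0 t≢-1 e = t≢-1 (x-y≡0⇒x≡y _ _ (trans (cong (_ +_) (-‿involutive 1#)) e))

    σ-≢ : ∀ {t} → t ≢ - 1# → σ t * (t + 1#) ≡ t + n
    σ-≢ {t} t≢-1 with t ≟ - 1#
    ... | yes e = ⊥-elim (t≢-1 e)
    ... | no _ = by (inverseʳ _ (t+1≢0 t≢-1)) (solve 3 (λ t n r →
      (t ⊕ n) ⊗ r ⊗ (t ⊕ #1) ⊕ (t ⊕ n) ⊗ #1 ⊜ t ⊕ n ⊕ (t ⊕ n) ⊗ ((t ⊕ #1) ⊗ r)) t n ((t + 1#) ⁻¹))

    σ≢1 : ∀ {t} → t ≢ - 1# → σ t ≢ 1#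
    σ≢1 {t} t≢-1 e = 1-n≢0 (by₂ (σ-≢ t≢-1) e (solve 3 (λ t n s →
      #1 ⊖ n ⊕ #1 ⊗ (t ⊕ n) ⊕ ⊝ (t ⊕ #1) ⊗ #1 ⊜ #0 ⊕ #1 ⊗ (s ⊗ (t ⊕ #1)) ⊕ ⊝ (t ⊕ #1) ⊗ s) t n (σ t)))

    σ-injective : ∀ {x y} → σ x ≡ σ y → x ≡ y
    σ-injective {x} {y} e = cases (x ≟ - 1#) (y ≟ - 1#)
      where
      cases : Dec (x ≡ - 1#) → Dec (y ≡ - 1#) → x ≡ y
      cases (yes p) (yes r) = trans p (sym r)
      cases (yes p) (no r)  = ⊥-elim (σ≢1 r (trans (sym e) (trans (cong σ p) σ-1)))
      cases (no p)  (yes r) = ⊥-elim (σ≢1 p (trans e (trans (cong σ r) σ-1)))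
      cases (no p)  (no r)  = *-cancelˡ-≢0 1-n≢0 (by₂ (trans (cong (_* (y + 1#)) e) (σ-≢ r)) (σ-≢ p)
        (solve 4 (λ x y n s →
          (#1 ⊖ n) ⊗ x ⊕ (x ⊕ #1) ⊗ (y ⊕ n) ⊕ ⊝ (y ⊕ #1) ⊗ (x ⊕ n) ⊜ (#1 ⊖ n) ⊗ y ⊕ (x ⊕ #1) ⊗ (s ⊗ (y ⊕ #1)) ⊕ ⊝ (y ⊕ #1) ⊗ (s ⊗ (x ⊕ #1))) x y n (σ x)))

    j : Carrier → Carrier
    j t = (t + 1#) * (t + 1#) * i t

    j≡ : ∀ t → j t ≡ 1# + (n + 1#) * i t + - (t * i t)
    j≡ t = by (t²i≡1+ni t) (solve 3 (λ t n i →
      (t ⊕ #1) ⊗ (t ⊕ #1) ⊗ i ⊕ #1 ⊗ (#1 ⊕ n ⊗ i) ⊜ #1 ⊕ (n ⊕ #1) ⊗ i ⊖ t ⊗ i ⊕ #1 ⊗ (t ⊗ t ⊗ i)) t n (i t))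

    j-1≡0 : j (- 1#) ≡ 0#
    j-1≡0 = solve 1 (λ i → (⊝ #1 ⊕ #1) ⊗ (⊝ #1 ⊕ #1) ⊗ i ⊜ #0) (i (- 1#))

    -- (t + n)² - n(t + 1)² = (1 - n)(t² - n), so the projectivity multiplies t² - n by (1 - n)/(t +
    -- 1)².
    iσ≡uj : ∀ t → t ≢ - 1# → i (σ t) ≡ u * j t
    iσ≡uj t t≢-1 = i-unique (trans
      (solve 5 (λ s n u v i → (s ⊗ s ⊖ n) ⊗ (u ⊗ (v ⊗ v ⊗ i)) ⊜ (s ⊗ v ⊗ (s ⊗ v) ⊖ n ⊗ (v ⊗ v)) ⊗ (u ⊗ i)) (σ t) n u (t + 1#) (i t))
      (trans (cong (λ x → (x * x + - (n * ((t + 1#) * (t + 1#)))) * (u * i t)) (σ-≢ t≢-1))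
      (by₂ (i-inverse t) [1-n]u≡1 (solve 4 (λ t n u i →
         ((t ⊕ n) ⊗ (t ⊕ n) ⊖ n ⊗ ((t ⊕ #1) ⊗ (t ⊕ #1))) ⊗ (u ⊗ i) ⊕ (#1 ⊖ n) ⊗ u ⊗ #1 ⊕ #1 ⊗ #1
           ⊜ #1 ⊕ (#1 ⊖ n) ⊗ u ⊗ ((t ⊗ t ⊖ n) ⊗ i) ⊕ #1 ⊗ ((#1 ⊖ n) ⊗ u)) t n u (i t)))))

    -- Reindexing by σ replaces i by u j except at t = -1, where u j vanishes while i(σ(-1)) = i(1)
    -- = u. As f(0) = 0, the only correction is f(u), the term of the point that arrives from
    -- infinity.
    S-transport : ∀ f → f 0# ≡ 0# → S (λ t → f (i t)) ≡ f u + S (λ t → f (u * j t))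
    S-transport f f0≡0 = begin
      S (λ t → f (i t))                                  ≡⟨ S-reindex σ σ-injective (λ t → f (i t)) ⟨
      S (λ t → f (i (σ t)))                              ≡⟨ +-identityˡ _ ⟨
      0# + S (λ t → f (i (σ t)))                         ≡⟨ cong (_+ S (λ t → f (i (σ t)))) (trans (cong (λ x → f (u * x)) j-1≡0) (trans (cong f (zeroʳ u)) f0≡0)) ⟨
      f (u * j (- 1#)) + S (λ t → f (i (σ t)))           ≡⟨ Σ.∑-except _ _ unique (∈els (- 1#)) (λ t t≢-1 → cong f (iσ≡uj t t≢-1)) ⟩
      f (i (σ (- 1#))) + S (λ t → f (u * j t))           ≡⟨ cong (λ x → f x + S (λ t → f (u * j t))) (trans (cong i σ-1) i1≡u) ⟩
      f u + S (λ t → f (u * j t))                        ∎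
      where open ≡-Reasoning

    S-j : S j ≡ (n + 1#) * S₁
    S-j = begin
      S j                                                         ≡⟨ S-cong (λ t → trans (j≡ t) (solve 3 (λ n i t → #1 ⊕ (n ⊕ #1) ⊗ i ⊖ t ⊗ i ⊜ #1 ⊕ ((n ⊕ #1) ⊗ i ⊕ ⊝ #1 ⊗ (t ⊗ i))) n (i t) t)) ⟩
      S (λ t → 1# + ((n + 1#) * i t + - 1# * (t * i t)))          ≡⟨ S-+ _ _ ⟩
      S (λ _ → 1#) + S (λ t → (n + 1#) * i t + - 1# * (t * i t))  ≡⟨ cong₂ _+_ S-1 (S-linear (n + 1#) (- 1#) i (λ t → t * i t)) ⟩
      0# + ((n + 1#) * S₁ + - 1# * S (λ t → t * i t))             ≡⟨ cong (λ x → 0# + ((n + 1#) * S₁ + - 1# * x)) S-ti ⟩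
      0# + ((n + 1#) * S₁ + - 1# * 0#)                            ≡⟨ solve 2 (λ n s → #0 ⊕ ((n ⊕ #1) ⊗ s ⊕ ⊝ #1 ⊗ #0) ⊜ (n ⊕ #1) ⊗ s) n S₁ ⟩
      (n + 1#) * S₁                                               ∎
      where open ≡-Reasoning

    S₁≡ : S₁ ≡ u + u * ((n + 1#) * S₁)
    S₁≡ = trans (S-transport (λ x → x) refl) (cong (u +_) (trans (S-* u j) (cong (u *_) S-j)))

    -- Multiplied by 1 - n, the equation `S₁≡` reads (1 - n)S₁ = 1 + (n + 1)S₁, that is -2nS₁ = 1,
    -- and -2 = 1.
    nS₁≡1 : n * S₁ ≡ 1#
    nS₁≡1 = by₂ S₁≡ [1-n]u≡1
      (solve 3 (λ n u s → n ⊗ s ⊕ (#1 ⊖ n) ⊗ (u ⊕ u ⊗ ((n ⊕ #1) ⊗ s)) ⊕ (#1 ⊕ (n ⊕ #1) ⊗ s) ⊗ #1 ⊜ #1 ⊕ (#1 ⊖ n) ⊗ s ⊕ (#1 ⊕ (n ⊕ #1) ⊗ s) ⊗ ((#1 ⊖ n) ⊗ u)) n u S₁)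

    j²≡ : ∀ t → j t * j t ≡ 1# + (((n * n + 1#) * (i t * i t) + - n * i t) + (1# * (t * i t) + (n + 1#) * (t * i t * i t)))
    j²≡ t = trans (cong₂ _*_ (j≡ t) (j≡ t)) (by {k = i t} (t²i≡1+ni t) (solve 3 (λ t n i →
      (#1 ⊕ (n ⊕ #1) ⊗ i ⊖ t ⊗ i) ⊗ (#1 ⊕ (n ⊕ #1) ⊗ i ⊖ t ⊗ i) ⊕ i ⊗ (#1 ⊕ n ⊗ i)
        ⊜ #1 ⊕ (((n ⊗ n ⊕ #1) ⊗ (i ⊗ i) ⊕ ⊝ n ⊗ i) ⊕ (#1 ⊗ (t ⊗ i) ⊕ (n ⊕ #1) ⊗ (t ⊗ i ⊗ i))) ⊕ i ⊗ (t ⊗ t ⊗ i)) t n (i t)))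

    S-j² : S (λ t → u * j t * (u * j t)) ≡ u * u * ((n * n + 1#) * S₂ + - n * S₁)
    S-j² = begin
      S (λ t → u * j t * (u * j t)) ≡⟨ trans (S-cong λ t → trans (solve 2 (λ u j → u ⊗ j ⊗ (u ⊗ j) ⊜ u ⊗ u ⊗ (j ⊗ j)) u (j t)) (cong (u * u *_) (j²≡ t))) (S-* (u * u) _) ⟩
      u * u * S (λ t → 1# + (((n * n + 1#) * (i t * i t) + - n * i t) + (1# * (t * i t) + (n + 1#) * (t * i t * i t))))
        ≡⟨ cong (u * u *_) (trans (S-+ _ _) (trans (cong₂ _+_ S-1 (S-+ _ _)) (+-identityˡ _))) ⟩
      u * u * (S (λ t → (n * n + 1#) * (i t * i t) + - n * i t) + S (λ t → 1# * (t * i t) + (n + 1#) * (t * i t * i t)))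
        ≡⟨ cong (u * u *_) (cong₂ _+_ (S-linear _ _ _ _) (trans (S-linear _ _ _ _) (cong₂ (λ a b → 1# * a + (n + 1#) * b) S-ti S-ti²))) ⟩
      u * u * ((n * n + 1#) * S₂ + - n * S₁ + (1# * 0# + (n + 1#) * 0#))
        ≡⟨ solve 3 (λ u x n → u ⊗ u ⊗ (x ⊕ (#1 ⊗ #0 ⊕ (n ⊕ #1) ⊗ #0)) ⊜ u ⊗ u ⊗ x) u ((n * n + 1#) * S₂ + - n * S₁) n ⟩
      u * u * ((n * n + 1#) * S₂ + - n * S₁) ∎
      where open ≡-Reasoning

    -- Transport of squares gives (1 - n)²S₂ = 1 + (n² + 1)S₂ - nS₁. The constants cancel by nS₁ =
    -- 1, and nS₂ = 0 remains.
    S₂≡0 : S₂ ≡ 0#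
    S₂≡0 = xy≡0⇒y≡0 n≢0 (by [1-n]u≡1 (by₂ (trans (S-transport (λ x → x * x) (zeroˡ 0#)) (cong (u * u +_) S-j²)) nS₁≡1
      (solve 4 (λ n u S₁ S₂ → let r = #1 ⊖ n ; k = ((n ⊗ n ⊕ #1) ⊗ S₂) ⊗ (r ⊗ u ⊕ #1) in
        n ⊗ S₂ ⊕ k ⊗ #1 ⊕ r ⊗ r ⊗ (u ⊗ u ⊕ u ⊗ u ⊗ ((n ⊗ n ⊕ #1) ⊗ S₂ ⊕ ⊝ n ⊗ S₁)) ⊕ ⊝ (r ⊗ r ⊗ u ⊗ u) ⊗ #1
        ⊜ #0 ⊕ k ⊗ (r ⊗ u) ⊕ r ⊗ r ⊗ S₂ ⊕ ⊝ (r ⊗ r ⊗ u ⊗ u) ⊗ (n ⊗ S₁)) n u S₁ S₂)))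

  -- Quartics with only nonsquare values

  -- The discriminant a₁²a₂² − 4a₀a₂³ − 4a₁³a₃ + 18a₀a₁a₂a₃ − 27a₀²a₃² reduced modulo 3.
  disc : (a₀ a₁ a₂ a₃ : Carrier) → Carrier
  disc a₀ a₁ a₂ a₃ = a₁ * a₁ * (a₂ * a₂) + - (a₀ * (a₂ * a₂ * a₂)) + - (a₁ * a₁ * a₁ * a₃)

  module _ {n : ℕ} where
    discᴱ : (a₀ a₁ a₂ a₃ : Expr F₃ n) → Expr F₃ n
    discᴱ a₀ a₁ a₂ a₃ = a₁ ⊗ a₁ ⊗ (a₂ ⊗ a₂) ⊖ a₀ ⊗ (a₂ ⊗ a₂ ⊗ a₂) ⊖ a₁ ⊗ a₁ ⊗ a₁ ⊗ a₃

    cubicᴱ : (a₀ a₁ a₂ a₃ X Y : Expr F₃ n) → Expr F₃ n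
    cubicᴱ a₀ a₁ a₂ a₃ X Y = a₀ ⊗ (X ⊗ X ⊗ X) ⊕ a₁ ⊗ (X ⊗ X ⊗ Y) ⊕ a₂ ⊗ (X ⊗ Y ⊗ Y) ⊕ a₃ ⊗ (Y ⊗ Y ⊗ Y)

  cubic : (a₀ a₁ a₂ a₃ X Y : Carrier) → Carrier
  cubic a₀ a₁ a₂ a₃ X Y = a₀ * (X * X * X) + a₁ * (X * X * Y) + a₂ * (X * Y * Y) + a₃ * (Y * Y * Y)

  -- Besides X - tY and X - uY the cubic has the factor a₀X + eY with e = a₁ + a₀(t + u). The
  -- discriminant is the square of the product of the three pairwise determinants.
  two-roots⇒IsSquare-disc : ∀ {a₀ a₁ a₂ a₃ t u} → t ≢ u → cubic a₀ a₁ a₂ a₃ t 1# ≡ 0# → cubic a₀ a₁ a₂ a₃ u 1# ≡ 0# →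
    IsSquare (disc a₀ a₁ a₂ a₃)
  two-roots⇒IsSquare-disc {a₀} {a₁} {a₂} {a₃} {t} {u} t≢u ct≡0 cu≡0 =
    (t + - u) * (a₀ * t + e) * (a₀ * u + e) ,
    trans (solve 4 (λ a₀ a₁ t u → let e = a₁ ⊕ a₀ ⊗ (t ⊕ u) ; w = (t ⊖ u) ⊗ (a₀ ⊗ t ⊕ e) ⊗ (a₀ ⊗ u ⊕ e) in
       w ⊗ w ⊜ discᴱ a₀ a₁ (⊝ (a₀ ⊗ (t ⊗ t ⊕ t ⊗ u ⊕ u ⊗ u) ⊕ a₁ ⊗ (t ⊕ u))) (t ⊗ u ⊗ e)) a₀ a₁ t u)
      (sym (cong₂ (disc a₀ a₁) a₂≡ a₃≡))
    where
    e : Carrier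
    e = a₁ + a₀ * (t + u)
    t-u≢0 : t + - u ≢ 0#
    t-u≢0 h = t≢u (x-y≡0⇒x≡y t u h)
    a₂≡ : a₂ ≡ - (a₀ * (t * t + t * u + u * u) + a₁ * (t + u))
    a₂≡ = *-cancelˡ-≢0 t-u≢0 (by₂ ct≡0 cu≡0 (solve 6 (λ a₀ a₁ a₂ a₃ t u →
      (t ⊖ u) ⊗ a₂ ⊕ #1 ⊗ #0 ⊕ ⊝ #1 ⊗ #0 ⊜ (t ⊖ u) ⊗ ⊝ (a₀ ⊗ (t ⊗ t ⊕ t ⊗ u ⊕ u ⊗ u) ⊕ a₁ ⊗ (t ⊕ u)) ⊕ #1 ⊗ cubicᴱ a₀ a₁ a₂ a₃ t #1 ⊕ ⊝ #1 ⊗ cubicᴱ a₀ a₁ a₂ a₃ u #1) a₀ a₁ a₂ a₃ t u))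
    a₃≡ : a₃ ≡ t * u * e
    a₃≡ = by₂ ct≡0 a₂≡ (solve 6 (λ a₀ a₁ a₂ a₃ t u →
      a₃ ⊕ #1 ⊗ #0 ⊕ ⊝ t ⊗ ⊝ (a₀ ⊗ (t ⊗ t ⊕ t ⊗ u ⊕ u ⊗ u) ⊕ a₁ ⊗ (t ⊕ u)) ⊜ t ⊗ u ⊗ (a₁ ⊕ a₀ ⊗ (t ⊕ u)) ⊕ #1 ⊗ cubicᴱ a₀ a₁ a₂ a₃ t #1 ⊕ ⊝ t ⊗ a₂) a₀ a₁ a₂ a₃ t u)

  -- If all values of the quartic are nonsquare, every member of the pencil of cubics has exactly one zero, so
  -- the ratio φ of two members permutes the field; comparing Σ φ and Σ φ² with Σ t and Σ t² forces Δ = 0.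
  module NonsquareValues (z₀ z₃ z₄ : Carrier) (Δ≢0 : Δ₁ z₀ 0# z₃ z₄ ≢ 0#)
    (nonsquare : ∀ X Y → Nonzero₂ X Y → ¬ IsSquare (quartic z₀ 0# 1# z₃ z₄ X Y)) where

    z₀-nonsquare : ¬ IsSquare z₀
    z₀-nonsquare (s , e) = nonsquare 1# 0# (1≢0 ∘ proj₁) (s , trans e
      (solve 3 (λ z₀ z₃ z₄ → z₀ ⊜ quarticᴱ z₀ #0 #1 z₃ z₄ #1 #0) z₀ z₃ z₄))

    z₄-nonsquare : ¬ IsSquare z₄
    z₄-nonsquare (s , e) = nonsquare 0# 1# (1≢0 ∘ proj₂) (s , trans e
      (solve 3 (λ z₀ z₃ z₄ → z₄ ⊜ quarticᴱ z₀ #0 #1 z₃ z₄ #0 #1) z₀ z₃ z₄))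

    z₀≢0 : z₀ ≢ 0#
    z₀≢0 e = z₀-nonsquare (0# , trans (zeroˡ 0#) (sym e))

    I : Carrier → Carrier
    I = i z₄ z₄-nonsquare

    SI : Carrier
    SI = S₁ z₄ z₄-nonsquare

    κ : Carrier
    κ = z₀ * z₄ + - 1#

    -- φ t is the b for which t is a zero of the cubic with a₁ = b and a₂ = 1, namely (z₀t³ - t +
    -- z₃)/(t² - z₄), written after division with remainder κt + z₃. The denominator has no zero
    -- since z₄, the value at (0 : 1), is a nonsquare.
    φ : Carrier → Carrier
    φ t = z₀ * t + (κ * (t * I t) + z₃ * I t)

    φ-root : ∀ {t b} → φ t ≡ b → cubic (- z₀) b 1# (- (z₃ + b * z₄)) t 1# ≡ 0#
    φ-root {t} refl = by (i-inverse z₄ z₄-nonsquare t) (solve 5 (λ z₀ z₃ z₄ t i →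
      let b = z₀ ⊗ t ⊕ ((z₀ ⊗ z₄ ⊖ #1) ⊗ (t ⊗ i) ⊕ z₃ ⊗ i) ; k = (z₀ ⊗ z₄ ⊖ #1) ⊗ t ⊕ z₃ in
      cubicᴱ (⊝ z₀) b #1 (⊝ (z₃ ⊕ b ⊗ z₄)) t #1 ⊕ k ⊗ #1 ⊜ #0 ⊕ k ⊗ ((t ⊗ t ⊖ z₄) ⊗ i)) z₀ z₃ z₄ t (I t))

    disc-pencil : ∀ b → disc (- z₀) b 1# (- (z₃ + b * z₄)) ≡ quartic z₀ 0# 1# z₃ z₄ 1# b
    disc-pencil b = solve 4 (λ z₀ z₃ z₄ b →
      discᴱ (⊝ z₀) b #1 (⊝ (z₃ ⊕ b ⊗ z₄)) ⊜ quarticᴱ z₀ #0 #1 z₃ z₄ #1 b) z₀ z₃ z₄ b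

    -- Two different t with the same b = φ t would be two zeros of one cubic and make its
    -- discriminant f(1, b) a square.
    φ-injective : ∀ {t u} → φ t ≡ φ u → t ≡ u
    φ-injective {t} {u} e = decidable-stable (t ≟ u) λ t≢u →
      nonsquare 1# (φ u) (1≢0 ∘ proj₁) (subst IsSquare (disc-pencil (φ u)) (two-roots⇒IsSquare-disc t≢u (φ-root e) (φ-root refl)))

    S-t : S (λ t → t) ≡ 0#
    S-t = S-odd (λ t → t) (λ _ → refl)

    -- Σ φ = z₃S₁, the other summands of φ being odd, and Σ φ = Σ t = 0 because φ permutes the
    -- field. Now z₄S₁ = 1.
    z₃≡0 : z₃ ≡ 0#
    z₃≡0 = by₂ Sφ (nS₁≡1 z₄ z₄-nonsquare) (solve 3 (λ z₃ z₄ s →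
      z₃ ⊕ z₄ ⊗ #0 ⊕ ⊝ z₃ ⊗ #1 ⊜ #0 ⊕ z₄ ⊗ (z₃ ⊗ s) ⊕ ⊝ z₃ ⊗ (z₄ ⊗ s)) z₃ z₄ SI)
      where
      open ≡-Reasoning
      Sφ : z₃ * SI ≡ 0#
      Sφ = begin
        z₃ * SI ≡⟨ solve 3 (λ z₀ κ x → x ⊜ z₀ ⊗ #0 ⊕ (κ ⊗ #0 ⊕ x)) z₀ κ (z₃ * SI) ⟩
        z₀ * 0# + (κ * 0# + z₃ * SI) ≡⟨ cong₂ (λ a b → z₀ * a + (κ * b + z₃ * SI)) S-t (S-ti z₄ z₄-nonsquare) ⟨
        z₀ * S (λ t → t) + (κ * S (λ t → t * I t) + z₃ * SI)
          ≡⟨ trans (S-+ (λ t → z₀ * t) (λ t → κ * (t * I t) + z₃ * I t)) (cong₂ _+_ (S-* z₀ (λ t → t)) (S-linear κ z₃ (λ t → t * I t) I)) ⟨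
        S φ ≡⟨ S-reindex φ φ-injective (λ t → t) ⟩
        S (λ t → t) ≡⟨ S-t ⟩
        0# ∎

    -- Σ φ² and Σ (z₀t)² both equal Σ t², so the rest of Σ φ² vanishes: -z₀κ(z₄S₁) + κ²(S₁ + z₄S₂) =
    -- 0. By S₂ = 0 and z₄S₁ = 1, multiplication by z₄ turns this into κ(κ - z₀z₄) = -κ = 0.
    κ≡0 : κ ≡ 0#
    κ≡0 = xy≡0⇒y≡0 (-≢0 1≢0) (by₂ Sφ² (nS₁≡1 z₄ z₄-nonsquare) (solve 3 (λ z₀ z₄ s → let κ = z₀ ⊗ z₄ ⊖ #1 in
        ⊝ #1 ⊗ κ ⊕ z₄ ⊗ #0 ⊕ ⊝ (κ ⊗ κ ⊖ z₀ ⊗ z₄ ⊗ κ) ⊗ #1 ⊜ #0 ⊕ z₄ ⊗ (⊝ (z₀ ⊗ κ) ⊗ (z₄ ⊗ s) ⊕ κ ⊗ κ ⊗ s) ⊕ ⊝ (κ ⊗ κ ⊖ z₀ ⊗ z₄ ⊗ κ) ⊗ (z₄ ⊗ s)) z₀ z₄ SI))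
      where
      open ≡-Reasoning
      sq : Carrier → Carrier
      sq t = t * t
      φ² : ∀ t → sq (φ t) ≡ sq (z₀ * t) + (- (z₀ * κ) * (t * t * I t) + κ * κ * (I t + z₄ * (I t * I t)))
      φ² t = by₂ z₃≡0 (t²i≡1+ni z₄ z₄-nonsquare t) (solve 6 (λ z₀ z₃ z₄ κ t i →
        let φ = z₀ ⊗ t ⊕ (κ ⊗ (t ⊗ i) ⊕ z₃ ⊗ i) ; k = i ⊗ (φ ⊕ (z₀ ⊗ t ⊕ κ ⊗ (t ⊗ i))) in
        φ ⊗ φ ⊕ k ⊗ #0 ⊕ κ ⊗ κ ⊗ i ⊗ (#1 ⊕ z₄ ⊗ i) ⊜
        z₀ ⊗ t ⊗ (z₀ ⊗ t) ⊕ (⊝ (z₀ ⊗ κ) ⊗ (t ⊗ t ⊗ i) ⊕ κ ⊗ κ ⊗ (i ⊕ z₄ ⊗ (i ⊗ i))) ⊕ k ⊗ z₃ ⊕ κ ⊗ κ ⊗ i ⊗ (t ⊗ t ⊗ i)) z₀ z₃ z₄ κ t (I t))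
      S-I+z₄I² : S (λ t → I t + z₄ * (I t * I t)) ≡ SI
      S-I+z₄I² = trans (S-+ _ _) (trans (cong (SI +_) (trans (S-* z₄ _) (trans (cong (z₄ *_) (S₂≡0 z₄ z₄-nonsquare)) (zeroʳ z₄)))) (+-identityʳ SI))
      Sφ² : - (z₀ * κ) * (z₄ * SI) + κ * κ * SI ≡ 0#
      Sφ² = +-cancelˡ (S sq) _ _ (begin
        S sq + (- (z₀ * κ) * (z₄ * SI) + κ * κ * SI)
          ≡⟨ cong₂ _+_ (S-reindex (z₀ *_) (*-injective z₀≢0) sq) (cong₂ (λ a b → - (z₀ * κ) * a + κ * κ * b) (S-t²i z₄ z₄-nonsquare) S-I+z₄I²) ⟨
        S (λ t → sq (z₀ * t)) + (- (z₀ * κ) * S (λ t → t * t * I t) + κ * κ * S (λ t → I t + z₄ * (I t * I t)))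
          ≡⟨ trans (S-+ _ _) (cong (S (λ t → sq (z₀ * t)) +_) (S-linear _ _ _ _)) ⟨
        S (λ t → sq (z₀ * t) + (- (z₀ * κ) * (t * t * I t) + κ * κ * (I t + z₄ * (I t * I t))))
          ≡⟨ S-cong φ² ⟨
        S (λ t → sq (φ t)) ≡⟨ S-reindex φ φ-injective sq ⟩
        S sq ≡⟨ +-identityʳ _ ⟨
        S sq + 0# ∎)

    abstract
      -- With z₁ = z₃ = 0 and d = z₀z₄ the invariant is d(d - 1)², and κ = d - 1 = 0.
      impossible : ⊥
      impossible = Δ≢0 (by₂ κ≡0 z₃≡0 (solve 3 (λ z₀ z₃ z₄ → let k = z₀ ⊗ z₄ ⊗ (z₀ ⊗ z₄ ⊖ #1) ; l = ⊝ (z₀ ⊗ z₃) in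
        Δᴱ z₀ #0 #1 z₃ z₄ ⊕ k ⊗ #0 ⊕ l ⊗ #0 ⊜ #0 ⊕ k ⊗ (z₀ ⊗ z₄ ⊖ #1) ⊕ l ⊗ z₃) z₀ z₃ z₄))

  -- The translation that removes z₁ needs z₀ ≠ 0; as the value at (1 : 0), z₀ is a nonsquare.
  nonsquare-values-impossible : ∀ z₀ z₁ z₃ z₄ → Δ₁ z₀ z₁ z₃ z₄ ≢ 0# →
    (∀ X Y → Nonzero₂ X Y → ¬ IsSquare (quartic z₀ z₁ 1# z₃ z₄ X Y)) → ⊥
  nonsquare-values-impossible z₀ z₁ z₃ z₄ Δ≢0 nonsquare =
    NonsquareValues.impossible z₀ z₃′ z₄′
      (λ e → Δ≢0 (trans (sym (Δ-shift z₀ z₁ z₃ z₄ ε)) (trans (cong (λ a → Δ₁ z₀ a z₃′ z₄′) z₁′≡0) e)))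
      (λ X Y nz (s , e) → nonsquare (X + ε * Y) Y
        (λ (X+εY≡0 , Y≡0) → nz (by₂ X+εY≡0 Y≡0 (solve 3 (λ X Y ε → X ⊕ #1 ⊗ #0 ⊕ ⊝ ε ⊗ #0 ⊜ #0 ⊕ #1 ⊗ (X ⊕ ε ⊗ Y) ⊕ ⊝ ε ⊗ Y) X Y ε) , Y≡0))
        (s , trans e (trans (cong (λ a → quartic z₀ a 1# z₃′ z₄′ X Y) (sym z₁′≡0)) (quartic-shift z₀ z₁ z₃ z₄ ε X Y))))
    where
    z₀≢0 : z₀ ≢ 0#
    z₀≢0 e = nonsquare 1# 0# (1≢0 ∘ proj₁) (0# , by e (solve 4 (λ z₀ z₁ z₃ z₄ →
      #0 ⊗ #0 ⊕ ⊝ #1 ⊗ #0 ⊜ quarticᴱ z₀ z₁ #1 z₃ z₄ #1 #0 ⊕ ⊝ #1 ⊗ z₀) z₀ z₁ z₃ z₄))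
    ε z₃′ z₄′ : Carrier
    ε = - (z₁ * z₀ ⁻¹)
    z₃′ = shift₃ z₀ z₃ ε
    z₄′ = shift₄ z₀ z₁ z₃ z₄ ε
    z₁′≡0 : shift₁ z₀ z₁ ε ≡ 0#
    z₁′≡0 = by (inverseʳ z₀ z₀≢0) (solve 3 (λ z₀ z₁ r → z₁ ⊕ ⊝ (z₁ ⊗ r) ⊗ z₀ ⊕ ⊝ z₁ ⊗ #1 ⊜ #0 ⊕ ⊝ z₁ ⊗ (z₀ ⊗ r)) z₀ z₁ (z₀ ⁻¹))

  -- Binary quadratic and cubic forms and the type of a plane

  quadratic : (α β γ X Y : Carrier) → Carrier
  quadratic α β γ X Y = α * (X * X) + β * (X * Y) + γ * (Y * Y)

  module _ {n : ℕ} where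
    linearᴱ : (l m X Y : Expr F₃ n) → Expr F₃ n
    linearᴱ l m X Y = l ⊗ X ⊕ m ⊗ Y

    quadraticᴱ : (α β γ X Y : Expr F₃ n) → Expr F₃ n
    quadraticᴱ α β γ X Y = α ⊗ (X ⊗ X) ⊕ β ⊗ (X ⊗ Y) ⊕ γ ⊗ (Y ⊗ Y)

  det : (l m l′ m′ : Carrier) → Carrier
  det l m l′ m′ = l * m′ + - (m * l′)

  detᴱ : ∀ {n} (l m l′ m′ : Expr F₃ n) → Expr F₃ n
  detᴱ l m l′ m′ = l ⊗ m′ ⊖ m ⊗ l′

  det≢0⇒disjoint : ∀ {l m l′ m′} → det l m l′ m′ ≢ 0# → ∀ X Y → Nonzero₂ X Y → ¬ (linear l m X Y ≡ 0# × linear l′ m′ X Y ≡ 0#)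
  det≢0⇒disjoint {l} {m} {l′} {m′} d≢0 X Y nz (e , e′) = nz
    ( xy≡0⇒y≡0 d≢0 (by₂ e e′ (solve 6 (λ l m l′ m′ X Y →
        detᴱ l m l′ m′ ⊗ X ⊕ m′ ⊗ #0 ⊕ ⊝ m ⊗ #0 ⊜ #0 ⊕ m′ ⊗ linearᴱ l m X Y ⊕ ⊝ m ⊗ linearᴱ l′ m′ X Y) l m l′ m′ X Y))
    , xy≡0⇒y≡0 d≢0 (by₂ e e′ (solve 6 (λ l m l′ m′ X Y →
        detᴱ l m l′ m′ ⊗ Y ⊕ ⊝ l′ ⊗ #0 ⊕ l ⊗ #0 ⊜ #0 ⊕ ⊝ l′ ⊗ linearᴱ l m X Y ⊕ l ⊗ linearᴱ l′ m′ X Y) l m l′ m′ X Y)))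

  det≢0⇒Nonzero : ∀ {l m l′ m′} → det l m l′ m′ ≢ 0# → Nonzero₂ l m
  det≢0⇒Nonzero {l′ = l′} {m′} d≢0 (refl , refl) = d≢0 (solve 2 (λ l′ m′ → detᴱ #0 #0 l′ m′ ⊜ #0) l′ m′)

  det-swap≢0 : ∀ {l m l′ m′} → det l m l′ m′ ≢ 0# → det l′ m′ l m ≢ 0#
  det-swap≢0 {l} {m} {l′} {m′} d≢0 e = d≢0 (by e (solve 4 (λ l m l′ m′ →
    detᴱ l m l′ m′ ⊕ ⊝ #1 ⊗ #0 ⊜ #0 ⊕ ⊝ #1 ⊗ detᴱ l′ m′ l m) l m l′ m′))

  det≢0⇒Independent : ∀ {l m l′ m′} → det l m l′ m′ ≢ 0# → Independent (l ∷ m ∷ []) (l′ ∷ m′ ∷ [])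
  det≢0⇒Independent {l} {m} d≢0 c refl = d≢0 (solve 3 (λ l m c → detᴱ l m (c ⊗ l) (c ⊗ m) ⊜ #0) l m c)

  Independent⇒det≢0 : ∀ {l m l′ m′} → Nonzero₂ l m → Independent (l ∷ m ∷ []) (l′ ∷ m′ ∷ []) → det l m l′ m′ ≢ 0#
  Independent⇒det≢0 {l} {m} {l′} {m′} nz ind d≡0 with l ≟ 0#
  ... | no l≢0 = ind (l ⁻¹ * l′) (cong₂ (λ a b → a ∷ b ∷ [])
    (by (inverseʳ l l≢0) (solve 3 (λ l r l′ → l′ ⊕ ⊝ l′ ⊗ #1 ⊜ r ⊗ l′ ⊗ l ⊕ ⊝ l′ ⊗ (l ⊗ r)) l (l ⁻¹) l′))
    (by₂ (inverseʳ l l≢0) d≡0 (solve 5 (λ l m l′ m′ r →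
      m′ ⊕ ⊝ m′ ⊗ #1 ⊕ r ⊗ #0 ⊜ r ⊗ l′ ⊗ m ⊕ ⊝ m′ ⊗ (l ⊗ r) ⊕ r ⊗ detᴱ l m l′ m′) l m l′ m′ (l ⁻¹))))
  ... | yes refl = ind (m ⁻¹ * m′) (cong₂ (λ a b → a ∷ b ∷ [])
    (trans (xy≡0⇒y≡0 m≢0 (by d≡0 (solve 3 (λ m l′ m′ → m ⊗ l′ ⊕ ⊝ #1 ⊗ #0 ⊜ #0 ⊕ ⊝ #1 ⊗ detᴱ #0 m l′ m′) m l′ m′))) (sym (zeroʳ _)))
    (by (inverseʳ m m≢0) (solve 3 (λ m r m′ → m′ ⊕ ⊝ m′ ⊗ #1 ⊜ r ⊗ m′ ⊗ m ⊕ ⊝ m′ ⊗ (m ⊗ r)) m (m ⁻¹) m′)))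
    where
    m≢0 : m ≢ 0#
    m≢0 e = nz (refl , e)

  -- The usual factor 4 is 1.
  quadDisc : (α β γ : Carrier) → Carrier
  quadDisc α β γ = β * β + - (α * γ)

  -- (βY - αX)² - Y²(β² - αγ) is α times the form, so at a zero with Y ≠ 0 the discriminant is a
  -- square up to Y². A zero with Y = 0 means α = 0, and then the discriminant is β².
  quadratic-zero⇒IsSquare : ∀ {α β γ X Y} → Nonzero₂ X Y → quadratic α β γ X Y ≡ 0# → IsSquare (quadDisc α β γ)
  quadratic-zero⇒IsSquare {α} {β} {γ} {X} {Y} nz e with Y ≟ 0#
  ... | no Y≢0 = IsSquare-scale Y≢0 (β * Y + - (α * X) , by e (solve 5 (λ α β γ X Y →
    (β ⊗ Y ⊖ α ⊗ X) ⊗ (β ⊗ Y ⊖ α ⊗ X) ⊕ α ⊗ #0 ⊜ Y ⊗ Y ⊗ (β ⊗ β ⊖ α ⊗ γ) ⊕ α ⊗ quadraticᴱ α β γ X Y) α β γ X Y))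
  ... | yes refl = β , by α≡0 (solve 3 (λ α β γ → β ⊗ β ⊕ γ ⊗ #0 ⊜ β ⊗ β ⊖ α ⊗ γ ⊕ γ ⊗ α) α β γ)
    where
    X≢0 : X ≢ 0#
    X≢0 e = nz (e , refl)
    α≡0 : α ≡ 0#
    α≡0 = xy≡0⇒y≡0 (*-≢0 X≢0 X≢0) (by e (solve 4 (λ α β γ X → X ⊗ X ⊗ α ⊕ #1 ⊗ #0 ⊜ #0 ⊕ #1 ⊗ quadraticᴱ α β γ X #0) α β γ X))

  record QuadSplit (α β γ s : Carrier) : Set where
    field
      l₁ m₁ l₂ m₂ : Carrier
      α≡ : α ≡ l₁ * l₂
      β≡ : β ≡ l₁ * m₂ + m₁ * l₂
      γ≡ : γ ≡ m₁ * m₂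
      det² : det l₁ m₁ l₂ m₂ * det l₁ m₁ l₂ m₂ ≡ s * s

  quadSplit : ∀ {α β γ s} → s * s ≡ quadDisc α β γ → QuadSplit α β γ s
  quadSplit {α} {β} {γ} {s} s²≡ with α ≟ 0#
  -- The roots are (β ± s)/α, because -1/2 = 1.
  ... | no α≢0 = record
    { l₁ = 1# ; m₁ = - ((β + s) * r) ; l₂ = α ; m₂ = - (β + - s)
    ; α≡ = sym (*-identityˡ α)
    ; β≡ = by (inverseʳ α α≢0) (solve 4 (λ α r β s →
        β ⊕ (β ⊕ s) ⊗ #1 ⊜ #1 ⊗ ⊝ (β ⊖ s) ⊕ ⊝ ((β ⊕ s) ⊗ r) ⊗ α ⊕ (β ⊕ s) ⊗ (α ⊗ r)) α r β s)
    ; γ≡ = by₂ s²≡ (inverseʳ α α≢0) (solve 5 (λ α β γ s r →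
        γ ⊕ r ⊗ (β ⊗ β ⊖ α ⊗ γ) ⊕ ⊝ γ ⊗ #1 ⊜ ⊝ ((β ⊕ s) ⊗ r) ⊗ ⊝ (β ⊖ s) ⊕ r ⊗ (s ⊗ s) ⊕ ⊝ γ ⊗ (α ⊗ r)) α β γ s r)
    ; det² = by (inverseʳ α α≢0) (solve 4 (λ α β s r → let D = detᴱ #1 (⊝ ((β ⊕ s) ⊗ r)) α (⊝ (β ⊖ s)) ; k = (β ⊕ s) ⊗ (D ⊖ s) in
        D ⊗ D ⊕ k ⊗ #1 ⊜ s ⊗ s ⊕ k ⊗ (α ⊗ r)) α β s r) }
    where r = α ⁻¹
  ... | yes refl = record
    { l₁ = 0# ; m₁ = 1# ; l₂ = β ; m₂ = γ
    ; α≡ = sym (zeroˡ β)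
    ; β≡ = solve 2 (λ β γ → β ⊜ #0 ⊗ γ ⊕ #1 ⊗ β) β γ
    ; γ≡ = sym (*-identityˡ γ)
    ; det² = trans (solve 2 (λ β γ → detᴱ #0 #1 β γ ⊗ detᴱ #0 #1 β γ ⊜ β ⊗ β ⊖ #0 ⊗ γ) β γ) (sym s²≡) }

  quadSplit-mulF : ∀ {α β γ s} (S : QuadSplit α β γ s) → let open QuadSplit S in
    α ∷ β ∷ γ ∷ [] ≡ mulF (l₁ ∷ m₁ ∷ []) (l₂ ∷ m₂ ∷ [])
  quadSplit-mulF S = cong₂ _∷_ (trans α≡ (sym (+-identityʳ _)))
    (cong₂ _∷_ (trans β≡ (cong (l₁ * m₂ +_) (sym (+-identityʳ _)))) (cong (_∷ []) γ≡))
    where open QuadSplit S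

  form₁ : ∀ {p} → Form 1 p → ∃₂ λ l m → p ≡ l ∷ m ∷ []
  form₁ {l ∷ m ∷ []} refl = l , m , refl

  form₂ : ∀ {p} → Form 2 p → ∃ λ α → ∃₂ λ β γ → p ≡ α ∷ β ∷ γ ∷ []
  form₂ {α ∷ β ∷ γ ∷ []} refl = α , β , γ , refl

  form₃ : ∀ {p} → Form 3 p → ∃₂ λ a₀ a₁ → ∃₂ λ a₂ a₃ → p ≡ a₀ ∷ a₁ ∷ a₂ ∷ a₃ ∷ []
  form₃ {a₀ ∷ a₁ ∷ a₂ ∷ a₃ ∷ []} refl = a₀ , a₁ , a₂ , a₃ , refl

  NonzeroF⇒Nonzero₂ : ∀ {l m} → NonzeroF (l ∷ m ∷ []) → Nonzero₂ l m
  NonzeroF⇒Nonzero₂ (here l≢0) (e , _) = l≢0 e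
  NonzeroF⇒Nonzero₂ (there (here m≢0)) (_ , e) = m≢0 e

  Nonzero₂⇒NonzeroF : ∀ {l m} → Nonzero₂ l m → NonzeroF (l ∷ m ∷ [])
  Nonzero₂⇒NonzeroF {l} nz with l ≟ 0#
  ... | no l≢0 = here l≢0
  ... | yes l≡0 = there (here (λ m≡0 → nz (l≡0 , m≡0)))

  Nonzero₂⇒Linear : ∀ {l m} → Nonzero₂ l m → Linear (l ∷ m ∷ [])
  Nonzero₂⇒Linear nz = refl , Nonzero₂⇒NonzeroF nz

  -- (m : −l) is the zero of l X + m Y.
  Nonzero₂-root : ∀ {l m} → Nonzero₂ l m → Nonzero₂ m (- l)
  Nonzero₂-root nz (m≡0 , -l≡0) = nz (trans (sym (-‿involutive _)) (trans (cong -_ -l≡0) -0#≈0#) , m≡0)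

  ¬IsSquare⇒≢0 : ∀ {d} → ¬ IsSquare d → d ≢ 0#
  ¬IsSquare⇒≢0 ns refl = ns (0# , zeroˡ 0#)

  nonsquare⇒Irreducible : ∀ {α β γ} → ¬ IsSquare (quadDisc α β γ) → Irreducible 2 (α ∷ β ∷ γ ∷ [])
  nonsquare⇒Irreducible {α} {β} {γ} ns = refl , nonzero , λ where
      1 1 g h _ _ refl fg fh e → split (form₁ {g} fg) (form₁ {h} fh) e
      (suc (suc zero)) zero g h _ () _ fg fh e
      (suc (suc (suc _))) _ g h _ _ () fg fh e
      zero _ g h () _ _ fg fh e
    where
    nonzero : NonzeroF (α ∷ β ∷ γ ∷ [])
    nonzero with α ≟ 0# | β ≟ 0#
    ... | no α≢0 | _      = here α≢0
    ... | yes _  | no β≢0 = there (here β≢0)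
    ... | yes refl | yes refl = ⊥-elim (¬IsSquare⇒≢0 ns (solve 1 (λ γ → #0 ⊗ #0 ⊖ #0 ⊗ γ ⊜ #0) γ))
    split : ∀ {g h} → ∃₂ (λ l m → g ≡ l ∷ m ∷ []) → ∃₂ (λ l m → h ≡ l ∷ m ∷ []) → ¬ (α ∷ β ∷ γ ∷ [] ≡ mulF g h)
    split (l , m , refl) (l′ , m′ , refl) refl = ns (det l m l′ m′ , solve 4 (λ l m l′ m′ → let β = l ⊗ m′ ⊕ (m ⊗ l′ ⊕ #0) in
      detᴱ l m l′ m′ ⊗ detᴱ l m l′ m′ ⊜ β ⊗ β ⊖ (l ⊗ l′ ⊕ #0) ⊗ (m ⊗ m′)) l m l′ m′)

  Irreducible⇒nonsquare : ∀ {α β γ} → Irreducible 2 (α ∷ β ∷ γ ∷ []) → ¬ IsSquare (quadDisc α β γ)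
  Irreducible⇒nonsquare (_ , _ , irr) (s , s²≡) =
    irr 1 1 (l₁ ∷ m₁ ∷ []) (l₂ ∷ m₂ ∷ []) (s≤s z≤n) (s≤s z≤n) refl refl refl (quadSplit-mulF split)
    where
    split = quadSplit s²≡
    open QuadSplit split

  -- a₀ = 0 stands for the zero (1 : 0); every other point of the line is some (t : 1).
  HasRoot : (a₀ a₁ a₂ a₃ : Carrier) → Set
  HasRoot a₀ a₁ a₂ a₃ = a₀ ≡ 0# ⊎ ∃ λ t → cubic a₀ a₁ a₂ a₃ t 1# ≡ 0#

  HasRoot? : ∀ a₀ a₁ a₂ a₃ → Dec (HasRoot a₀ a₁ a₂ a₃)
  HasRoot? a₀ a₁ a₂ a₃ = a₀ ≟ 0# ⊎-dec ∃? (λ t → cubic a₀ a₁ a₂ a₃ t 1# ≟ 0#)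

  zero⇒HasRoot : ∀ {a₀ a₁ a₂ a₃} X Y → Nonzero₂ X Y → cubic a₀ a₁ a₂ a₃ X Y ≡ 0# → HasRoot a₀ a₁ a₂ a₃
  zero⇒HasRoot {a₀} {a₁} {a₂} {a₃} X Y nz e with Y ≟ 0#
  ... | yes refl = inj₁ (xy≡0⇒y≡0 (*-≢0 (*-≢0 X≢0 X≢0) X≢0) (by e (solve 5 (λ a₀ a₁ a₂ a₃ X →
      X ⊗ X ⊗ X ⊗ a₀ ⊕ #1 ⊗ #0 ⊜ #0 ⊕ #1 ⊗ cubicᴱ a₀ a₁ a₂ a₃ X #0) a₀ a₁ a₂ a₃ X)))
    where
    X≢0 : X ≢ 0#
    X≢0 X≡0 = nz (X≡0 , refl)
  ... | no Y≢0 = inj₂ (r * X , (begin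
    cubic a₀ a₁ a₂ a₃ (r * X) 1#      ≡⟨ cong (cubic a₀ a₁ a₂ a₃ (r * X)) (inverseˡ Y≢0) ⟨
    cubic a₀ a₁ a₂ a₃ (r * X) (r * Y) ≡⟨ solve 7 (λ a₀ a₁ a₂ a₃ r X Y → cubicᴱ a₀ a₁ a₂ a₃ (r ⊗ X) (r ⊗ Y) ⊜ r ⊗ r ⊗ r ⊗ cubicᴱ a₀ a₁ a₂ a₃ X Y) a₀ a₁ a₂ a₃ r X Y ⟩
    r * r * r * cubic a₀ a₁ a₂ a₃ X Y ≡⟨ cong (r * r * r *_) e ⟩
    r * r * r * 0#                    ≡⟨ zeroʳ _ ⟩
    0#                                ∎))
    where
    open ≡-Reasoning
    r = Y ⁻¹

  record RootFactor (a₀ a₁ a₂ a₃ : Carrier) : Set where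
    field
      l m α β γ : Carrier
      nonzero : Nonzero₂ l m
      a₀≡ : a₀ ≡ l * α
      a₁≡ : a₁ ≡ l * β + m * α
      a₂≡ : a₂ ≡ l * γ + m * β
      a₃≡ : a₃ ≡ m * γ

    δ res : Carrier
    δ   = quadDisc α β γ
    res = quadratic α β γ m (- l)

    cubic≡ : ∀ X Y → cubic a₀ a₁ a₂ a₃ X Y ≡ linear l m X Y * quadratic α β γ X Y
    cubic≡ X Y = trans (cong₂ (λ a b → cubic a b a₂ a₃ X Y) a₀≡ a₁≡) (trans (cong₂ (λ a b → cubic (l * α) (l * β + m * α) a b X Y) a₂≡ a₃≡)
      (solve 7 (λ l m α β γ X Y → cubicᴱ (l ⊗ α) (l ⊗ β ⊕ m ⊗ α) (l ⊗ γ ⊕ m ⊗ β) (m ⊗ γ) X Y ⊜ linearᴱ l m X Y ⊗ quadraticᴱ α β γ X Y) l m α β γ X Y))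

    -- `res`, the value of the quadratic factor at the zero (m : -l) of the linear one, is the
    -- resultant of the two. So `disc` and `δ` lie in the same square class as soon as `res` is
    -- nonzero.
    disc≡ : disc a₀ a₁ a₂ a₃ ≡ res * res * δ
    disc≡ = trans (cong₂ (λ a b → disc a b a₂ a₃) a₀≡ a₁≡) (trans (cong₂ (disc (l * α) (l * β + m * α)) a₂≡ a₃≡)
      (solve 5 (λ l m α β γ → let res = quadraticᴱ α β γ m (⊝ l) in
        discᴱ (l ⊗ α) (l ⊗ β ⊕ m ⊗ α) (l ⊗ γ ⊕ m ⊗ β) (m ⊗ γ) ⊜ res ⊗ res ⊗ (β ⊗ β ⊖ α ⊗ γ)) l m α β γ))

  rootFactor : ∀ {a₀ a₁ a₂ a₃} → HasRoot a₀ a₁ a₂ a₃ → RootFactor a₀ a₁ a₂ a₃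
  rootFactor {a₀} {a₁} {a₂} {a₃} (inj₁ a₀≡0) = record
    { l = 0# ; m = 1# ; α = a₁ ; β = a₂ ; γ = a₃ ; nonzero = 1≢0 ∘ proj₂
    ; a₀≡ = trans a₀≡0 (sym (zeroˡ a₁))
    ; a₁≡ = solve 2 (λ a₁ a₂ → a₁ ⊜ #0 ⊗ a₂ ⊕ #1 ⊗ a₁) a₁ a₂
    ; a₂≡ = solve 2 (λ a₁ a₂ → a₁ ⊜ #0 ⊗ a₂ ⊕ #1 ⊗ a₁) a₂ a₃
    ; a₃≡ = sym (*-identityˡ a₃) }
  rootFactor {a₀} {a₁} {a₂} {a₃} (inj₂ (t , e)) = record
    { l = 1# ; m = - t ; α = a₀ ; β = a₁ + t * a₀ ; γ = a₂ + t * (a₁ + t * a₀) ; nonzero = 1≢0 ∘ proj₁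
    ; a₀≡ = sym (*-identityˡ a₀)
    ; a₁≡ = solve 3 (λ a₀ a₁ t → a₁ ⊜ #1 ⊗ (a₁ ⊕ t ⊗ a₀) ⊕ ⊝ t ⊗ a₀) a₀ a₁ t
    ; a₂≡ = solve 3 (λ b a₂ t → a₂ ⊜ #1 ⊗ (a₂ ⊕ t ⊗ b) ⊕ ⊝ t ⊗ b) (a₁ + t * a₀) a₂ t
    ; a₃≡ = by e (solve 5 (λ a₀ a₁ a₂ a₃ t → a₃ ⊕ #1 ⊗ #0 ⊜ ⊝ t ⊗ (a₂ ⊕ t ⊗ (a₁ ⊕ t ⊗ a₀)) ⊕ #1 ⊗ cubicᴱ a₀ a₁ a₂ a₃ t #1) a₀ a₁ a₂ a₃ t) }

  -- The map d t³ − e² t is additive with kernel {t ∣ d t² = e²} ∪ {0}.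
  abstract
    additive-solve : ∀ {d e} → ¬ IsSquare d → e ≢ 0# → ∀ b → ∃ λ t → d * (t * t * t) + - (e * e * t) ≡ b
    additive-solve {d} {e} d-ns e≢0 = injective⇒surjective (λ t → d * (t * t * t) + - (e * e * t)) λ {x} {y} h →
      decidable-stable (x ≟ y) λ x≢y → d-ns (IsSquare-scale (x-y≢0 x≢y) (e ,
        x-y≡0⇒x≡y _ _ (xy≡0⇒y≡0 (x-y≢0 x≢y) (by h (solve 4 (λ d e x y →
          (x ⊖ y) ⊗ (e ⊗ e ⊖ (x ⊖ y) ⊗ (x ⊖ y) ⊗ d) ⊕ ⊝ #1 ⊗ (d ⊗ (y ⊗ y ⊗ y) ⊖ e ⊗ e ⊗ y)
          ⊜ #0 ⊕ ⊝ #1 ⊗ (d ⊗ (x ⊗ x ⊗ x) ⊖ e ⊗ e ⊗ x)) d e x y)))))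
      where
      x-y≢0 : ∀ {x y} → x ≢ y → x + - y ≢ 0#
      x-y≢0 x≢y h = x≢y (x-y≡0⇒x≡y _ _ h)

  nonsquare-disc⇒a₂≢0 : ∀ {a₀ a₂ a₃} → ¬ IsSquare (disc a₀ 0# a₂ a₃) → a₂ ≢ 0#
  nonsquare-disc⇒a₂≢0 {a₀} {a₃ = a₃} ns refl = ¬IsSquare⇒≢0 ns (solve 2 (λ a₀ a₃ → discᴱ a₀ #0 #0 a₃ ⊜ #0) a₀ a₃)

  -- Restricted to the line t (a₂, a₁) + N the cubic is c(N) + det² t − disc t³.
  nonsquare-disc⇒HasRoot : ∀ {a₀ a₁ a₂ a₃} → ¬ IsSquare (disc a₀ a₁ a₂ a₃) → HasRoot a₀ a₁ a₂ a₃
  nonsquare-disc⇒HasRoot {a₀} {a₁} {a₂} {a₃} ns with a₁ ≟ 0#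
  -- Here N = (1, 0), with determinant a₁ up to sign. If a₁ = 0, the choice is N = (0, 1), with
  -- determinant a₂.
  ... | no a₁≢0 with t , e ← additive-solve ns a₁≢0 a₀ =
    zero⇒HasRoot (t * a₂ + 1#) (t * a₁) (λ (h , ta₁≡0) → 1≢0 (by₂ h (xy≡0⇒y≡0 a₁≢0 (trans (*-comm a₁ t) ta₁≡0))
        (solve 2 (λ a₂ t → #1 ⊕ #1 ⊗ #0 ⊕ ⊝ a₂ ⊗ #0 ⊜ #0 ⊕ #1 ⊗ (t ⊗ a₂ ⊕ #1) ⊕ ⊝ a₂ ⊗ t) a₂ t)))
      (by e (solve 5 (λ a₀ a₁ a₂ a₃ t → cubicᴱ a₀ a₁ a₂ a₃ (t ⊗ a₂ ⊕ #1) (t ⊗ a₁) ⊕ ⊝ #1 ⊗ a₀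
        ⊜ #0 ⊕ ⊝ #1 ⊗ (discᴱ a₀ a₁ a₂ a₃ ⊗ (t ⊗ t ⊗ t) ⊖ a₁ ⊗ a₁ ⊗ t)) a₀ a₁ a₂ a₃ t))
  ... | yes refl with t , e ← additive-solve ns (nonsquare-disc⇒a₂≢0 ns) a₃ =
    zero⇒HasRoot (t * a₂) 1# (1≢0 ∘ proj₂)
      (by e (solve 4 (λ a₀ a₂ a₃ t → cubicᴱ a₀ #0 a₂ a₃ (t ⊗ a₂) #1 ⊕ ⊝ #1 ⊗ a₃
        ⊜ #0 ⊕ ⊝ #1 ⊗ (discᴱ a₀ #0 a₂ a₃ ⊗ (t ⊗ t ⊗ t) ⊖ a₂ ⊗ a₂ ⊗ t)) a₀ a₂ a₃ t))

  cong₄ : ∀ {a b c d a′ b′ c′ d′ : Carrier} → a ≡ a′ → b ≡ b′ → c ≡ c′ → d ≡ d′ →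
    _≡_ {A = List Carrier} (a ∷ b ∷ c ∷ d ∷ []) (a′ ∷ b′ ∷ c′ ∷ d′ ∷ [])
  cong₄ refl refl refl refl = refl

  -- Class, number of zeros and square class of the discriminant are established together: the class
  -- is what is counted, the other two feed the two summations over the pencil.
  data PlaneType (a₀ a₁ a₂ a₃ : Carrier) : Set where
    tangent   : disc a₀ a₁ a₂ a₃ ≡ 0# → 𝓝₂ (a₀ ∷ a₁ ∷ a₂ ∷ a₃ ∷ []) → zeros (cubic a₀ a₁ a₂ a₃) ≡ 2 → PlaneType a₀ a₁ a₂ a₃
    split     : IsSquare (disc a₀ a₁ a₂ a₃) → disc a₀ a₁ a₂ a₃ ≢ 0# → HasRoot a₀ a₁ a₂ a₃ →
                𝓝₃ (a₀ ∷ a₁ ∷ a₂ ∷ a₃ ∷ []) → zeros (cubic a₀ a₁ a₂ a₃) ≡ 3 → PlaneType a₀ a₁ a₂ a₃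
    mixed     : ¬ IsSquare (disc a₀ a₁ a₂ a₃) → 𝓝₄ (a₀ ∷ a₁ ∷ a₂ ∷ a₃ ∷ []) → zeros (cubic a₀ a₁ a₂ a₃) ≡ 1 → PlaneType a₀ a₁ a₂ a₃
    rootless  : IsSquare (disc a₀ a₁ a₂ a₃) → disc a₀ a₁ a₂ a₃ ≢ 0# → ¬ HasRoot a₀ a₁ a₂ a₃ →
                𝓝₅ (a₀ ∷ a₁ ∷ a₂ ∷ a₃ ∷ []) → zeros (cubic a₀ a₁ a₂ a₃) ≡ 0 → PlaneType a₀ a₁ a₂ a₃

  -- A double root can only sit at (a₂ : a₁), where the derivative vanishes.
  record DoubleRoot (a₀ a₁ a₂ a₃ : Carrier) : Set where
    field
      p₀ p₁ : Carrier
      unit  : a₁ * p₁ + a₂ * p₀ ≡ 1#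
      a₀≡   : a₀ ≡ a₁ * a₁ * p₀
      a₃≡   : a₃ ≡ a₂ * a₂ * p₁

  -- The cofactor p₀X + p₁Y is scaled to have the value 1 at (a₂ : a₁), so it does not vanish at the
  -- double root. Then (a₁X - a₂Y)²(p₀X + p₁Y) has middle coefficients a₁ and a₂, because -2 = 1.
  doubleRoot : ∀ {a₀ a₁ a₂ a₃} → Nonzero₂ a₁ a₂ → disc a₀ a₁ a₂ a₃ ≡ 0# → DoubleRoot a₀ a₁ a₂ a₃
  doubleRoot {a₀} {a₁} {a₂} {a₃} nz e with a₁ ≟ 0#
  ... | no a₁≢0 = record { p₀ = p₀ ; p₁ = p₁ ; unit = unit ; a₀≡ = a₀≡ ; a₃≡ = a₃≡ }
    where
    r p₀ p₁ : Carrier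
    r = a₁ ⁻¹
    p₀ = a₀ * (r * r)
    p₁ = r * (1# + - (a₂ * p₀))
    unit : a₁ * p₁ + a₂ * p₀ ≡ 1#
    unit = by (inverseʳ a₁ a₁≢0) (solve 4 (λ a₁ a₂ p₀ r → a₁ ⊗ (r ⊗ (#1 ⊖ a₂ ⊗ p₀)) ⊕ a₂ ⊗ p₀ ⊕ (#1 ⊖ a₂ ⊗ p₀) ⊗ #1
      ⊜ #1 ⊕ (#1 ⊖ a₂ ⊗ p₀) ⊗ (a₁ ⊗ r)) a₁ a₂ p₀ r)
    a₀≡ : a₀ ≡ a₁ * a₁ * p₀
    a₀≡ = by (inverseʳ a₁ a₁≢0) (solve 3 (λ a₀ a₁ r → let k = ⊝ (a₀ ⊗ (a₁ ⊗ r ⊕ #1)) in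
      a₀ ⊕ k ⊗ #1 ⊜ a₁ ⊗ a₁ ⊗ (a₀ ⊗ (r ⊗ r)) ⊕ k ⊗ (a₁ ⊗ r)) a₀ a₁ r)
    a₃≡ : a₃ ≡ a₂ * a₂ * p₁
    a₃≡ = *-cancelˡ-≢0 (*-≢0 (*-≢0 a₁≢0 a₁≢0) a₁≢0) (by e (by₂ unit a₀≡ (solve 6 (λ a₀ a₁ a₂ a₃ p₀ p₁ →
      a₁ ⊗ a₁ ⊗ a₁ ⊗ a₃ ⊕ ⊝ #1 ⊗ #0 ⊕ ⊝ (a₁ ⊗ a₁ ⊗ a₂ ⊗ a₂) ⊗ #1 ⊕ ⊝ (a₂ ⊗ a₂ ⊗ a₂) ⊗ (a₁ ⊗ a₁ ⊗ p₀)
      ⊜ a₁ ⊗ a₁ ⊗ a₁ ⊗ (a₂ ⊗ a₂ ⊗ p₁) ⊕ ⊝ #1 ⊗ discᴱ a₀ a₁ a₂ a₃ ⊕ ⊝ (a₁ ⊗ a₁ ⊗ a₂ ⊗ a₂) ⊗ (a₁ ⊗ p₁ ⊕ a₂ ⊗ p₀) ⊕ ⊝ (a₂ ⊗ a₂ ⊗ a₂) ⊗ a₀) a₀ a₁ a₂ a₃ p₀ p₁)))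
  ... | yes refl = record { p₀ = r ; p₁ = a₃ * (r * r) ; unit = unit ; a₀≡ = a₀≡ ; a₃≡ = a₃≡ }
    where
    a₂≢0 : a₂ ≢ 0#
    a₂≢0 a₂≡0 = nz (refl , a₂≡0)
    r : Carrier
    r = a₂ ⁻¹
    unit : 0# * (a₃ * (r * r)) + a₂ * r ≡ 1#
    unit = trans (cong₂ _+_ (zeroˡ _) (inverseʳ a₂ a₂≢0)) (+-identityˡ 1#)
    a₀≡ : a₀ ≡ 0# * 0# * r
    a₀≡ = trans (xy≡0⇒y≡0 (*-≢0 (*-≢0 a₂≢0 a₂≢0) a₂≢0) (by e (solve 3 (λ a₀ a₂ a₃ →
      a₂ ⊗ a₂ ⊗ a₂ ⊗ a₀ ⊕ ⊝ #1 ⊗ #0 ⊜ #0 ⊕ ⊝ #1 ⊗ discᴱ a₀ #0 a₂ a₃) a₀ a₂ a₃)))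
      (solve 1 (λ r → #0 ⊜ #0 ⊗ #0 ⊗ r) r)
    a₃≡ : a₃ ≡ a₂ * a₂ * (a₃ * (r * r))
    a₃≡ = by (inverseʳ a₂ a₂≢0) (solve 3 (λ a₀ a₁ r → let k = ⊝ (a₀ ⊗ (a₁ ⊗ r ⊕ #1)) in
      a₀ ⊕ k ⊗ #1 ⊜ a₁ ⊗ a₁ ⊗ (a₀ ⊗ (r ⊗ r)) ⊕ k ⊗ (a₁ ⊗ r)) a₃ a₂ r)

  module _ {a₀ a₁ a₂ a₃ : Carrier} where

    disc≡0⇒tangent : Nonzero₂ a₁ a₂ → disc a₀ a₁ a₂ a₃ ≡ 0# → PlaneType a₀ a₁ a₂ a₃
    disc≡0⇒tangent nz e = tangent e
      (1# , a₁ ∷ - a₂ ∷ [] , p₀ ∷ p₁ ∷ [] , 1≢0 , Nonzero₂⇒Linear ℓ₁-nz , Nonzero₂⇒Linear (det≢0⇒Nonzero (det-swap≢0 d≢0)) ,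
       det≢0⇒Independent d≢0 , cong₄
        (trans a₀≡ (solve 2 (λ a p → a ⊗ a ⊗ p ⊜ #1 ⊗ (a ⊗ (a ⊗ p ⊕ #0) ⊕ #0)) a₁ p₀))
        (by unit (solve 4 (λ a₁ a₂ p₀ p₁ → a₁ ⊕ ⊝ a₁ ⊗ #1 ⊜ #1 ⊗ (a₁ ⊗ (a₁ ⊗ p₁ ⊕ (⊝ a₂ ⊗ p₀ ⊕ #0)) ⊕ (⊝ a₂ ⊗ (a₁ ⊗ p₀ ⊕ #0) ⊕ #0)) ⊕ ⊝ a₁ ⊗ (a₁ ⊗ p₁ ⊕ a₂ ⊗ p₀)) a₁ a₂ p₀ p₁))
        (by unit (solve 4 (λ a₁ a₂ p₀ p₁ → a₂ ⊕ ⊝ a₂ ⊗ #1 ⊜ #1 ⊗ (a₁ ⊗ (⊝ a₂ ⊗ p₁) ⊕ ⊝ a₂ ⊗ (a₁ ⊗ p₁ ⊕ (⊝ a₂ ⊗ p₀ ⊕ #0))) ⊕ ⊝ a₂ ⊗ (a₁ ⊗ p₁ ⊕ a₂ ⊗ p₀)) a₁ a₂ p₀ p₁))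
        (trans a₃≡ (solve 2 (λ a p → a ⊗ a ⊗ p ⊜ #1 ⊗ (⊝ a ⊗ (⊝ a ⊗ p))) a₂ p₁)))
      (trans (zeros-* {cubic a₀ a₁ a₂ a₃} {λ X Y → ℓ₁ X Y * ℓ₁ X Y} {linear p₀ p₁} cubic≡ (λ X Y nz′ (h , h′) → det≢0⇒disjoint d≢0 X Y nz′ (x²≡0⇒x≡0 h , h′)))
        (cong₂ ℕ._+_ (trans (∑ℙ-cong λ X Y _ → 𝟙-cong (ℓ₁ X Y * ℓ₁ X Y ≟ 0#) (ℓ₁ X Y ≟ 0#) x²≡0⇒x≡0 (λ h → trans (cong (_* ℓ₁ X Y) h) (zeroˡ _))) (zeros-linear ℓ₁-nz))
          (zeros-linear (det≢0⇒Nonzero (det-swap≢0 d≢0)))))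
      where
      open DoubleRoot (doubleRoot nz e)
      ℓ₁ : Carrier → Carrier → Carrier
      ℓ₁ = linear a₁ (- a₂)
      ℓ₁-nz : Nonzero₂ a₁ (- a₂)
      ℓ₁-nz (a₁≡0 , -a₂≡0) = nz (a₁≡0 , trans (sym (-‿involutive a₂)) (trans (cong -_ -a₂≡0) -0#≈0#))
      d≢0 : det a₁ (- a₂) p₀ p₁ ≢ 0#
      d≢0 h = 1≢0 (trans (sym unit) (trans (solve 4 (λ a₁ a₂ p₀ p₁ → a₁ ⊗ p₁ ⊕ a₂ ⊗ p₀ ⊜ detᴱ a₁ (⊝ a₂) p₀ p₁) a₁ a₂ p₀ p₁) h))
      cubic≡ : ∀ X Y → cubic a₀ a₁ a₂ a₃ X Y ≡ ℓ₁ X Y * ℓ₁ X Y * linear p₀ p₁ X Y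
      cubic≡ X Y = trans (cong₂ (λ a b → cubic a a₁ a₂ b X Y) a₀≡ a₃≡) (by unit (solve 6 (λ a₁ a₂ p₀ p₁ X Y →
        let ℓ = linearᴱ a₁ (⊝ a₂) X Y ; k = ⊝ (X ⊗ Y ⊗ (a₁ ⊗ X ⊕ a₂ ⊗ Y)) in
        cubicᴱ (a₁ ⊗ a₁ ⊗ p₀) a₁ a₂ (a₂ ⊗ a₂ ⊗ p₁) X Y ⊕ k ⊗ #1 ⊜ ℓ ⊗ ℓ ⊗ linearᴱ p₀ p₁ X Y ⊕ k ⊗ (a₁ ⊗ p₁ ⊕ a₂ ⊗ p₀)) a₁ a₂ p₀ p₁ X Y))

    rootFactor-mulF : (R : RootFactor a₀ a₁ a₂ a₃) → let open RootFactor R in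
      a₀ ∷ a₁ ∷ a₂ ∷ a₃ ∷ [] ≡ scale 1# (mulF (l ∷ m ∷ []) (α ∷ β ∷ γ ∷ []))
    rootFactor-mulF R = cong₄
      (trans a₀≡ (solve 2 (λ l α → l ⊗ α ⊜ #1 ⊗ (l ⊗ α ⊕ #0)) l α))
      (trans a₁≡ (solve 4 (λ l m α β → l ⊗ β ⊕ m ⊗ α ⊜ #1 ⊗ (l ⊗ β ⊕ (m ⊗ α ⊕ #0))) l m α β))
      (trans a₂≡ (sym (*-identityˡ _)))
      (trans a₃≡ (sym (*-identityˡ _)))
      where open RootFactor R

    -- The discriminant is res²δ, so δ is a nonsquare and the quadratic left after splitting off a
    -- zero is irreducible.
    nonsquare⇒mixed : ¬ IsSquare (disc a₀ a₁ a₂ a₃) → PlaneType a₀ a₁ a₂ a₃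
    nonsquare⇒mixed ns = mixed ns
      (1# , l ∷ m ∷ [] , α ∷ β ∷ γ ∷ [] , 1≢0 , Nonzero₂⇒Linear nonzero , nonsquare⇒Irreducible δ-ns , rootFactor-mulF R)
      (trans (zeros-* {cubic a₀ a₁ a₂ a₃} {linear l m} {quadratic α β γ} cubic≡ (λ X Y nz (_ , e) → noZero X Y nz e))
        (cong₂ ℕ._+_ (zeros-linear nonzero) (zeros-none {quadratic α β γ} noZero)))
      where
      R : RootFactor a₀ a₁ a₂ a₃
      R = rootFactor (nonsquare-disc⇒HasRoot ns)
      open RootFactor R
      δ-ns : ¬ IsSquare δ
      δ-ns (s , e) = ns (res * s , trans (solve 2 (λ r s → r ⊗ s ⊗ (r ⊗ s) ⊜ r ⊗ r ⊗ (s ⊗ s)) res s) (trans (cong (res * res *_) e) (sym disc≡)))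
      noZero : ∀ X Y → Nonzero₂ X Y → quadratic α β γ X Y ≢ 0#
      noZero X Y nz e = δ-ns (quadratic-zero⇒IsSquare nz e)

    -- As res²δ is a nonzero square, res ≠ 0 and δ is a nonzero square. So the quadratic factor
    -- splits. Its two factors are independent since δ is the square of their determinant, and res
    -- is the product of their determinants with the first factor.
    root⇒split : IsSquare (disc a₀ a₁ a₂ a₃) → disc a₀ a₁ a₂ a₃ ≢ 0# → HasRoot a₀ a₁ a₂ a₃ → PlaneType a₀ a₁ a₂ a₃
    root⇒split (s , s²≡) d≢0 root = split (s , s²≡) d≢0 root
      (1# , l ∷ m ∷ [] , l₁ ∷ m₁ ∷ [] , l₂ ∷ m₂ ∷ [] , 1≢0 , Nonzero₂⇒Linear nonzero ,
        Nonzero₂⇒Linear (det≢0⇒Nonzero det₁₂≢0) , Nonzero₂⇒Linear (det≢0⇒Nonzero (det-swap≢0 det₁₂≢0)) ,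
        det≢0⇒Independent det₁≢0 , det≢0⇒Independent det₂≢0 , det≢0⇒Independent det₁₂≢0 ,
        trans (rootFactor-mulF R) (cong (scale 1# ∘ mulF (l ∷ m ∷ [])) (quadSplit-mulF Q)))
      (trans (zeros-* {cubic a₀ a₁ a₂ a₃} {linear l m} {quadratic α β γ} cubic≡ disjoint)
        (cong₂ ℕ._+_ (zeros-linear nonzero)
          (trans (zeros-* {quadratic α β γ} {linear l₁ m₁} {linear l₂ m₂} quadratic≡ (det≢0⇒disjoint det₁₂≢0))
            (cong₂ ℕ._+_ (zeros-linear (det≢0⇒Nonzero det₁₂≢0)) (zeros-linear (det≢0⇒Nonzero (det-swap≢0 det₁₂≢0)))))))
      where
      R : RootFactor a₀ a₁ a₂ a₃
      R = rootFactor root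
      open RootFactor R
      res≢0 : res ≢ 0#
      res≢0 e = d≢0 (trans disc≡ (trans (cong (λ r → r * res * δ) e) (trans (cong (_* δ) (zeroˡ res)) (zeroˡ δ))))
      δ-square : IsSquare δ
      δ-square = IsSquare-scale res≢0 (s , trans s²≡ disc≡)
      Q : QuadSplit α β γ (proj₁ δ-square)
      Q = quadSplit (proj₂ δ-square)
      open QuadSplit Q
      δ≢0 : δ ≢ 0#
      δ≢0 e = d≢0 (trans disc≡ (trans (cong (res * res *_) e) (zeroʳ _)))
      det₁₂≢0 : det l₁ m₁ l₂ m₂ ≢ 0#
      det₁₂≢0 e = δ≢0 (trans (sym (proj₂ δ-square)) (trans (sym det²) (trans (cong (_* det l₁ m₁ l₂ m₂) e) (zeroˡ _))))
      quadratic≡ : ∀ X Y → quadratic α β γ X Y ≡ linear l₁ m₁ X Y * linear l₂ m₂ X Y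
      quadratic≡ X Y = trans (cong₂ (λ a c → quadratic a β c X Y) α≡ γ≡) (trans (cong (λ b → quadratic (l₁ * l₂) b (m₁ * m₂) X Y) β≡)
        (solve 6 (λ l m l′ m′ X Y → quadraticᴱ (l ⊗ l′) (l ⊗ m′ ⊕ m ⊗ l′) (m ⊗ m′) X Y ⊜ linearᴱ l m X Y ⊗ linearᴱ l′ m′ X Y) l₁ m₁ l₂ m₂ X Y))
      res≡ : res ≡ det l m l₁ m₁ * det l m l₂ m₂
      res≡ = trans (quadratic≡ m (- l)) (solve 6 (λ l m l₁ m₁ l₂ m₂ → linearᴱ l₁ m₁ m (⊝ l) ⊗ linearᴱ l₂ m₂ m (⊝ l) ⊜ detᴱ l m l₁ m₁ ⊗ detᴱ l m l₂ m₂) l m l₁ m₁ l₂ m₂)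
      det₁≢0 : det l m l₁ m₁ ≢ 0#
      det₁≢0 e = res≢0 (trans res≡ (trans (cong (_* det l m l₂ m₂) e) (zeroˡ _)))
      det₂≢0 : det l m l₂ m₂ ≢ 0#
      det₂≢0 e = res≢0 (trans res≡ (trans (cong (det l m l₁ m₁ *_) e) (zeroʳ _)))
      disjoint : ∀ X Y → Nonzero₂ X Y → ¬ (linear l m X Y ≡ 0# × quadratic α β γ X Y ≡ 0#)
      disjoint X Y nz (e , e′) = [ (λ h → det≢0⇒disjoint det₁≢0 X Y nz (e , h)) , (λ h → det≢0⇒disjoint det₂≢0 X Y nz (e , h)) ]′
        (xy≡0⇒ (trans (sym (quadratic≡ X Y)) e′))

    cubic-mulF : ∀ {l m α β γ} → a₀ ∷ a₁ ∷ a₂ ∷ a₃ ∷ [] ≡ mulF (l ∷ m ∷ []) (α ∷ β ∷ γ ∷ []) →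
      ∀ X Y → cubic a₀ a₁ a₂ a₃ X Y ≡ linear l m X Y * quadratic α β γ X Y
    cubic-mulF {l} {m} {α} {β} {γ} refl X Y = solve 7 (λ l m α β γ X Y →
      cubicᴱ (l ⊗ α ⊕ #0) (l ⊗ β ⊕ (m ⊗ α ⊕ #0)) (l ⊗ γ ⊕ m ⊗ β) (m ⊗ γ) X Y ⊜ linearᴱ l m X Y ⊗ quadraticᴱ α β γ X Y) l m α β γ X Y

    cubic-mulF′ : ∀ {l m α β γ} → a₀ ∷ a₁ ∷ a₂ ∷ a₃ ∷ [] ≡ mulF (α ∷ β ∷ γ ∷ []) (l ∷ m ∷ []) →
      ∀ X Y → cubic a₀ a₁ a₂ a₃ X Y ≡ linear l m X Y * quadratic α β γ X Y
    cubic-mulF′ {l} {m} {α} {β} {γ} refl X Y = solve 7 (λ l m α β γ X Y →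
      cubicᴱ (α ⊗ l ⊕ #0) (α ⊗ m ⊕ (β ⊗ l ⊕ #0)) (β ⊗ m ⊕ (γ ⊗ l ⊕ #0)) (γ ⊗ m) X Y ⊜ linearᴱ l m X Y ⊗ quadraticᴱ α β γ X Y) l m α β γ X Y

    linear-zero : ∀ l m → ∃₂ λ X Y → Nonzero₂ X Y × linear l m X Y ≡ 0#
    linear-zero l m with l ≟ 0#
    ... | yes refl = 1# , 0# , 1≢0 ∘ proj₁ , solve 1 (λ m → linearᴱ #0 m #1 #0 ⊜ #0) m
    ... | no l≢0 = m , - l , (λ (m≡0 , -l≡0) → Nonzero₂-root (l≢0 ∘ proj₁) (m≡0 , -l≡0)) , solve 2 (λ l m → linearᴱ l m m (⊝ l) ⊜ #0) l m

    factor⇒HasRoot : ∀ {l m α β γ} → (∀ X Y → cubic a₀ a₁ a₂ a₃ X Y ≡ linear l m X Y * quadratic α β γ X Y) → HasRoot a₀ a₁ a₂ a₃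
    factor⇒HasRoot {l} {m} {α} {β} {γ} cubic≡ with X , Y , nz , e ← linear-zero l m =
      zero⇒HasRoot X Y nz (trans (cubic≡ X Y) (trans (cong (_* quadratic α β γ X Y) e) (zeroˡ _)))

    Irreducible₃⇒¬HasRoot : Irreducible 3 (a₀ ∷ a₁ ∷ a₂ ∷ a₃ ∷ []) → ¬ HasRoot a₀ a₁ a₂ a₃
    Irreducible₃⇒¬HasRoot (_ , _ , irr) root = irr 1 2 (l ∷ m ∷ []) (α ∷ β ∷ γ ∷ []) (s≤s z≤n) (s≤s z≤n) refl refl refl
      (trans (rootFactor-mulF R) (cong₄ (*-identityˡ _) (*-identityˡ _) (*-identityˡ _) (*-identityˡ _)))
      where
      R : RootFactor a₀ a₁ a₂ a₃
      R = rootFactor root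
      open RootFactor R

    noRoot⇒rootless : Nonzero₂ a₁ a₂ → IsSquare (disc a₀ a₁ a₂ a₃) → disc a₀ a₁ a₂ a₃ ≢ 0# → ¬ HasRoot a₀ a₁ a₂ a₃ → PlaneType a₀ a₁ a₂ a₃
    noRoot⇒rootless nz sq d≢0 noRoot = rootless sq d≢0 noRoot (refl , nonzero , irreducible)
      (zeros-none {cubic a₀ a₁ a₂ a₃} (λ X Y nz e → noRoot (zero⇒HasRoot X Y nz e)))
      where
      nonzero : NonzeroF (a₀ ∷ a₁ ∷ a₂ ∷ a₃ ∷ [])
      nonzero with a₁ ≟ 0#
      ... | no a₁≢0 = there (here a₁≢0)
      ... | yes a₁≡0 = there (there (here λ a₂≡0 → nz (a₁≡0 , a₂≡0)))
      irreducible : ∀ d₁ d₂ g h → 1 ℕ.≤ d₁ → 1 ℕ.≤ d₂ → d₁ ℕ.+ d₂ ≡ 3 → Form d₁ g → Form d₂ h → ¬ (a₀ ∷ a₁ ∷ a₂ ∷ a₃ ∷ [] ≡ mulF g h)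
      irreducible 1 2 g h _ _ refl fg fh e with form₁ {g} fg | form₂ {h} fh
      ... | l , m , refl | α , β , γ , refl = noRoot (factor⇒HasRoot (cubic-mulF {l} {m} {α} {β} {γ} e))
      irreducible 2 1 g h _ _ refl fg fh e with form₂ {g} fg | form₁ {h} fh
      ... | α , β , γ , refl | l , m , refl = noRoot (factor⇒HasRoot (cubic-mulF′ {l} {m} {α} {β} {γ} e))
      irreducible (suc (suc (suc zero))) zero g h _ () _ fg fh e
      irreducible (suc (suc (suc (suc _)))) _ g h _ _ () fg fh e
      irreducible zero _ g h () _ _ fg fh e

    planeType : Nonzero₂ a₁ a₂ → PlaneType a₀ a₁ a₂ a₃
    planeType nz with disc a₀ a₁ a₂ a₃ ≟ 0# | IsSquare? (disc a₀ a₁ a₂ a₃) | HasRoot? a₀ a₁ a₂ a₃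
    ... | yes d≡0 | _      | _        = disc≡0⇒tangent nz d≡0
    ... | no d≢0  | no ns  | _        = nonsquare⇒mixed ns
    ... | no d≢0  | yes sq | yes root = root⇒split sq d≢0 root
    ... | no d≢0  | yes sq | no none  = noRoot⇒rootless nz sq d≢0 none

  -- Mutual exclusion of the plane classes

  discF : List Carrier → Carrier
  discF (a₀ ∷ a₁ ∷ a₂ ∷ a₃ ∷ []) = disc a₀ a₁ a₂ a₃
  discF _ = 0#

  module _ {a₀ a₁ a₂ a₃ : Carrier} where

    private
      a : Vec4
      a = a₀ ∷ a₁ ∷ a₂ ∷ a₃ ∷ []

    disc-mulF : ∀ {c l m α β γ} → cubicOf a ≡ scale c (mulF (l ∷ m ∷ []) (α ∷ β ∷ γ ∷ [])) →
      let w = c * c * quadratic α β γ m (- l) in disc a₀ a₁ a₂ a₃ ≡ w * w * quadDisc α β γ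
    disc-mulF {c} {l} {m} {α} {β} {γ} e = trans (cong discF e) (solve 6 (λ c l m α β γ →
      let w = c ⊗ c ⊗ quadraticᴱ α β γ m (⊝ l) in
      discᴱ (c ⊗ (l ⊗ α ⊕ #0)) (c ⊗ (l ⊗ β ⊕ (m ⊗ α ⊕ #0))) (c ⊗ (l ⊗ γ ⊕ m ⊗ β)) (c ⊗ (m ⊗ γ)) ⊜ w ⊗ w ⊗ (β ⊗ β ⊖ α ⊗ γ)) c l m α β γ)

    root-mulF : ∀ {c l m α β γ} → cubicOf a ≡ scale c (mulF (l ∷ m ∷ []) (α ∷ β ∷ γ ∷ [])) → HasRoot a₀ a₁ a₂ a₃
    root-mulF {c} {l} {m} {α} {β} {γ} refl = factor⇒HasRoot {l = l} {m} {c * α} {c * β} {c * γ} λ X Y → solve 8 (λ c l m α β γ X Y →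
      cubicᴱ (c ⊗ (l ⊗ α ⊕ #0)) (c ⊗ (l ⊗ β ⊕ (m ⊗ α ⊕ #0))) (c ⊗ (l ⊗ γ ⊕ m ⊗ β)) (c ⊗ (m ⊗ γ)) X Y
      ⊜ linearᴱ l m X Y ⊗ quadraticᴱ (c ⊗ α) (c ⊗ β) (c ⊗ γ) X Y) c l m α β γ X Y

    quadratic-at : ∀ l m l₁ m₁ l₂ m₂ → quadratic (l₁ * l₂ + 0#) (l₁ * m₂ + (m₁ * l₂ + 0#)) (m₁ * m₂) m (- l) ≡ det l m l₁ m₁ * det l m l₂ m₂
    quadratic-at = solve 6 (λ l m l₁ m₁ l₂ m₂ →
      quadraticᴱ (l₁ ⊗ l₂ ⊕ #0) (l₁ ⊗ m₂ ⊕ (m₁ ⊗ l₂ ⊕ #0)) (m₁ ⊗ m₂) m (⊝ l) ⊜ detᴱ l m l₁ m₁ ⊗ detᴱ l m l₂ m₂)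

    -- In characteristic 3 the cube of lX + mY is l³X³ + m³Y³.
    𝓝₁⇒a₁≡a₂≡0 : 𝓝₁ a → a₁ ≡ 0# × a₂ ≡ 0#
    𝓝₁⇒a₁≡a₂≡0 (c , ℓ , _ , (form , _) , e) with form₁ {ℓ} form
    ... | l , m , refl with e₁ ← proj₂ (∷-injective e) with e₂ ← proj₂ (∷-injective e₁) =
      trans (proj₁ (∷-injective e₁)) (solve 3 (λ c l m → c ⊗ (l ⊗ (l ⊗ m ⊕ (m ⊗ l ⊕ #0)) ⊕ (m ⊗ (l ⊗ l ⊕ #0) ⊕ #0)) ⊜ #0) c l m) ,
      trans (proj₁ (∷-injective e₂)) (solve 3 (λ c l m → c ⊗ (l ⊗ (m ⊗ m) ⊕ m ⊗ (l ⊗ m ⊕ (m ⊗ l ⊕ #0))) ⊜ #0) c l m)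

    𝓝₂⇒disc≡0 : 𝓝₂ a → disc a₀ a₁ a₂ a₃ ≡ 0#
    𝓝₂⇒disc≡0 (c , ℓ₁ , ℓ₂ , _ , (form , _) , (form′ , _) , _ , e) with form₁ {ℓ₁} form | form₁ {ℓ₂} form′
    ... | l , m , refl | l′ , m′ , refl = trans (disc-mulF e) (trans
      (cong (λ r → c * c * r * (c * c * r) * quadDisc (l * l′ + 0#) (l * m′ + (m * l′ + 0#)) (m * m′))
        (trans (quadratic-at l m l m l′ m′) (solve 4 (λ l m l′ m′ → detᴱ l m l m ⊗ detᴱ l m l′ m′ ⊜ #0) l m l′ m′)))
      (solve 2 (λ c d → c ⊗ c ⊗ #0 ⊗ (c ⊗ c ⊗ #0) ⊗ d ⊜ #0) c (quadDisc (l * l′ + 0#) (l * m′ + (m * l′ + 0#)) (m * m′))))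

    -- The discriminant is the square of c² times the product of the three pairwise determinants.
    𝓝₃⇒split : 𝓝₃ a → (IsSquare (disc a₀ a₁ a₂ a₃) × disc a₀ a₁ a₂ a₃ ≢ 0#) × HasRoot a₀ a₁ a₂ a₃
    𝓝₃⇒split (c , ℓ , ℓ₁ , ℓ₂ , c≢0 , (form , nz) , (form′ , nz′) , (form″ , _) , i₁ , i₂ , i₁₂ , e)
      with form₁ {ℓ} form | form₁ {ℓ₁} form′ | form₁ {ℓ₂} form″
    ... | l , m , refl | l₁ , m₁ , refl | l₂ , m₂ , refl = ((s , sym disc≡s²) , (λ h → *-≢0 s≢0 s≢0 (trans (sym disc≡s²) h))) , root-mulF e
      where
      s : Carrier
      s = c * c * (det l m l₁ m₁ * det l m l₂ m₂) * det l₁ m₁ l₂ m₂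
      s≢0 : s ≢ 0#
      s≢0 = *-≢0 (*-≢0 (*-≢0 c≢0 c≢0) (*-≢0 (Independent⇒det≢0 (NonzeroF⇒Nonzero₂ nz) i₁) (Independent⇒det≢0 (NonzeroF⇒Nonzero₂ nz) i₂)))
        (Independent⇒det≢0 (NonzeroF⇒Nonzero₂ nz′) i₁₂)
      disc≡s² : disc a₀ a₁ a₂ a₃ ≡ s * s
      disc≡s² = trans (disc-mulF e) (trans
        (cong (λ r → c * c * r * (c * c * r) * quadDisc (l₁ * l₂ + 0#) (l₁ * m₂ + (m₁ * l₂ + 0#)) (m₁ * m₂)) (quadratic-at l m l₁ m₁ l₂ m₂))
        (solve 6 (λ c r l₁ m₁ l₂ m₂ → let α = l₁ ⊗ l₂ ⊕ #0 ; β = l₁ ⊗ m₂ ⊕ (m₁ ⊗ l₂ ⊕ #0) ; γ = m₁ ⊗ m₂ ; s = c ⊗ c ⊗ r ⊗ detᴱ l₁ m₁ l₂ m₂ in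
          c ⊗ c ⊗ r ⊗ (c ⊗ c ⊗ r) ⊗ (β ⊗ β ⊖ α ⊗ γ) ⊜ s ⊗ s) c (det l m l₁ m₁ * det l m l₂ m₂) l₁ m₁ l₂ m₂))

    𝓝₄⇒nonsquare : 𝓝₄ a → ¬ IsSquare (disc a₀ a₁ a₂ a₃)
    𝓝₄⇒nonsquare (c , ℓ , Q , c≢0 , (form , nz) , irr , e) (s , s²≡) with form₁ {ℓ} form | form₂ {Q} (proj₁ irr)
    ... | l , m , refl | α , β , γ , refl = Irreducible⇒nonsquare irr (IsSquare-scale w≢0 (s , trans s²≡ (disc-mulF e)))
      where
      w≢0 : c * c * quadratic α β γ m (- l) ≢ 0#
      w≢0 = *-≢0 (*-≢0 c≢0 c≢0) λ h → Irreducible⇒nonsquare irr (quadratic-zero⇒IsSquare (Nonzero₂-root (NonzeroF⇒Nonzero₂ nz)) h)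

  kindOf : ∀ {a₀ a₁ a₂ a₃} → PlaneType a₀ a₁ a₂ a₃ → Kind
  kindOf (tangent _ _ _)      = tangentᴷ
  kindOf (split _ _ _ _ _)    = splitᴷ
  kindOf (mixed _ _ _)        = mixedᴷ
  kindOf (rootless _ _ _ _ _) = rootlessᴷ

  sqrts-kind : ∀ {a₀ a₁ a₂ a₃} (T : PlaneType a₀ a₁ a₂ a₃) → sqrts (disc a₀ a₁ a₂ a₃) ≡ sqrtsᴷ (kindOf T)
  sqrts-kind (tangent d≡0 _ _) = trans (cong sqrts d≡0) sqrts-0
  sqrts-kind (split (s , s²≡) d≢0 _ _ _) = trans (cong sqrts (sym s²≡)) (sqrts-square λ { refl → d≢0 (trans (sym s²≡) (zeroˡ 0#)) })
  sqrts-kind (mixed ns _ _) = sqrts-nonsquare ns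
  sqrts-kind (rootless (s , s²≡) d≢0 _ _ _) = trans (cong sqrts (sym s²≡)) (sqrts-square λ { refl → d≢0 (trans (sym s²≡) (zeroˡ 0#)) })

  zeros-kind : ∀ {a₀ a₁ a₂ a₃} (T : PlaneType a₀ a₁ a₂ a₃) → zeros (cubic a₀ a₁ a₂ a₃) ≡ zerosᴷ (kindOf T)
  zeros-kind (tangent _ _ e)      = e
  zeros-kind (split _ _ _ _ e)    = e
  zeros-kind (mixed _ _ e)        = e
  zeros-kind (rootless _ _ _ _ e) = e

  𝓝ᴷ : Kind → Vec4 → Set
  𝓝ᴷ tangentᴷ  = 𝓝₂
  𝓝ᴷ splitᴷ    = 𝓝₃
  𝓝ᴷ mixedᴷ    = 𝓝₄
  𝓝ᴷ rootlessᴷ = 𝓝₅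

  module _ {a₀ a₁ a₂ a₃ : Carrier} where

    in-class : (T : PlaneType a₀ a₁ a₂ a₃) → 𝓝ᴷ (kindOf T) (a₀ ∷ a₁ ∷ a₂ ∷ a₃ ∷ [])
    in-class (tangent _ n _)      = n
    in-class (split _ _ _ n _)    = n
    in-class (mixed _ n _)        = n
    in-class (rootless _ _ _ n _) = n

    -- 𝓝₂, 𝓝₃ and 𝓝₄ are told apart by the discriminant being zero, a nonzero square or a nonsquare;
    -- 𝓝₅ has no zero, while each of the other three types has one.
    class-unique : ∀ k → 𝓝ᴷ k (a₀ ∷ a₁ ∷ a₂ ∷ a₃ ∷ []) → (T : PlaneType a₀ a₁ a₂ a₃) → kindOf T ≡ k
    class-unique tangentᴷ n (tangent _ _ _)      = refl
    class-unique tangentᴷ n (split _ d≢0 _ _ _)  = ⊥-elim (d≢0 (𝓝₂⇒disc≡0 n))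
    class-unique tangentᴷ n (mixed ns _ _)       = ⊥-elim (¬IsSquare⇒≢0 ns (𝓝₂⇒disc≡0 n))
    class-unique tangentᴷ n (rootless _ d≢0 _ _ _) = ⊥-elim (d≢0 (𝓝₂⇒disc≡0 n))
    class-unique splitᴷ n (tangent d≡0 _ _)      = ⊥-elim (proj₂ (proj₁ (𝓝₃⇒split n)) d≡0)
    class-unique splitᴷ n (split _ _ _ _ _)      = refl
    class-unique splitᴷ n (mixed ns _ _)         = ⊥-elim (ns (proj₁ (proj₁ (𝓝₃⇒split n))))
    class-unique splitᴷ n (rootless _ _ none _ _) = ⊥-elim (none (proj₂ (𝓝₃⇒split n)))
    class-unique mixedᴷ n (tangent d≡0 _ _)      = ⊥-elim (¬IsSquare⇒≢0 (𝓝₄⇒nonsquare n) d≡0)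
    class-unique mixedᴷ n (split sq _ _ _ _)     = ⊥-elim (𝓝₄⇒nonsquare n sq)
    class-unique mixedᴷ n (mixed _ _ _)          = refl
    class-unique mixedᴷ n (rootless sq _ _ _ _)  = ⊥-elim (𝓝₄⇒nonsquare n sq)
    class-unique rootlessᴷ n (tangent _ (c , ℓ₁ , ℓ₂ , _ , (form , _) , (form′ , _) , _ , e) _) with form₁ {ℓ₁} form | form₁ {ℓ₂} form′
    ... | _ , _ , refl | _ , _ , refl = ⊥-elim (Irreducible₃⇒¬HasRoot n (root-mulF e))
    class-unique rootlessᴷ n (split _ _ root _ _) = ⊥-elim (Irreducible₃⇒¬HasRoot n root)
    class-unique rootlessᴷ n (mixed ns _ _)      = ⊥-elim (Irreducible₃⇒¬HasRoot n (nonsquare-disc⇒HasRoot ns))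
    class-unique rootlessᴷ n (rootless _ _ _ _ _) = refl

  -- Normalised coordinate vectors

  leadInv : ∀ {n} → Vec Carrier n → Carrier
  -- The value 1 for the zero vector makes `leadInv` nonzero without a hypothesis.
  leadInv []       = 1#
  leadInv (x ∷ xs) with x ≟ 0#
  ... | yes _ = leadInv xs
  ... | no  _ = x ⁻¹

  leadInv≢0 : ∀ {n} (v : Vec Carrier n) → leadInv v ≢ 0#
  leadInv≢0 []       = 1≢0
  leadInv≢0 (x ∷ xs) with x ≟ 0#
  ... | yes _   = leadInv≢0 xs
  ... | no  x≢0 = ⁻¹-≢0 x≢0

  normalize : ∀ {n} → Vec Carrier n → Vec Carrier n
  normalize v = vmap (leadInv v *_) v

  AllZero : ∀ {n} → Vec Carrier n → Set
  AllZero []       = ⊤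
  AllZero (x ∷ xs) = x ≡ 0# × AllZero xs

  normalize-Normalized : ∀ {n} (v : Vec Carrier n) → ¬ AllZero v → Normalized (normalize v)
  normalize-Normalized []       nz = nz _
  normalize-Normalized (x ∷ xs) nz with x ≟ 0#
  ... | yes x≡0 = inj₂ (trans (cong (leadInv xs *_) x≡0) (zeroʳ _) , normalize-Normalized xs (λ z → nz (x≡0 , z)))
  ... | no  x≢0 = inj₁ (inverseˡ x≢0)

  Normalized-scale : ∀ {n c} (v : Vec Carrier n) → c ≢ 0# → Normalized v → Normalized (vmap (c *_) v) → c ≡ 1#
  Normalized-scale {c = c} (x ∷ xs) c≢0 (inj₁ refl)       (inj₁ e)       = trans (sym (*-identityʳ c)) e
  Normalized-scale {c = c} (x ∷ xs) c≢0 (inj₁ refl)       (inj₂ (e , _)) = ⊥-elim (c≢0 (trans (sym (*-identityʳ c)) e))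
  Normalized-scale {c = c} (x ∷ xs) c≢0 (inj₂ (refl , n)) (inj₁ e)       = ⊥-elim (0≢1 (trans (sym (zeroʳ c)) e))
  Normalized-scale (x ∷ xs) c≢0 (inj₂ (refl , n)) (inj₂ (_ , n′)) = Normalized-scale xs c≢0 n n′

  vmap-* : ∀ {n} c d (v : Vec Carrier n) → vmap (c *_) (vmap (d *_) v) ≡ vmap ((c * d) *_) v
  vmap-* c d []       = refl
  vmap-* c d (x ∷ xs) = cong₂ _∷_ (sym (*-assoc c d x)) (vmap-* c d xs)

  vmap-1 : ∀ {n} (v : Vec Carrier n) → vmap (1# *_) v ≡ v
  vmap-1 []       = refl
  vmap-1 (x ∷ xs) = cong₂ _∷_ (*-identityˡ x) (vmap-1 xs)

  normalize-unique : ∀ {n c} (v w : Vec Carrier n) → c ≢ 0# → Normalized w → w ≡ vmap (c *_) v → Normalized (normalize v) → normalize v ≡ w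
  normalize-unique {c = c} v w c≢0 nw w≡cv nv = trans normalize≡ (trans (cong (λ k → vmap (k *_) w) k≡1) (vmap-1 w))
    where
    k : Carrier
    k = leadInv v * c ⁻¹
    kc≡ : k * c ≡ leadInv v
    kc≡ = trans (*-assoc _ _ _) (trans (cong (leadInv v *_) (inverseˡ c≢0)) (*-identityʳ _))
    normalize≡ : normalize v ≡ vmap (k *_) w
    normalize≡ = sym (trans (cong (vmap (k *_)) w≡cv) (trans (vmap-* k c v) (cong (λ d → vmap (d *_) v) kc≡)))
    k≡1 : k ≡ 1#
    k≡1 = Normalized-scale w (*-≢0 (leadInv≢0 v) (⁻¹-≢0 c≢0)) nw (subst Normalized normalize≡ nv)

  Normalized⇒¬AllZero : ∀ {n} (v : Vec Carrier n) → Normalized v → ¬ AllZero v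
  Normalized⇒¬AllZero (x ∷ xs) (inj₁ refl)    (e , _) = 1≢0 e
  Normalized⇒¬AllZero (x ∷ xs) (inj₂ (_ , n)) (_ , z) = Normalized⇒¬AllZero xs n z

  ∈points⇒ : ∀ {X Y} → (X , Y) ∈ points → Y ≡ 1# ⊎ (X ≡ 1# × Y ≡ 0#)
  ∈points⇒ (here refl) = inj₂ (refl , refl)
  ∈points⇒ (there p) with _ , _ , refl ← ∈-map⁻ (_, 1#) p = inj₁ refl

  ∈points⇒Nonzero₂ : ∀ {X Y} → (X , Y) ∈ points → Nonzero₂ X Y
  ∈points⇒Nonzero₂ p with ∈points⇒ p
  ... | inj₁ refl          = 1≢0 ∘ proj₂
  ... | inj₂ (refl , refl) = 1≢0 ∘ proj₁

  ∑-none : ∀ {A : Set} (xs : List A) {P : A → Set} (P? : ∀ x → Dec (P x)) → (∀ {x} → x ∈ xs → ¬ P x) → ∑ xs (λ x → 𝟙 (P? x)) ≡ 0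
  ∑-none []       P? none = refl
  ∑-none (x ∷ xs) P? none = cong₂ ℕ._+_ (𝟙-no (P? x) (none (here refl))) (∑-none xs P? (none ∘ there))

  ∑ℙ-comm : ∀ (f : (X Y U V : Carrier) → ℕ) →
    ∑ℙ (λ X Y → ∑ℙ (λ U V → f X Y U V)) ≡ ∑ℙ (λ U V → ∑ℙ (λ X Y → f X Y U V))
  ∑ℙ-comm f = begin
    ∑ℙ (λ X Y → ∑ℙ (λ U V → f X Y U V))
      ≡⟨ trans (∑-points (λ X Y → ∑ points (λ (U , V) → f X Y U V))) (∑ℙ-cong λ X Y _ → ∑-points (f X Y)) ⟨
    ∑ points (λ (X , Y) → ∑ points (λ (U , V) → f X Y U V))
      ≡⟨ ∑-comm points points (λ (X , Y) (U , V) → f X Y U V) ⟩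
    ∑ points (λ (U , V) → ∑ points (λ (X , Y) → f X Y U V))
      ≡⟨ trans (∑-points (λ U V → ∑ points (λ (X , Y) → f X Y U V))) (∑ℙ-cong λ U V _ → ∑-points (λ X Y → f X Y U V)) ⟩
    ∑ℙ (λ U V → ∑ℙ (λ X Y → f X Y U V)) ∎
    where open ≡-Reasoning

  ∑ℙ-1 : ∑ℙ (λ _ _ → 1) ≡ suc (length els)
  ∑ℙ-1 = cong suc (∑-1 els)

  -- The pencil of planes through the line

  -- The planes a₀ = −(z₁a₁ + z₀a₂), a₃ = −(z₄a₁ + z₃a₂): the plane with (a₂ : a₁) = (X : Y) has discriminant
  -- f(X, Y), f being the quartic, and its cubic form is −(X ∂f/∂X + Y ∂f/∂Y) with the derivatives taken at (U, V).
  module Pencil (z₀ z₁ z₃ z₄ : Carrier) (Δ≢0 : Δ₁ z₀ z₁ z₃ z₄ ≢ 0#) where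

    Q : Carrier → Carrier → Carrier
    Q = quartic z₀ z₁ 1# z₃ z₄

    vec : Carrier → Carrier → Vec4
    vec X Y = - (z₁ * Y + z₀ * X) ∷ Y ∷ X ∷ - (z₄ * Y + z₃ * X) ∷ []

    plane : Carrier × Carrier → Vec4
    plane (X , Y) = normalize (vec X Y)

    module _ (X Y : Carrier) where
      c b₀ b₁ b₂ b₃ : Carrier
      c  = leadInv (vec X Y)
      b₀ = c * - (z₁ * Y + z₀ * X)
      b₁ = c * Y
      b₂ = c * X
      b₃ = c * - (z₄ * Y + z₃ * X)

      c≢0 : c ≢ 0#
      c≢0 = leadInv≢0 (vec X Y)

      -- The discriminant has degree 4, so normalisation multiplies it by c⁴, which affects neither
      -- its vanishing nor its square class.
      disc-plane : disc b₀ b₁ b₂ b₃ ≡ c * c * (c * c) * Q X Y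
      disc-plane = solve 7 (λ z₀ z₁ z₃ z₄ c X Y →
        discᴱ (c ⊗ ⊝ (z₁ ⊗ Y ⊕ z₀ ⊗ X)) (c ⊗ Y) (c ⊗ X) (c ⊗ ⊝ (z₄ ⊗ Y ⊕ z₃ ⊗ X)) ⊜ c ⊗ c ⊗ (c ⊗ c) ⊗ quarticᴱ z₀ z₁ #1 z₃ z₄ X Y)
        z₀ z₁ z₃ z₄ c X Y

    -- Both are minus the partial derivatives.
    ∂X ∂Y : Carrier → Carrier → Carrier
    ∂X U V = - (z₀ * (U * U * U)) + U * V * V + - (z₃ * (V * V * V))
    ∂Y U V = - (z₁ * (U * U * U)) + U * U * V + - (z₄ * (V * V * V))

    cubic-plane : ∀ X Y U V → cubic (b₀ X Y) (b₁ X Y) (b₂ X Y) (b₃ X Y) U V ≡ c X Y * linear (∂X U V) (∂Y U V) X Y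
    cubic-plane X Y U V = solve 9 (λ z₀ z₁ z₃ z₄ c X Y U V →
      cubicᴱ (c ⊗ ⊝ (z₁ ⊗ Y ⊕ z₀ ⊗ X)) (c ⊗ Y) (c ⊗ X) (c ⊗ ⊝ (z₄ ⊗ Y ⊕ z₃ ⊗ X)) U V ⊜
      c ⊗ linearᴱ (⊝ (z₀ ⊗ (U ⊗ U ⊗ U)) ⊕ U ⊗ V ⊗ V ⊕ ⊝ (z₃ ⊗ (V ⊗ V ⊗ V))) (⊝ (z₁ ⊗ (U ⊗ U ⊗ U)) ⊕ U ⊗ U ⊗ V ⊕ ⊝ (z₄ ⊗ (V ⊗ V ⊗ V))) X Y)
      z₀ z₁ z₃ z₄ (c X Y) X Y U V

    -- A common zero (t : 1) of the derivatives determines z₃ = t - z₀t³ and z₄ = t² - z₁t³, and a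
    -- common zero (1 : 0) gives z₀ = z₁ = 0; in both cases `Δ₁` vanishes identically.
    ∂-Nonzero₂ : ∀ U V → Nonzero₂ U V → Nonzero₂ (∂X U V) (∂Y U V)
    ∂-Nonzero₂ U V nz (e , e′) with V ≟ 0#
    ... | yes refl = Δ≢0 (trans (cong₂ (λ a b → Δ₁ a b z₃ z₄) z₀≡0 z₁≡0) (solve 2 (λ z₃ z₄ → Δᴱ #0 #0 #1 z₃ z₄ ⊜ #0) z₃ z₄))
      where
      U³≢0 : U * U * U ≢ 0#
      U³≢0 = *-≢0 (*-≢0 U≢0 U≢0) U≢0
        where
        U≢0 : U ≢ 0#
        U≢0 h = nz (h , refl)
      z₀≡0 : z₀ ≡ 0#
      z₀≡0 = xy≡0⇒y≡0 U³≢0 (by e (solve 3 (λ z₀ z₃ U → U ⊗ U ⊗ U ⊗ z₀ ⊕ ⊝ #1 ⊗ #0 ⊜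
        #0 ⊕ ⊝ #1 ⊗ (⊝ (z₀ ⊗ (U ⊗ U ⊗ U)) ⊕ U ⊗ #0 ⊗ #0 ⊕ ⊝ (z₃ ⊗ (#0 ⊗ #0 ⊗ #0)))) z₀ z₃ U))
      z₁≡0 : z₁ ≡ 0#
      z₁≡0 = xy≡0⇒y≡0 U³≢0 (by e′ (solve 3 (λ z₁ z₄ U → U ⊗ U ⊗ U ⊗ z₁ ⊕ ⊝ #1 ⊗ #0 ⊜
        #0 ⊕ ⊝ #1 ⊗ (⊝ (z₁ ⊗ (U ⊗ U ⊗ U)) ⊕ U ⊗ U ⊗ #0 ⊕ ⊝ (z₄ ⊗ (#0 ⊗ #0 ⊗ #0)))) z₁ z₄ U))
    ... | no V≢0 = Δ≢0 (trans (cong₂ (Δ₁ z₀ z₁) z₃≡ z₄≡)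
        (solve 3 (λ z₀ z₁ t → Δᴱ z₀ z₁ #1 (t ⊖ z₀ ⊗ (t ⊗ t ⊗ t)) (t ⊗ t ⊖ z₁ ⊗ (t ⊗ t ⊗ t)) ⊜ #0) z₀ z₁ t))
      where
      r t : Carrier
      r = V ⁻¹
      t = r * U
      tV≡U : t * V ≡ U
      tV≡U = by (inverseʳ V V≢0) (solve 3 (λ U V r → r ⊗ U ⊗ V ⊕ U ⊗ #1 ⊜ U ⊕ U ⊗ (V ⊗ r)) U V r)
      V³≢0 : V * V * V ≢ 0#
      V³≢0 = *-≢0 (*-≢0 V≢0 V≢0) V≢0
      z₃≡ : z₃ ≡ t + - (z₀ * (t * t * t))
      z₃≡ = *-cancelˡ-≢0 V³≢0 (by (trans (cong (λ u → ∂X u V) tV≡U) e) (solve 4 (λ z₀ z₃ t V → let U = t ⊗ V in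
        V ⊗ V ⊗ V ⊗ z₃ ⊕ ⊝ #1 ⊗ #0 ⊜ V ⊗ V ⊗ V ⊗ (t ⊖ z₀ ⊗ (t ⊗ t ⊗ t)) ⊕ ⊝ #1 ⊗ (⊝ (z₀ ⊗ (U ⊗ U ⊗ U)) ⊕ U ⊗ V ⊗ V ⊕ ⊝ (z₃ ⊗ (V ⊗ V ⊗ V)))) z₀ z₃ t V))
      z₄≡ : z₄ ≡ t * t + - (z₁ * (t * t * t))
      z₄≡ = *-cancelˡ-≢0 V³≢0 (by (trans (cong (λ u → ∂Y u V) tV≡U) e′) (solve 4 (λ z₁ z₄ t V → let U = t ⊗ V in
        V ⊗ V ⊗ V ⊗ z₄ ⊕ ⊝ #1 ⊗ #0 ⊜ V ⊗ V ⊗ V ⊗ (t ⊗ t ⊖ z₁ ⊗ (t ⊗ t ⊗ t)) ⊕ ⊝ #1 ⊗ (⊝ (z₁ ⊗ (U ⊗ U ⊗ U)) ⊕ U ⊗ U ⊗ V ⊕ ⊝ (z₄ ⊗ (V ⊗ V ⊗ V)))) z₁ z₄ t V))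

    b-Nonzero₂ : ∀ {X Y} → Nonzero₂ X Y → Nonzero₂ (b₁ X Y) (b₂ X Y)
    b-Nonzero₂ {X} {Y} nz (e , e′) = nz (xy≡0⇒y≡0 (c≢0 X Y) e′ , xy≡0⇒y≡0 (c≢0 X Y) e)

    D : Carrier → Carrier → Carrier
    D X Y = disc (b₀ X Y) (b₁ X Y) (b₂ X Y) (b₃ X Y)

    Type : Carrier → Carrier → Set
    Type X Y = PlaneType (b₀ X Y) (b₁ X Y) (b₂ X Y) (b₃ X Y)

    type : ∀ {X Y} → Nonzero₂ X Y → Type X Y
    type nz = planeType (b-Nonzero₂ nz)

    abstract
      kind : Carrier × Carrier → Kind
      kind (X , Y) with ¬? (X ≟ 0# ×-dec Y ≟ 0#)
      ... | yes nz = kindOf (type nz)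
      -- A placeholder: (0, 0) represents no point of the line.
      ... | no _   = tangentᴷ

      kind-type : ∀ {X Y} → Nonzero₂ X Y → ∃ λ (T : Type X Y) → kind (X , Y) ≡ kindOf T
      kind-type {X} {Y} nz with ¬? (X ≟ 0# ×-dec Y ≟ 0#)
      ... | yes nz′ = type nz′ , refl
      ... | no ¬nz  = ⊥-elim (¬nz nz)

    n : Kind → ℕ
    n = count kind points

    Q≡0⇔disc≡0 : ∀ {X Y} → (D X Y ≡ 0# → Q X Y ≡ 0#) × (Q X Y ≡ 0# → D X Y ≡ 0#)
    Q≡0⇔disc≡0 {X} {Y} = (λ e → xy≡0⇒y≡0 (*-≢0 c²≢0 c²≢0) (trans (sym (disc-plane X Y)) e)) , (λ e → trans (disc-plane X Y) (trans (cong (c X Y * c X Y * (c X Y * c X Y) *_) e) (zeroʳ _)))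
      where
      c²≢0 : c X Y * c X Y ≢ 0#
      c²≢0 = *-≢0 (c≢0 X Y) (c≢0 X Y)

    square-disc⇒square-Q : ∀ {X Y} → IsSquare (D X Y) → IsSquare (Q X Y)
    square-disc⇒square-Q {X} {Y} sq = IsSquare-scale (*-≢0 (c≢0 X Y) (c≢0 X Y)) (subst IsSquare (disc-plane X Y) sq)

    square-Q⇒square-disc : ∀ {X Y} → IsSquare (Q X Y) → IsSquare (D X Y)
    square-Q⇒square-disc {X} {Y} (s , e) = c X Y * c X Y * s , trans
      (solve 2 (λ c s → c ⊗ c ⊗ s ⊗ (c ⊗ c ⊗ s) ⊜ c ⊗ c ⊗ (c ⊗ c) ⊗ (s ⊗ s)) (c X Y) s) (trans (cong (c X Y * c X Y * (c X Y * c X Y) *_) e) (sym (disc-plane X Y)))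

    n-tangent : n tangentᴷ ≡ zeros Q
    n-tangent = trans (∑-points (λ X Y → 𝟙 (kind (X , Y) ≟ᴷ tangentᴷ))) (∑ℙ-cong λ X Y nz → 𝟙-cong (kind (X , Y) ≟ᴷ tangentᴷ) (Q X Y ≟ 0#)
      (λ e → let T , e′ = kind-type nz in to T (trans (sym e′) e))
      (λ e → let T , e′ = kind-type nz in trans e′ (from T e)))
      where
      to : ∀ {X Y} (T : Type X Y) → kindOf T ≡ tangentᴷ → Q X Y ≡ 0#
      to {X} {Y} (tangent d≡0 _ _) _ = proj₁ (Q≡0⇔disc≡0 {X} {Y}) d≡0
      from : ∀ {X Y} (T : Type X Y) → Q X Y ≡ 0# → kindOf T ≡ tangentᴷ
      from (tangent _ _ _) _ = refl
      from {X} {Y} (split _ d≢0 _ _ _) e = ⊥-elim (d≢0 (proj₂ (Q≡0⇔disc≡0 {X} {Y}) e))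
      from {X} {Y} (mixed ns _ _) e = ⊥-elim (¬IsSquare⇒≢0 ns (proj₂ (Q≡0⇔disc≡0 {X} {Y}) e))
      from {X} {Y} (rootless _ d≢0 _ _ _) e = ⊥-elim (d≢0 (proj₂ (Q≡0⇔disc≡0 {X} {Y}) e))

    ∑sqrts : ∑ points (sqrtsᴷ ∘ kind) ≡ doubleCover z₀ z₁ z₃ z₄
    ∑sqrts = trans (∑-points (λ X Y → sqrtsᴷ (kind (X , Y)))) (∑ℙ-cong λ X Y nz → let T , e = kind-type nz in
      trans (cong sqrtsᴷ e) (trans (sym (sqrts-kind T)) (trans (cong sqrts (disc-plane X Y)) (sqrts-scale (Q X Y) (*-≢0 (c≢0 X Y) (c≢0 X Y))))))

    -- Double counting of planes with a zero of their cubic: the cubic is linear in (X, Y), so after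
    -- exchanging the sums each (U, V) leaves a nonzero linear form, with a single zero.
    ∑zeros : ∑ points (zerosᴷ ∘ kind) ≡ suc (length els)
    ∑zeros = begin
      ∑ points (zerosᴷ ∘ kind) ≡⟨ ∑-points (λ X Y → zerosᴷ (kind (X , Y))) ⟩
      ∑ℙ (λ X Y → zerosᴷ (kind (X , Y))) ≡⟨ ∑ℙ-cong {g = λ X Y → zeros (linear′ X Y)} pointwise ⟩
      ∑ℙ (λ X Y → zeros (linear′ X Y)) ≡⟨ ∑ℙ-comm (λ X Y U V → 𝟙 (linear′ X Y U V ≟ 0#)) ⟩
      ∑ℙ (λ U V → zeros (linear (∂X U V) (∂Y U V))) ≡⟨ ∑ℙ-cong (λ U V nz → zeros-linear (∂-Nonzero₂ U V nz)) ⟩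
      ∑ℙ (λ _ _ → 1) ≡⟨ ∑ℙ-1 ⟩
      suc (length els) ∎
      where
      open ≡-Reasoning
      linear′ : (X Y U V : Carrier) → Carrier
      linear′ X Y U V = linear (∂X U V) (∂Y U V) X Y
      pointwise : ∀ X Y → Nonzero₂ X Y → zerosᴷ (kind (X , Y)) ≡ zeros (linear′ X Y)
      pointwise X Y nz = let T , e = kind-type nz in trans (cong zerosᴷ e) (trans (sym (zeros-kind T))
        (∑ℙ-cong λ U V _ → 𝟙-cong (cubic (b₀ X Y) (b₁ X Y) (b₂ X Y) (b₃ X Y) U V ≟ 0#) (linear′ X Y U V ≟ 0#)
          (λ e → xy≡0⇒y≡0 (c≢0 X Y) (trans (sym (cubic-plane X Y U V)) e))
          (λ e → trans (cubic-plane X Y U V) (trans (cong (c X Y *_) e) (zeroʳ _)))))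

    total : n tangentᴷ ℕ.+ n splitᴷ ℕ.+ n mixedᴷ ℕ.+ n rootlessᴷ ≡ suc (length els)
    total = trans (sym (trans (∑-kind kind points (λ _ → 1))
      (solveℕ 4 (λ a b c d → con 1 :* a :+ con 1 :* b :+ con 1 :* c :+ con 1 :* d := a :+ b :+ c :+ d) refl
        (n tangentᴷ) (n splitᴷ) (n mixedᴷ) (n rootlessᴷ))))
      (trans (∑-points (λ _ _ → 1)) ∑ℙ-1)

    -- Planes and incidences are equally many, q + 1; cancelling n₂ + n₃ + n₄ leaves n₅ = n₂ + 2n₃.
    n-rootless : n rootlessᴷ ≡ n tangentᴷ ℕ.+ 2 ℕ.* n splitᴷ
    n-rootless = ℕ.+-cancelˡ-≡ (n tangentᴷ ℕ.+ n splitᴷ ℕ.+ n mixedᴷ) _ _ (trans total (trans (sym ∑zeros) (trans (∑-kind kind points zerosᴷ)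
      (solveℕ 4 (λ a b c d → con 2 :* a :+ con 3 :* b :+ con 1 :* c :+ con 0 :* d := (a :+ b :+ c) :+ (a :+ con 2 :* b)) refl
        (n tangentᴷ) (n splitᴷ) (n mixedᴷ) (n rootlessᴷ)))))

    nonzero-square-value : ∀ {X Y} → (X , Y) ∈ points → kind (X , Y) ≡ splitᴷ ⊎ kind (X , Y) ≡ rootlessᴷ →
      ∃ λ s → s ≢ 0# × s * s ≡ Q X Y
    nonzero-square-value {X} {Y} p k = let T , e = kind-type (∈points⇒Nonzero₂ p) in
      from T ([ (λ h → inj₁ (trans (sym e) h)) , (λ h → inj₂ (trans (sym e) h)) ]′ k)
      where
      root : IsSquare (D X Y) → D X Y ≢ 0# → ∃ λ s → s ≢ 0# × s * s ≡ Q X Y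
      root sq d≢0 = let s , e = square-disc⇒square-Q {X} {Y} sq in
        s , (λ s≡0 → d≢0 (proj₂ (Q≡0⇔disc≡0 {X} {Y}) (trans (sym e) (trans (cong (_* s) s≡0) (zeroˡ s))))) , e
      from : (T : Type X Y) → kindOf T ≡ splitᴷ ⊎ kindOf T ≡ rootlessᴷ → ∃ λ s → s ≢ 0# × s * s ≡ Q X Y
      from (split sq d≢0 _ _ _) _    = root sq d≢0
      from (rootless sq d≢0 _ _ _) _ = root sq d≢0
      from (tangent _ _ _) (inj₁ ())
      from (tangent _ _ _) (inj₂ ())
      from (mixed _ _ _) (inj₁ ())
      from (mixed _ _ _) (inj₂ ())

    mixed⇒nonsquare : ∀ {X Y} → Nonzero₂ X Y → kind (X , Y) ≡ mixedᴷ → ¬ IsSquare (Q X Y)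
    mixed⇒nonsquare {X} {Y} nz k sq = let T , e = kind-type nz in from T (trans (sym e) k)
      where
      from : (T : Type X Y) → kindOf T ≢ mixedᴷ
      from (mixed ns _ _) _ = ns (square-Q⇒square-disc {X} {Y} sq)

    nonsquare-extend : (∀ {X Y} → (X , Y) ∈ points → ¬ IsSquare (Q X Y)) → ∀ X Y → Nonzero₂ X Y → ¬ IsSquare (Q X Y)
    nonsquare-extend ns X Y nz sq = cases (Y ≟ 0#)
      where
      rescale : ∀ d U V → d ≢ 0# → X ≡ d * U → Y ≡ d * V → (U , V) ∈ points → ⊥
      rescale d U V d≢0 refl refl p = ns p (IsSquare-scale (*-≢0 d≢0 d≢0) (subst IsSquare (quartic-homogeneous z₀ z₁ 1# z₃ z₄ d U V) sq))
      cases : Dec (Y ≡ 0#) → ⊥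
      cases (yes Y≡0) = rescale X 1# 0# (λ X≡0 → nz (X≡0 , Y≡0)) (sym (*-identityʳ X)) (trans Y≡0 (sym (zeroʳ X))) (here refl)
      cases (no Y≢0)  = rescale Y (Y ⁻¹ * X) 1# Y≢0 (sym (trans (sym (*-assoc Y _ X)) (trans (cong (_* X) (inverseʳ Y Y≢0)) (*-identityˡ X)))) (sym (*-identityʳ Y))
        (there (∈-map⁺ (_, 1#) (∈els _)))

    not-all-mixed : ¬ (∀ {R} → R ∈ points → kind R ≡ mixedᴷ)
    not-all-mixed all = nonsquare-values-impossible z₀ z₁ z₃ z₄ Δ≢0 (nonsquare-extend (λ p → mixed⇒nonsquare (∈points⇒Nonzero₂ p) (all p)))

    doubleCover≡ : doubleCover z₀ z₁ z₃ z₄ ≡ 1 ℕ.+ cubicPoints (Δ₁ z₀ z₁ z₃ z₄)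
    doubleCover≡ with any? (λ R → kind R ≟ᴷ splitᴷ ⊎-dec kind R ≟ᴷ rootlessᴷ) points
    ... | yes p = let (X , Y) , p∈ , k = find p
                      s , s≢0 , e = nonzero-square-value p∈ k
                  in doubleCover-count z₀ z₁ z₃ z₄ Δ≢0 X Y s≢0 e (∈points⇒ p∈)
    ... | no ¬p = ⊥-elim (not-all-mixed λ {R} p → only-mixed (kind R) refl p)
      where
      n-split≡0 : n splitᴷ ≡ 0
      n-split≡0 = ∑-none points (λ R → kind R ≟ᴷ splitᴷ) (λ p k → ¬p (lose p (inj₁ k)))
      n-rootless≡0 : n rootlessᴷ ≡ 0
      n-rootless≡0 = ∑-none points (λ R → kind R ≟ᴷ rootlessᴷ) (λ p k → ¬p (lose p (inj₂ k)))
      n-tangent≡0 : n tangentᴷ ≡ 0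
      n-tangent≡0 = ℕ.m+n≡0⇒m≡0 _ (trans (sym n-rootless) n-rootless≡0)
      only-mixed : ∀ {R} k → kind R ≡ k → R ∈ points → kind R ≡ mixedᴷ
      only-mixed mixedᴷ e _ = e
      only-mixed splitᴷ e p = ⊥-elim (¬p (lose p (inj₁ e)))
      only-mixed rootlessᴷ e p = ⊥-elim (¬p (lose p (inj₂ e)))
      only-mixed {R} tangentᴷ e p = case trans (sym (𝟙-yes (kind R ≟ᴷ tangentᴷ) e)) (∑≡0⇒≡0 (λ R → 𝟙 (kind R ≟ᴷ tangentᴷ)) n-tangent≡0 p) of λ ()
  
    weighted-count : n tangentᴷ ℕ.+ 2 ℕ.* n splitᴷ ℕ.+ 2 ℕ.* n rootlessᴷ ≡ 1 ℕ.+ cubicPoints (Δ₁ z₀ z₁ z₃ z₄)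
    weighted-count = trans (sym (trans (∑-kind kind points sqrtsᴷ)
      (solveℕ 4 (λ a b c d → con 1 :* a :+ con 2 :* b :+ con 0 :* c :+ con 2 :* d := a :+ con 2 :* b :+ con 2 :* d) refl
        (n tangentᴷ) (n splitᴷ) (n mixedᴷ) (n rootlessᴷ)))) (trans ∑sqrts doubleCover≡)

    module Relations {E : ℕ} (E≡ : E ≡ 1 ℕ.+ cubicPoints (Δ₁ z₀ z₁ z₃ z₄)) where

      -- E = n₂ + 2n₃ + 2n₅ and n₅ = n₂ + 2n₃ give E = 3n₂ + 6n₃ = 3n₅.
      rel-split : 6 ℕ.* n splitᴷ ℕ.+ 3 ℕ.* n tangentᴷ ≡ E
      rel-split = trans (solveℕ 2 (λ a b → con 6 :* b :+ con 3 :* a := a :+ con 2 :* b :+ con 2 :* (a :+ con 2 :* b)) refl (n tangentᴷ) (n splitᴷ))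
        (trans (cong (λ d → n tangentᴷ ℕ.+ 2 ℕ.* n splitᴷ ℕ.+ 2 ℕ.* d) (sym n-rootless)) (trans weighted-count (sym E≡)))

      rel-rootless : 3 ℕ.* n rootlessᴷ ≡ E
      rel-rootless = trans (cong (3 ℕ.*_) n-rootless) (trans
        (solveℕ 2 (λ a b → con 3 :* (a :+ con 2 :* b) := con 6 :* b :+ con 3 :* a) refl (n tangentᴷ) (n splitᴷ)) rel-split)

      -- 2(n₂ + n₃ + n₅) = 4n₂ + 6n₃ = E + n₂, so the doubled total isolates n₄.
      rel-mixed : 2 ℕ.* n mixedᴷ ℕ.+ E ℕ.+ n tangentᴷ ≡ 2 ℕ.* (length els ℕ.+ 1)
      rel-mixed = trans (cong (λ e → 2 ℕ.* n mixedᴷ ℕ.+ e ℕ.+ n tangentᴷ) (sym rel-split)) (trans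
        (solveℕ 3 (λ a b c → con 2 :* c :+ (con 6 :* b :+ con 3 :* a) :+ a := con 2 :* (a :+ b :+ c :+ (a :+ con 2 :* b))) refl (n tangentᴷ) (n splitᴷ) (n mixedᴷ))
        (cong (2 ℕ.*_) (trans (cong (n tangentᴷ ℕ.+ n splitᴷ ℕ.+ n mixedᴷ ℕ.+_) (sym n-rootless)) (trans total (ℕ.+-comm 1 _)))))

  module _ {A B : Set} (f : A → B) (g : B → A) where

    Unique-retract : (xs : List A) → (∀ {x} → x ∈ xs → g (f x) ≡ x) → Unique xs → Unique (map f xs)
    Unique-retract xs gf≡ u = Unique.map⁻ {f = g} (subst Unique (sym (trans (sym (map-∘ xs)) (map-id-local (All.tabulate gf≡)))) u)

  vec-≡ : ∀ {a₀ a₁ a₂ a₃ b₀ b₁ b₂ b₃ : Carrier} → a₀ ≡ b₀ → a₁ ≡ b₁ → a₂ ≡ b₂ → a₃ ≡ b₃ →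
    _≡_ {A = Vec4} (a₀ ∷ a₁ ∷ a₂ ∷ a₃ ∷ []) (b₀ ∷ b₁ ∷ b₂ ∷ b₃ ∷ [])
  vec-≡ refl refl refl refl = refl

  module PencilCards (z₀ z₁ z₃ z₄ : Carrier) (Δ≢0 : Δ₁ z₀ z₁ z₃ z₄ ≢ 0#) where

    open Pencil z₀ z₁ z₃ z₄ Δ≢0 public

    InPencil : Vec4 → Set
    InPencil (a₀ ∷ a₁ ∷ a₂ ∷ a₃ ∷ []) = a₀ ≡ - (z₁ * a₁ + z₀ * a₂) × a₃ ≡ - (z₄ * a₁ + z₃ * a₂)

    abstract
      -- The inverse of `plane` on the pencil. For a₁ = 0 the answer (1 : 0) is right because a₁ =
      -- a₂ = 0 would make a member of the pencil the zero vector.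
      toPoint : Vec4 → Carrier × Carrier
      toPoint (a₀ ∷ a₁ ∷ a₂ ∷ a₃ ∷ []) with a₁ ≟ 0#
      ... | yes _ = 1# , 0#
      ... | no _  = a₁ ⁻¹ * a₂ , 1#

      toPoint∈points : ∀ a → toPoint a ∈ points
      toPoint∈points (a₀ ∷ a₁ ∷ a₂ ∷ a₃ ∷ []) with a₁ ≟ 0#
      ... | yes _ = here refl
      ... | no _  = there (∈-map⁺ (_, 1#) (∈els _))

      toPoint-plane : ∀ {R} → R ∈ points → toPoint (plane R) ≡ R
      toPoint-plane (here refl) with leadInv (vec 1# 0#) * 0# ≟ 0#
      ... | yes _ = refl
      ... | no h  = ⊥-elim (h (zeroʳ _))
      toPoint-plane (there p) with t , _ , refl ← ∈-map⁻ (_, 1#) p with leadInv (vec t 1#) * 1# ≟ 0#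
      ... | yes h = ⊥-elim (*-≢0 (leadInv≢0 (vec t 1#)) 1≢0 h)
      ... | no c1≢0 = cong (_, 1#) (*-cancelˡ-≢0 c1≢0 (by (inverseʳ _ c1≢0) (solve 3 (λ c t r →
        c ⊗ #1 ⊗ (r ⊗ (c ⊗ t)) ⊕ c ⊗ t ⊗ #1 ⊜ c ⊗ #1 ⊗ t ⊕ c ⊗ t ⊗ (c ⊗ #1 ⊗ r)) (leadInv (vec t 1#)) t ((leadInv (vec t 1#) * 1#) ⁻¹))))

      vec-toPoint : ∀ a → InPencil a → ¬ AllZero a → ∃ λ d → d ≢ 0# × a ≡ vmap (d *_) (vec (proj₁ (toPoint a)) (proj₂ (toPoint a)))
      vec-toPoint (a₀ ∷ a₁ ∷ a₂ ∷ a₃ ∷ []) (e₀ , e₃) nz with a₁ ≟ 0#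
      ... | yes refl = a₂ , (λ { refl → nz (trans e₀ (solve 2 (λ x y → ⊝ (x ⊗ #0 ⊕ y ⊗ #0) ⊜ #0) z₁ z₀) , refl , refl ,
            trans e₃ (solve 2 (λ x y → ⊝ (x ⊗ #0 ⊕ y ⊗ #0) ⊜ #0) z₄ z₃) , _) }) ,
          vec-≡ (trans e₀ (solve 3 (λ x y a → ⊝ (x ⊗ #0 ⊕ y ⊗ a) ⊜ a ⊗ ⊝ (x ⊗ #0 ⊕ y ⊗ #1)) z₁ z₀ a₂)) (sym (zeroʳ a₂)) (sym (*-identityʳ a₂))
            (trans e₃ (solve 3 (λ x y a → ⊝ (x ⊗ #0 ⊕ y ⊗ a) ⊜ a ⊗ ⊝ (x ⊗ #0 ⊕ y ⊗ #1)) z₄ z₃ a₂))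
      ... | no a₁≢0 = a₁ , a₁≢0 , vec-≡ (trans e₀ (scaled z₁ z₀)) (sym (*-identityʳ a₁)) (sym a₁a₁⁻¹a₂≡a₂) (trans e₃ (scaled z₄ z₃))
        where
        a₁a₁⁻¹a₂≡a₂ : a₁ * (a₁ ⁻¹ * a₂) ≡ a₂
        a₁a₁⁻¹a₂≡a₂ = trans (sym (*-assoc _ _ _)) (trans (cong (_* a₂) (inverseʳ a₁ a₁≢0)) (*-identityˡ a₂))
        scaled : ∀ x y → - (x * a₁ + y * a₂) ≡ a₁ * - (x * 1# + y * (a₁ ⁻¹ * a₂))
        scaled x y = by a₁a₁⁻¹a₂≡a₂ (solve 5 (λ x y a₁ a₂ b → ⊝ (x ⊗ a₁ ⊕ y ⊗ a₂) ⊕ y ⊗ a₂ ⊜ a₁ ⊗ ⊝ (x ⊗ #1 ⊕ y ⊗ b) ⊕ y ⊗ (a₁ ⊗ b)) x y a₁ a₂ (a₁ ⁻¹ * a₂))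

    plane-Normalized : ∀ {X Y} → Nonzero₂ X Y → Normalized (plane (X , Y))
    plane-Normalized {X} {Y} nz = normalize-Normalized (vec X Y) (λ (_ , Y≡0 , X≡0 , _) → nz (X≡0 , Y≡0))

    plane-InPencil : ∀ X Y → InPencil (plane (X , Y))
    plane-InPencil X Y = scaled z₁ z₀ , scaled z₄ z₃
      where
      scaled : ∀ a b → c X Y * - (a * Y + b * X) ≡ - (a * (c X Y * Y) + b * (c X Y * X))
      scaled a b = solve 5 (λ c a b X Y → c ⊗ ⊝ (a ⊗ Y ⊕ b ⊗ X) ⊜ ⊝ (a ⊗ (c ⊗ Y) ⊕ b ⊗ (c ⊗ X))) (c X Y) a b X Y

    plane-toPoint : ∀ a → Normalized a → InPencil a → plane (toPoint a) ≡ a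
    plane-toPoint a na ia = let d , d≢0 , e = vec-toPoint a ia (Normalized⇒¬AllZero a na) in
      normalize-unique (vec (proj₁ (toPoint a)) (proj₂ (toPoint a))) a d≢0 na e (plane-Normalized (∈points⇒Nonzero₂ (toPoint∈points a)))

    kind⇒class : ∀ {X Y} → Nonzero₂ X Y → 𝓝ᴷ (kind (X , Y)) (plane (X , Y))
    kind⇒class {X} {Y} nz = let T , e = kind-type nz in subst (λ k → 𝓝ᴷ k (plane (X , Y))) (sym e) (in-class T)

    class⇒kind : ∀ {X Y} k → Nonzero₂ X Y → 𝓝ᴷ k (plane (X , Y)) → kind (X , Y) ≡ k
    class⇒kind k nz m = let T , e = kind-type nz in trans e (class-unique k m T)

    card-class : ∀ k → Card (λ a → Normalized a × InPencil a × 𝓝ᴷ k a) (n k)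
    card-class k = subst (Card _) (trans (length-map plane L) (length-filter-∑ (λ R → kind R ≟ᴷ k) points))
      (Card-list (map plane L) (Unique-retract plane toPoint L (λ p → toPoint-plane (proj₁ (∈L⇒ p))) (Unique.filter⁺ (λ R → kind R ≟ᴷ k) points-unique)) complete sound)
      where
      L : List (Carrier × Carrier)
      L = filter (λ R → kind R ≟ᴷ k) points
      ∈L⇒ : ∀ {R} → R ∈ L → R ∈ points × kind R ≡ k
      ∈L⇒ = ∈-filter⁻ (λ R → kind R ≟ᴷ k)
      complete : ∀ a → Normalized a × InPencil a × 𝓝ᴷ k a → a ∈ map plane L
      complete a (na , ia , m) = subst (_∈ map plane L) plane≡ (∈-map⁺ plane (∈-filter⁺ (λ R → kind R ≟ᴷ k) (toPoint∈points a)
          (class⇒kind k (∈points⇒Nonzero₂ (toPoint∈points a)) (subst (𝓝ᴷ k) (sym plane≡) m))))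
        where
        plane≡ : plane (toPoint a) ≡ a
        plane≡ = plane-toPoint a na ia
      sound : ∀ a → a ∈ map plane L → Normalized a × InPencil a × 𝓝ᴷ k a
      sound a p = let (X , Y) , R∈L , e = ∈-map⁻ plane p
                      R∈points , k≡ = ∈L⇒ R∈L
                      nz = ∈points⇒Nonzero₂ R∈points
                  in subst (λ a → Normalized a × InPencil a × 𝓝ᴷ k a) (sym e)
                       (plane-Normalized nz , plane-InPencil X Y , subst (λ k → 𝓝ᴷ k (plane (X , Y))) k≡ (kind⇒class nz))

    -- A cube has a₁ = a₂ = 0, and in the pencil these determine the other two coordinates, so the
    -- vector would be zero.
    card-𝓝₁ : Card (λ a → Normalized a × InPencil a × 𝓝₁ a) 0
    card-𝓝₁ = Card-list [] [] none λ _ ()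
      where
      none : ∀ a → Normalized a × InPencil a × 𝓝₁ a → a ∈ []
      none a@(a₀ ∷ a₁ ∷ a₂ ∷ a₃ ∷ []) (na , (e₀ , e₃) , m) with refl , refl ← 𝓝₁⇒a₁≡a₂≡0 {a₀} {a₁} {a₂} {a₃} m =
        ⊥-elim (Normalized⇒¬AllZero a na (trans e₀ (solve 2 (λ x y → ⊝ (x ⊗ #0 ⊕ y ⊗ #0) ⊜ #0) z₁ z₀) , refl , refl ,
            trans e₃ (solve 2 (λ x y → ⊝ (x ⊗ #0 ⊕ y ⊗ #0) ⊜ #0) z₄ z₃) , _))

  -- The points of the elliptic curve

  module _ (r : Carrier) where

    private
      δ : Carrier
      δ = r ⁻¹

      -- The pair is ordered (y, x) because `cubicPoints` sums over y and counts the square roots x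
      -- inside.
      Affine : Carrier × Carrier → Set
      Affine (y , x) = x * x ≡ y * (y * y) + y * y + - δ

      Affine? : ∀ yx → Dec (Affine yx)
      Affine? (y , x) = x * x ≟ y * (y * y) + y * y + - δ

      affinePoints : List (Carrier × Carrier)
      affinePoints = filter Affine? (cartesianProduct els els)

      ∞ᴱ : Vec Carrier 3
      ∞ᴱ = 1# ∷ 0# ∷ 0# ∷ []

      affine : Carrier × Carrier → Vec Carrier 3
      affine (y , x) = x ∷ y ∷ 1# ∷ []

      projective : Carrier × Carrier → Vec Carrier 3
      projective yx = normalize (affine yx)

      chart : Vec Carrier 3 → Carrier × Carrier
      chart (X ∷ Y ∷ Z ∷ []) = Z ⁻¹ * Y , Z ⁻¹ * X

      length-affinePoints : length affinePoints ≡ cubicPoints δ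
      length-affinePoints = trans (length-filter-∑ Affine? (cartesianProduct els els)) (∑-cartesianProduct els els (λ yx → 𝟙 (Affine? yx)))

      chart-projective : ∀ yx → chart (projective yx) ≡ yx
      chart-projective (y , x) = cong₂ _,_ (cancel y) (cancel x)
        where
        l : Carrier
        l = leadInv (affine (y , x))
        l1≢0 : l * 1# ≢ 0#
        l1≢0 = *-≢0 (leadInv≢0 (affine (y , x))) 1≢0
        cancel : ∀ a → (l * 1#) ⁻¹ * (l * a) ≡ a
        cancel a = by (inverseʳ _ l1≢0) (solve 3 (λ l a r → r ⊗ (l ⊗ a) ⊕ a ⊗ #1 ⊜ a ⊕ a ⊗ (l ⊗ #1 ⊗ r)) l a ((l * 1#) ⁻¹))

      projective-Normalized : ∀ yx → Normalized (projective yx)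
      projective-Normalized yx = normalize-Normalized (affine yx) (λ (_ , _ , 1≡0 , _) → 1≢0 1≡0)

      projective-chart : ∀ X Y Z → Normalized (X ∷ Y ∷ Z ∷ []) → Z ≢ 0# → projective (chart (X ∷ Y ∷ Z ∷ [])) ≡ X ∷ Y ∷ Z ∷ []
      projective-chart X Y Z nv Z≢0 = normalize-unique (affine (chart (X ∷ Y ∷ Z ∷ []))) (X ∷ Y ∷ Z ∷ []) Z≢0 nv
        (cong₂ _∷_ (sym (cancel X)) (cong₂ _∷_ (sym (cancel Y)) (cong (_∷ []) (sym (*-identityʳ Z))))) (projective-Normalized (chart (X ∷ Y ∷ Z ∷ [])))
        where
        cancel : ∀ a → Z * (Z ⁻¹ * a) ≡ a
        cancel a = trans (sym (*-assoc _ _ _)) (trans (cong (_* a) (inverseʳ Z Z≢0)) (*-identityˡ a))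

      OnE⇒Affine : ∀ X Y Z → Z ≢ 0# → OnE r (X ∷ Y ∷ Z ∷ []) → Affine (chart (X ∷ Y ∷ Z ∷ []))
      OnE⇒Affine X Y Z Z≢0 e = *-cancelˡ-≢0 (*-≢0 (*-≢0 Z≢0 Z≢0) Z≢0)
        (by (trans (cong₂ (λ a b → (a ^ 2) * Z + - ((b ^ 3) + (b ^ 2) * Z + - (δ * (Z ^ 3)))) (cancel X) (cancel Y)) (a+-b≡0 e))
          (solve 4 (λ Z x y δ → let X = Z ⊗ x ; Y = Z ⊗ y in
            Z ⊗ Z ⊗ Z ⊗ (x ⊗ x) ⊕ #1 ⊗ #0 ⊜
            Z ⊗ Z ⊗ Z ⊗ (y ⊗ (y ⊗ y) ⊕ y ⊗ y ⊖ δ) ⊕ #1 ⊗ (X ²ᴱ ⊗ Z ⊖ (Y ³ᴱ ⊕ Y ²ᴱ ⊗ Z ⊖ δ ⊗ Z ³ᴱ))) Z (Z ⁻¹ * X) (Z ⁻¹ * Y) δ))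
        where
        cancel : ∀ a → Z * (Z ⁻¹ * a) ≡ a
        cancel a = trans (sym (*-assoc _ _ _)) (trans (cong (_* a) (inverseʳ Z Z≢0)) (*-identityˡ a))

      Affine⇒OnE : ∀ yx → Affine yx → OnE r (projective yx)
      Affine⇒OnE (y , x) e = by e (solve 4 (λ l x y δ → let X = l ⊗ x ; Y = l ⊗ y ; Z = l ⊗ #1 in
        X ²ᴱ ⊗ Z ⊕ l ⊗ l ⊗ l ⊗ (y ⊗ (y ⊗ y) ⊕ y ⊗ y ⊖ δ) ⊜ Y ³ᴱ ⊕ Y ²ᴱ ⊗ Z ⊖ δ ⊗ Z ³ᴱ ⊕ l ⊗ l ⊗ l ⊗ (x ⊗ x)) (leadInv (affine (y , x))) x y δ)

      -- On Z = 0 the equation of the curve reads Y³ = 0.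
      at-infinity : ∀ X Y → Normalized (X ∷ Y ∷ 0# ∷ []) → OnE r (X ∷ Y ∷ 0# ∷ []) → X ∷ Y ∷ 0# ∷ [] ≡ ∞ᴱ
      at-infinity X Y nv e = normal Y≡0 nv
        where
        Y³≡0 : Y * (Y * Y) ≡ 0#
        Y³≡0 = by e (solve 3 (λ X Y δ → Y ⊗ (Y ⊗ Y) ⊕ ⊝ #1 ⊗ (Y ³ᴱ ⊕ Y ²ᴱ ⊗ #0 ⊖ δ ⊗ #0 ³ᴱ) ⊜ #0 ⊕ ⊝ #1 ⊗ (X ²ᴱ ⊗ #0)) X Y δ)
        Y≡0 : Y ≡ 0#
        Y≡0 = [ (λ h → h) , x²≡0⇒x≡0 ]′ (xy≡0⇒ Y³≡0)
        normal : Y ≡ 0# → Normalized (X ∷ Y ∷ 0# ∷ []) → X ∷ Y ∷ 0# ∷ [] ≡ ∞ᴱ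
        normal refl (inj₁ refl) = refl
        normal refl (inj₂ (_ , inj₁ 0≡1)) = ⊥-elim (0≢1 0≡1)
        normal refl (inj₂ (_ , inj₂ (_ , inj₁ 0≡1))) = ⊥-elim (0≢1 0≡1)

    card-EPoint : Card (EPoint r) (1 ℕ.+ cubicPoints (r ⁻¹))
    card-EPoint = subst (Card (EPoint r)) (cong suc (trans (length-map projective affinePoints) length-affinePoints))
      (Card-list (∞ᴱ ∷ map projective affinePoints) unique-points complete sound)
      where
      ∞∉ : ∞ᴱ ∈ map projective affinePoints → ⊥
      ∞∉ p with yx , _ , e ← ∈-map⁻ projective p = *-≢0 (leadInv≢0 (affine yx)) 1≢0 (sym (cong (λ { (_ ∷ _ ∷ Z ∷ []) → Z }) e))
      unique-points : Unique (∞ᴱ ∷ map projective affinePoints)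
      unique-points = ¬Any⇒All¬ _ ∞∉ ∷ Unique-retract projective chart affinePoints (λ {yx} _ → chart-projective yx)
        (Unique.filter⁺ Affine? (Unique.cartesianProduct⁺ unique unique))
      complete : ∀ v → EPoint r v → v ∈ ∞ᴱ ∷ map projective affinePoints
      complete (X ∷ Y ∷ Z ∷ []) (nv , e) = cases (Z ≟ 0#)
        where
        cases : Dec (Z ≡ 0#) → X ∷ Y ∷ Z ∷ [] ∈ ∞ᴱ ∷ map projective affinePoints
        cases (yes refl) = here (at-infinity X Y nv e)
        cases (no Z≢0) = there (subst (_∈ map projective affinePoints) (projective-chart X Y Z nv Z≢0)
          (∈-map⁺ projective (∈-filter⁺ Affine? (∈-cartesianProduct⁺ (∈els _) (∈els _)) (OnE⇒Affine X Y Z Z≢0 e))))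
      sound : ∀ v → v ∈ ∞ᴱ ∷ map projective affinePoints → EPoint r v
      sound _ (here refl) = inj₁ refl , solve 1 (λ δ → #1 ²ᴱ ⊗ #0 ⊜ #0 ³ᴱ ⊕ #0 ²ᴱ ⊗ #0 ⊖ δ ⊗ #0 ³ᴱ) δ
      sound v (there p) = let yx , yx∈ , e = ∈-map⁻ projective p in
        subst (EPoint r) (sym e) (projective-Normalized yx , Affine⇒OnE yx (proj₂ (∈-filter⁻ Affine? {xs = cartesianProduct els els} yx∈)))

  -- Zeros of the quartic by factorisation type

  ∂X′ : (z₀ z₂ z₃ U V : Carrier) → Carrier
  ∂X′ z₀ z₂ z₃ U V = z₀ * (U * U * U) + - (z₂ * (U * (V * V))) + z₃ * (V * V * V)

  ∂Y′ : (z₁ z₂ z₄ U V : Carrier) → Carrier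
  ∂Y′ z₁ z₂ z₄ U V = z₁ * (U * U * U) + - (z₂ * (U * (U * V))) + z₄ * (V * V * V)

  module _ {n : ℕ} where
    ∂Xᴱ : (z₀ z₂ z₃ U V : Expr F₃ n) → Expr F₃ n
    ∂Xᴱ z₀ z₂ z₃ U V = z₀ ⊗ (U ⊗ U ⊗ U) ⊖ z₂ ⊗ (U ⊗ (V ⊗ V)) ⊕ z₃ ⊗ (V ⊗ V ⊗ V)

    ∂Yᴱ : (z₁ z₂ z₄ U V : Expr F₃ n) → Expr F₃ n
    ∂Yᴱ z₁ z₂ z₄ U V = z₁ ⊗ (U ⊗ U ⊗ U) ⊖ z₂ ⊗ (U ⊗ (U ⊗ V)) ⊕ z₄ ⊗ (V ⊗ V ⊗ V)

  -- `∂X′` and `∂Y′` are the partial derivatives with 4 = 1, 3 = 0 and 2 = -1, so the condition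
  -- excludes a repeated linear factor over the field.
  Separable : (z₀ z₁ z₂ z₃ z₄ : Carrier) → Set
  Separable z₀ z₁ z₂ z₃ z₄ = ∀ U V → Nonzero₂ U V → Nonzero₂ (∂X′ z₀ z₂ z₃ U V) (∂Y′ z₁ z₂ z₄ U V)

  quarticF : List Carrier → Carrier → Carrier → Carrier
  quarticF (z₀ ∷ z₁ ∷ z₂ ∷ z₃ ∷ z₄ ∷ []) = quartic z₀ z₁ z₂ z₃ z₄
  quarticF _ _ _ = 0#

  SeparableF : List Carrier → Set
  SeparableF (z₀ ∷ z₁ ∷ z₂ ∷ z₃ ∷ z₄ ∷ []) = Separable z₀ z₁ z₂ z₃ z₄
  SeparableF _ = ⊥

  module _ {l m a₀ a₁ a₂ a₃ : Carrier} where

    quarticF-linear-cubic : ∀ X Y → quarticF (mulF (l ∷ m ∷ []) (a₀ ∷ a₁ ∷ a₂ ∷ a₃ ∷ [])) X Y ≡ linear l m X Y * cubic a₀ a₁ a₂ a₃ X Y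
    quarticF-linear-cubic X Y = solve 8 (λ l m a₀ a₁ a₂ a₃ X Y →
      quarticᴱ (l ⊗ a₀ ⊕ #0) (l ⊗ a₁ ⊕ (m ⊗ a₀ ⊕ #0)) (l ⊗ a₂ ⊕ m ⊗ a₁) (l ⊗ a₃ ⊕ m ⊗ a₂) (m ⊗ a₃) X Y ⊜ linearᴱ l m X Y ⊗ cubicᴱ a₀ a₁ a₂ a₃ X Y) l m a₀ a₁ a₂ a₃ X Y

    -- Product rule: at a common zero of the two factors both partial derivatives of the product
    -- vanish.
    linear-cubic-disjoint : SeparableF (mulF (l ∷ m ∷ []) (a₀ ∷ a₁ ∷ a₂ ∷ a₃ ∷ [])) →
      ∀ U V → Nonzero₂ U V → ¬ (linear l m U V ≡ 0# × cubic a₀ a₁ a₂ a₃ U V ≡ 0#)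
    linear-cubic-disjoint sep U V nz (e , e′) = sep U V nz
      ( by₂ e e′ (solve 8 (λ l m a₀ a₁ a₂ a₃ U V → let k = ⊝ (a₁ ⊗ U ⊗ V) ⊕ a₂ ⊗ V ⊗ V in
          ∂Xᴱ (l ⊗ a₀ ⊕ #0) (l ⊗ a₂ ⊕ m ⊗ a₁) (l ⊗ a₃ ⊕ m ⊗ a₂) U V ⊕ k ⊗ #0 ⊕ l ⊗ #0 ⊜ #0 ⊕ k ⊗ linearᴱ l m U V ⊕ l ⊗ cubicᴱ a₀ a₁ a₂ a₃ U V) l m a₀ a₁ a₂ a₃ U V)
      , by₂ e e′ (solve 8 (λ l m a₀ a₁ a₂ a₃ U V → let k = a₁ ⊗ U ⊗ U ⊖ a₂ ⊗ U ⊗ V in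
          ∂Yᴱ (l ⊗ a₁ ⊕ (m ⊗ a₀ ⊕ #0)) (l ⊗ a₂ ⊕ m ⊗ a₁) (m ⊗ a₃) U V ⊕ k ⊗ #0 ⊕ m ⊗ #0 ⊜ #0 ⊕ k ⊗ linearᴱ l m U V ⊕ m ⊗ cubicᴱ a₀ a₁ a₂ a₃ U V) l m a₀ a₁ a₂ a₃ U V))

  cubicF : List Carrier → Carrier → Carrier → Carrier
  cubicF (a₀ ∷ a₁ ∷ a₂ ∷ a₃ ∷ []) = cubic a₀ a₁ a₂ a₃
  cubicF _ _ _ = 0#

  module _ (l m α β γ : Carrier) where

    cubicF-linear-quadratic : ∀ X Y → cubicF (mulF (l ∷ m ∷ []) (α ∷ β ∷ γ ∷ [])) X Y ≡ linear l m X Y * quadratic α β γ X Y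
    cubicF-linear-quadratic X Y = solve 7 (λ l m α β γ X Y →
      cubicᴱ (l ⊗ α ⊕ #0) (l ⊗ β ⊕ (m ⊗ α ⊕ #0)) (l ⊗ γ ⊕ m ⊗ β) (m ⊗ γ) X Y ⊜ linearᴱ l m X Y ⊗ quadraticᴱ α β γ X Y) l m α β γ X Y

    -- Brings a later linear factor to the front, where `linear-cubic-disjoint` separates it from
    -- the product of the others.
    mulF-swap : ∀ l′ m′ → mulF (l ∷ m ∷ []) (mulF (l′ ∷ m′ ∷ []) (α ∷ β ∷ γ ∷ [])) ≡ mulF (l′ ∷ m′ ∷ []) (mulF (l ∷ m ∷ []) (α ∷ β ∷ γ ∷ []))
    mulF-swap l′ m′ = cong₂ _∷_ (solve 3 (λ l l′ α → l ⊗ (l′ ⊗ α ⊕ #0) ⊕ #0 ⊜ l′ ⊗ (l ⊗ α ⊕ #0) ⊕ #0) l l′ α)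
      (cong₄
        (solve 6 (λ l m l′ m′ α β → l ⊗ (l′ ⊗ β ⊕ (m′ ⊗ α ⊕ #0)) ⊕ (m ⊗ (l′ ⊗ α ⊕ #0) ⊕ #0) ⊜ l′ ⊗ (l ⊗ β ⊕ (m ⊗ α ⊕ #0)) ⊕ (m′ ⊗ (l ⊗ α ⊕ #0) ⊕ #0)) l m l′ m′ α β)
        (solve 7 (λ l m l′ m′ α β γ → l ⊗ (l′ ⊗ γ ⊕ m′ ⊗ β) ⊕ m ⊗ (l′ ⊗ β ⊕ (m′ ⊗ α ⊕ #0)) ⊜ l′ ⊗ (l ⊗ γ ⊕ m ⊗ β) ⊕ m′ ⊗ (l ⊗ β ⊕ (m ⊗ α ⊕ #0))) l m l′ m′ α β γ)
        (solve 6 (λ l m l′ m′ β γ → l ⊗ (m′ ⊗ γ) ⊕ m ⊗ (l′ ⊗ γ ⊕ m′ ⊗ β) ⊜ l′ ⊗ (m ⊗ γ) ⊕ m′ ⊗ (l ⊗ γ ⊕ m ⊗ β)) l m l′ m′ β γ)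
        (solve 3 (λ m m′ γ → m ⊗ (m′ ⊗ γ) ⊜ m′ ⊗ (m ⊗ γ)) m m′ γ))

  mulF-swap₃ : ∀ l m l′ m′ p r → mulF (l ∷ m ∷ []) (mulF (l′ ∷ m′ ∷ []) (p ∷ r ∷ [])) ≡ mulF (l′ ∷ m′ ∷ []) (mulF (l ∷ m ∷ []) (p ∷ r ∷ []))
  mulF-swap₃ l m l′ m′ p r = cong₄ (solve 3 (λ l l′ p → l ⊗ (l′ ⊗ p ⊕ #0) ⊕ #0 ⊜ l′ ⊗ (l ⊗ p ⊕ #0) ⊕ #0) l l′ p)
    (solve 6 (λ l m l′ m′ p r → l ⊗ (l′ ⊗ r ⊕ (m′ ⊗ p ⊕ #0)) ⊕ (m ⊗ (l′ ⊗ p ⊕ #0) ⊕ #0) ⊜ l′ ⊗ (l ⊗ r ⊕ (m ⊗ p ⊕ #0)) ⊕ (m′ ⊗ (l ⊗ p ⊕ #0) ⊕ #0)) l m l′ m′ p r)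
    (solve 6 (λ l m l′ m′ p r → l ⊗ (m′ ⊗ r) ⊕ m ⊗ (l′ ⊗ r ⊕ (m′ ⊗ p ⊕ #0)) ⊜ l′ ⊗ (m ⊗ r) ⊕ m′ ⊗ (l ⊗ r ⊕ (m ⊗ p ⊕ #0))) l m l′ m′ p r)
    (solve 3 (λ m m′ r → m ⊗ (m′ ⊗ r) ⊜ m′ ⊗ (m ⊗ r)) m m′ r)

  quadraticF-linear-linear : ∀ l m l′ m′ X Y → quadratic (l * l′ + 0#) (l * m′ + (m * l′ + 0#)) (m * m′) X Y ≡ linear l m X Y * linear l′ m′ X Y
  quadraticF-linear-linear = solve 6 (λ l m l′ m′ X Y →
    quadraticᴱ (l ⊗ l′ ⊕ #0) (l ⊗ m′ ⊕ (m ⊗ l′ ⊕ #0)) (m ⊗ m′) X Y ⊜ linearᴱ l m X Y ⊗ linearᴱ l′ m′ X Y)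

  irreducible-quadratic-zero : ∀ {α β γ} → Irreducible 2 (α ∷ β ∷ γ ∷ []) → ∀ X Y → Nonzero₂ X Y → quadratic α β γ X Y ≢ 0#
  irreducible-quadratic-zero irr X Y nz e = Irreducible⇒nonsquare irr (quadratic-zero⇒IsSquare nz e)

  irreducible-cubic-zero : ∀ {a₀ a₁ a₂ a₃} → Irreducible 3 (a₀ ∷ a₁ ∷ a₂ ∷ a₃ ∷ []) → ∀ X Y → Nonzero₂ X Y → cubic a₀ a₁ a₂ a₃ X Y ≢ 0#
  irreducible-cubic-zero irr X Y nz e = Irreducible₃⇒¬HasRoot irr (zero⇒HasRoot X Y nz e)

  zeros-linear-cubic : ∀ {l m a₀ a₁ a₂ a₃} → SeparableF (mulF (l ∷ m ∷ []) (a₀ ∷ a₁ ∷ a₂ ∷ a₃ ∷ [])) → Nonzero₂ l m →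
    zeros (quarticF (mulF (l ∷ m ∷ []) (a₀ ∷ a₁ ∷ a₂ ∷ a₃ ∷ []))) ≡ 1 ℕ.+ zeros (cubic a₀ a₁ a₂ a₃)
  zeros-linear-cubic {l} {m} {a₀} {a₁} {a₂} {a₃} sep nz = trans
    (zeros-* {quarticF (mulF (l ∷ m ∷ []) (a₀ ∷ a₁ ∷ a₂ ∷ a₃ ∷ []))} {linear l m} {cubic a₀ a₁ a₂ a₃} (quarticF-linear-cubic {l} {m} {a₀} {a₁} {a₂} {a₃})
      (linear-cubic-disjoint {l} {m} {a₀} {a₁} {a₂} {a₃} sep))
    (cong (ℕ._+ zeros (cubic a₀ a₁ a₂ a₃)) (zeros-linear nz))

  zeros-𝓕₁ : ∀ {f} → SeparableF f → 𝓕₁ f → zeros (quarticF f) ≡ 1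
  zeros-𝓕₁ sep (_ , ℓ , C , (form , nz) , irr , e) with form₁ {ℓ} form | form₃ {C} (proj₁ irr)
  zeros-𝓕₁ sep (_ , ℓ , C , (form , nz) , irr , refl) | l , m , refl | a₀ , a₁ , a₂ , a₃ , refl =
    trans (zeros-linear-cubic {l} {m} {a₀} {a₁} {a₂} {a₃} sep (NonzeroF⇒Nonzero₂ nz)) (cong suc (zeros-none {cubic a₀ a₁ a₂ a₃} (irreducible-cubic-zero irr)))

  zeros-𝓕₂ : ∀ {f} → SeparableF f → 𝓕₂ f → zeros (quarticF f) ≡ 2
  zeros-𝓕₂ sep (_ , ℓ₁ , ℓ₂ , Q , (form , nz) , (form′ , nz′) , irr , e) with form₁ {ℓ₁} form | form₁ {ℓ₂} form′ | form₂ {Q} (proj₁ irr)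
  zeros-𝓕₂ sep (_ , ℓ₁ , ℓ₂ , Q , (form , nz) , (form′ , nz′) , irr , refl) | l , m , refl | l′ , m′ , refl | α , β , γ , refl =
    trans (zeros-linear-cubic {l} {m} sep (NonzeroF⇒Nonzero₂ nz)) (cong suc (trans
      (zeros-* {cubicF (mulF (l′ ∷ m′ ∷ []) (α ∷ β ∷ γ ∷ []))} {linear l′ m′} {quadratic α β γ} (cubicF-linear-quadratic l′ m′ α β γ)
        (λ X Y nz (_ , e) → irreducible-quadratic-zero irr X Y nz e))
      (cong₂ ℕ._+_ (zeros-linear (NonzeroF⇒Nonzero₂ nz′)) (zeros-none {quadratic α β γ} (irreducible-quadratic-zero irr)))))

  zeros-𝓕₄ : ∀ {f} → SeparableF f → 𝓕₄ f → zeros (quarticF f) ≡ 4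
  zeros-𝓕₄ sep (_ , ℓ₁ , ℓ₂ , ℓ₃ , ℓ₄ , (f₁ , nz₁) , (f₂ , nz₂) , (f₃ , nz₃) , (f₄ , nz₄) , e) with form₁ {ℓ₁} f₁ | form₁ {ℓ₂} f₂ | form₁ {ℓ₃} f₃ | form₁ {ℓ₄} f₄
  zeros-𝓕₄ sep (_ , ℓ₁ , ℓ₂ , ℓ₃ , ℓ₄ , (f₁ , nz₁) , (f₂ , nz₂) , (f₃ , nz₃) , (f₄ , nz₄) , refl) | l₁ , m₁ , refl | l₂ , m₂ , refl | l₃ , m₃ , refl | l₄ , m₄ , refl =
    trans (zeros-linear-cubic {l₁} {m₁} sep (NonzeroF⇒Nonzero₂ nz₁)) (cong suc (trans
      (zeros-* {cubicF (mulF (l₂ ∷ m₂ ∷ []) (α ∷ β ∷ γ ∷ []))} {linear l₂ m₂} {quadratic α β γ} (cubicF-linear-quadratic l₂ m₂ α β γ)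
        disjoint₂)
      (cong₂ ℕ._+_ (zeros-linear (NonzeroF⇒Nonzero₂ nz₂)) (trans
        (zeros-* {quadratic α β γ} {linear l₃ m₃} {linear l₄ m₄} (quadraticF-linear-linear l₃ m₃ l₄ m₄) disjoint₃)
        (cong₂ ℕ._+_ (zeros-linear (NonzeroF⇒Nonzero₂ nz₃)) (zeros-linear (NonzeroF⇒Nonzero₂ nz₄)))))))
    where
    α β γ : Carrier
    α = l₃ * l₄ + 0#
    β = l₃ * m₄ + (m₃ * l₄ + 0#)
    γ = m₃ * m₄
    disjoint₂ : ∀ U V → Nonzero₂ U V → ¬ (linear l₂ m₂ U V ≡ 0# × quadratic α β γ U V ≡ 0#)
    disjoint₂ U V nz (e , e′) = linear-cubic-disjoint {l₂} {m₂} (subst SeparableF (mulF-swap l₁ m₁ α β γ l₂ m₂) sep) U V nz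
      (e , trans (cubicF-linear-quadratic l₁ m₁ α β γ U V) (trans (cong (linear l₁ m₁ U V *_) e′) (zeroʳ _)))
    disjoint₃ : ∀ U V → Nonzero₂ U V → ¬ (linear l₃ m₃ U V ≡ 0# × linear l₄ m₄ U V ≡ 0#)
    disjoint₃ U V nz (e , e′) = linear-cubic-disjoint {l₃} {m₃}
      (subst SeparableF (trans (cong (mulF (l₁ ∷ m₁ ∷ [])) (mulF-swap₃ l₂ m₂ l₃ m₃ l₄ m₄)) (mulF-swap l₁ m₁ _ _ _ l₃ m₃)) sep) U V nz
      (e , trans (cubicF-linear-quadratic l₁ m₁ _ _ _ U V) (trans (cong (linear l₁ m₁ U V *_)
        (trans (quadraticF-linear-linear l₂ m₂ l₄ m₄ U V) (trans (cong (linear l₂ m₂ U V *_) e′) (zeroʳ _)))) (zeroʳ _)))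

  zeros-𝓕₄′ : ∀ {f} → 𝓕₄′ f → zeros (quarticF f) ≡ 0
  zeros-𝓕₄′ (_ , Q₁ , Q₂ , irr₁ , irr₂ , e) with form₂ {Q₁} (proj₁ irr₁) | form₂ {Q₂} (proj₁ irr₂)
  zeros-𝓕₄′ (_ , Q₁ , Q₂ , irr₁ , irr₂ , refl) | α , β , γ , refl | α′ , β′ , γ′ , refl =
    zeros-none {quarticF (mulF (α ∷ β ∷ γ ∷ []) (α′ ∷ β′ ∷ γ′ ∷ []))} λ X Y nz e →
      *-≢0 (irreducible-quadratic-zero irr₁ X Y nz) (irreducible-quadratic-zero irr₂ X Y nz) (trans (sym (product X Y)) e)
    where
    product : ∀ X Y → quarticF (mulF (α ∷ β ∷ γ ∷ []) (α′ ∷ β′ ∷ γ′ ∷ [])) X Y ≡ quadratic α β γ X Y * quadratic α′ β′ γ′ X Y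
    product X Y = solve 8 (λ α β γ α′ β′ γ′ X Y →
      quarticᴱ (α ⊗ α′ ⊕ #0) (α ⊗ β′ ⊕ (β ⊗ α′ ⊕ #0)) (α ⊗ γ′ ⊕ (β ⊗ β′ ⊕ (γ ⊗ α′ ⊕ #0))) (β ⊗ γ′ ⊕ γ ⊗ β′) (γ ⊗ γ′) X Y
      ⊜ quadraticᴱ α β γ X Y ⊗ quadraticᴱ α′ β′ γ′ X Y) α β γ α′ β′ γ′ X Y

  abstract
    -- Division by X - tY in Horner form; a zero at (1 : 0) means z₀ = 0, and Y splits off.
    linear-factor : ∀ {z₀ z₁ z₂ z₃ z₄} X Y → Nonzero₂ X Y → quartic z₀ z₁ z₂ z₃ z₄ X Y ≡ 0# →
      ∃₂ λ l m → ∃₂ λ a₀ a₁ → ∃₂ λ a₂ a₃ → z₀ ∷ z₁ ∷ z₂ ∷ z₃ ∷ z₄ ∷ [] ≡ mulF (l ∷ m ∷ []) (a₀ ∷ a₁ ∷ a₂ ∷ a₃ ∷ [])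
    linear-factor {z₀} {z₁} {z₂} {z₃} {z₄} X Y nz e = cases (Y ≟ 0#)
      where
      cases : Dec (Y ≡ 0#) → ∃₂ λ l m → ∃₂ λ a₀ a₁ → ∃₂ λ a₂ a₃ → z₀ ∷ z₁ ∷ z₂ ∷ z₃ ∷ z₄ ∷ [] ≡ mulF (l ∷ m ∷ []) (a₀ ∷ a₁ ∷ a₂ ∷ a₃ ∷ [])
      cases (yes refl) = 0# , 1# , z₁ , z₂ , z₃ , z₄ , cong₂ _∷_ (trans z₀≡0 (solve 1 (λ a → #0 ⊜ #0 ⊗ a ⊕ #0) z₁)) (cong₄
          (solve 2 (λ a b → b ⊜ #0 ⊗ a ⊕ (#1 ⊗ b ⊕ #0)) z₂ z₁) (solve 2 (λ a b → b ⊜ #0 ⊗ a ⊕ #1 ⊗ b) z₃ z₂) (solve 2 (λ a b → b ⊜ #0 ⊗ a ⊕ #1 ⊗ b) z₄ z₃) (sym (*-identityˡ z₄)))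
        where
        X≢0 : X ≢ 0#
        X≢0 X≡0 = nz (X≡0 , refl)
        z₀≡0 : z₀ ≡ 0#
        z₀≡0 = xy≡0⇒y≡0 (*-≢0 (*-≢0 X≢0 X≢0) (*-≢0 X≢0 X≢0)) (by e (solve 6 (λ z₀ z₁ z₂ z₃ z₄ X →
          X ⊗ X ⊗ (X ⊗ X) ⊗ z₀ ⊕ #1 ⊗ #0 ⊜ #0 ⊕ #1 ⊗ quarticᴱ z₀ z₁ z₂ z₃ z₄ X #0) z₀ z₁ z₂ z₃ z₄ X))
      cases (no Y≢0) = 1# , - t , z₀ , a₁ , a₂ , a₃ , cong₂ _∷_ (solve 1 (λ z → z ⊜ #1 ⊗ z ⊕ #0) z₀) (cong₄
          (solve 3 (λ z t a → z ⊜ #1 ⊗ (z ⊕ t ⊗ a) ⊕ (⊝ t ⊗ a ⊕ #0)) z₁ t z₀) (horner z₂ a₁) (horner z₃ a₂)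
          (by root (solve 6 (λ z₀ z₁ z₂ z₃ z₄ t → z₄ ⊕ #1 ⊗ #0 ⊜ ⊝ t ⊗ (z₃ ⊕ t ⊗ (z₂ ⊕ t ⊗ (z₁ ⊕ t ⊗ z₀))) ⊕ #1 ⊗ quarticᴱ z₀ z₁ z₂ z₃ z₄ t #1) z₀ z₁ z₂ z₃ z₄ t)))
        where
        t a₁ a₂ a₃ : Carrier
        t = Y ⁻¹ * X
        a₁ = z₁ + t * z₀
        a₂ = z₂ + t * a₁
        a₃ = z₃ + t * a₂
        horner : ∀ z a → z ≡ 1# * (z + t * a) + - t * a
        horner z a = solve 3 (λ z t a → z ⊜ #1 ⊗ (z ⊕ t ⊗ a) ⊕ ⊝ t ⊗ a) z t a
        root : quartic z₀ z₁ z₂ z₃ z₄ t 1# ≡ 0#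
        root = trans (cong (quartic z₀ z₁ z₂ z₃ z₄ t) (sym (inverseˡ Y≢0))) (trans (quartic-homogeneous z₀ z₁ z₂ z₃ z₄ (Y ⁻¹) X Y) (trans (cong (Y ⁻¹ * Y ⁻¹ * (Y ⁻¹ * Y ⁻¹) *_) e) (zeroʳ _)))

  zeros-𝓕₂′ : ∀ {z₀ z₁ z₂ z₃ z₄} → 𝓕₂′ (z₀ ∷ z₁ ∷ z₂ ∷ z₃ ∷ z₄ ∷ []) → zeros (quartic z₀ z₁ z₂ z₃ z₄) ≡ 0
  zeros-𝓕₂′ {z₀} {z₁} {z₂} {z₃} {z₄} (_ , _ , _ , irr) = zeros-none {quartic z₀ z₁ z₂ z₃ z₄} λ X Y nz e → reducible (linear-factor X Y nz e)
    where
    reducible : ¬ (∃₂ λ l m → ∃₂ λ a₀ a₁ → ∃₂ λ a₂ a₃ → z₀ ∷ z₁ ∷ z₂ ∷ z₃ ∷ z₄ ∷ [] ≡ mulF (l ∷ m ∷ []) (a₀ ∷ a₁ ∷ a₂ ∷ a₃ ∷ []))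
    reducible (l , m , a₀ , a₁ , a₂ , a₃ , f≡) = irr 1 3 (l ∷ m ∷ []) (a₀ ∷ a₁ ∷ a₂ ∷ a₃ ∷ []) (s≤s z≤n) (s≤s z≤n) refl refl refl f≡

  RootedCounts : Vec4 → Vec4 → (E i : ℕ) → Set
  RootedCounts x y E i =
    Card (PlanesIn x y 𝓝₁) 0
    × Card (PlanesIn x y 𝓝₂) i
    × (∃ λ n₄ → Card (PlanesIn x y 𝓝₄) n₄ × 2 ℕ.* n₄ ℕ.+ E ℕ.+ i ≡ 2 ℕ.* (length els ℕ.+ 1))
    × (∃ λ n₃ → Card (PlanesIn x y 𝓝₃) n₃ × 6 ℕ.* n₃ ℕ.+ 3 ℕ.* i ≡ E)
    × (∃ λ n₅ → Card (PlanesIn x y 𝓝₅) n₅ × 3 ℕ.* n₅ ≡ E)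

  RootlessCounts : Vec4 → Vec4 → (E : ℕ) → Set
  RootlessCounts x y E =
    Card (PlanesIn x y 𝓝₁) 0
    × Card (PlanesIn x y 𝓝₂) 0
    × (∃ λ n₄ → Card (PlanesIn x y 𝓝₄) n₄ × 2 ℕ.* n₄ ℕ.+ E ≡ 2 ℕ.* (length els ℕ.+ 1))
    × (∃ λ n₃ → Card (PlanesIn x y 𝓝₃) n₃ × 6 ℕ.* n₃ ≡ E)
    × (∃ λ n₅ → Card (PlanesIn x y 𝓝₅) n₅ × 3 ℕ.* n₅ ≡ E)

  RootedCounts⇒RootlessCounts : ∀ {x y E} → RootedCounts x y E 0 → RootlessCounts x y E
  RootedCounts⇒RootlessCounts (c₁ , c₂ , (n₄ , c₄ , e₄) , (n₃ , c₃ , e₃) , c₅) =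
    c₁ , c₂ , (n₄ , c₄ , trans (sym (ℕ.+-identityʳ _)) e₄) , (n₃ , c₃ , trans (sym (ℕ.+-identityʳ _)) e₃) , c₅

  -- From the pencil of the normalised quartic to the line

  module Line (x₀ x₁ x₂ x₃ y₀ y₁ y₂ y₃ : Carrier)
    (Δ≢0 : Δ (fL (x₀ ∷ x₁ ∷ x₂ ∷ x₃ ∷ []) (y₀ ∷ y₁ ∷ y₂ ∷ y₃ ∷ [])) ≢ 0#) where

    x y : Vec4
    x = x₀ ∷ x₁ ∷ x₂ ∷ x₃ ∷ []
    y = y₀ ∷ y₁ ∷ y₂ ∷ y₃ ∷ []

    z₀ z₁ z₂ z₃ z₄ : Carrier
    z₀ = x₂ * y₃ + - (x₃ * y₂)
    z₁ = x₁ * y₃ + - (x₃ * y₁)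
    z₂ = x₀ * y₃ + - (x₃ * y₀)
    z₃ = x₀ * y₂ + - (x₂ * y₀)
    z₄ = x₀ * y₁ + - (x₁ * y₀)

    plücker : z₀ * z₄ + - (z₁ * z₃) + z₂ * (x₁ * y₂ + - (x₂ * y₁)) ≡ 0#
    plücker = solve 8 (λ x₀ x₁ x₂ x₃ y₀ y₁ y₂ y₃ →
      (x₂ ⊗ y₃ ⊖ x₃ ⊗ y₂) ⊗ (x₀ ⊗ y₁ ⊖ x₁ ⊗ y₀) ⊖ (x₁ ⊗ y₃ ⊖ x₃ ⊗ y₁) ⊗ (x₀ ⊗ y₂ ⊖ x₂ ⊗ y₀) ⊕ (x₀ ⊗ y₃ ⊖ x₃ ⊗ y₀) ⊗ (x₁ ⊗ y₂ ⊖ x₂ ⊗ y₁) ⊜ #0)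
      x₀ x₁ x₂ x₃ y₀ y₁ y₂ y₃

    Δ-z₂≡0 : ∀ z₀ z₁ z₃ z₄ → z₀ * z₄ + - (z₁ * z₃) ≡ 0# → Δ (z₀ ∷ z₁ ∷ 0# ∷ z₃ ∷ z₄ ∷ []) ≡ 0#
    Δ-z₂≡0 z₀ z₁ z₃ z₄ e = by e (solve 4 (λ z₀ z₁ z₃ z₄ → let d = z₀ ⊗ z₄ ⊖ z₁ ⊗ z₃ in
      Δᴱ z₀ z₁ #0 z₃ z₄ ⊕ d ⊗ d ⊗ #0 ⊜ #0 ⊕ d ⊗ d ⊗ d) z₀ z₁ z₃ z₄)

    -- If p₀₃ = 0, the Plücker relation leaves p₂₃p₀₁ = p₁₃p₀₂, and every term of Δ vanishes.
    z₂≢0 : z₂ ≢ 0#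
    z₂≢0 e = Δ≢0 (trans (cong (λ z → Δ (z₀ ∷ z₁ ∷ z ∷ z₃ ∷ z₄ ∷ [])) e) (Δ-z₂≡0 z₀ z₁ z₃ z₄
      (trans (sym (+-identityʳ _)) (trans (cong (z₀ * z₄ + - (z₁ * z₃) +_) (trans (sym (zeroˡ _)) (cong (_* (x₁ * y₂ + - (x₂ * y₁))) (sym e)))) plücker))))

    r w₀ w₁ w₃ w₄ : Carrier
    r  = z₂ ⁻¹
    w₀ = r * z₀
    w₁ = r * z₁
    w₃ = r * z₃
    w₄ = r * z₄

    z₂w : ∀ z → z₂ * (r * z) ≡ z
    z₂w z = trans (sym (*-assoc _ _ _)) (trans (cong (_* z) (inverseʳ z₂ z₂≢0)) (*-identityˡ z))

    unscale : {A : Set} (g : (a b c d : Carrier) → A) → g (z₂ * w₀) (z₂ * w₁) (z₂ * w₃) (z₂ * w₄) ≡ g z₀ z₁ z₃ z₄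
    unscale g = trans (cong₂ (λ a b → g a b (z₂ * w₃) (z₂ * w₄)) (z₂w z₀) (z₂w z₁)) (cong₂ (g z₀ z₁) (z₂w z₃) (z₂w z₄))

    -- Δ is homogeneous of degree 6, the exponent with which z₂ enters `ȷ`.
    Δ-scale : ∀ s a b c d → Δ (s * a ∷ s * b ∷ s ∷ s * c ∷ s * d ∷ []) ≡ (s ^ 6) * Δ₁ a b c d
    Δ-scale = solve 5 (λ s a b c d → Δᴱ (s ⊗ a) (s ⊗ b) s (s ⊗ c) (s ⊗ d) ⊜ s ⁶ᴱ ⊗ Δᴱ a b #1 c d)

    Δ≡ : Δ (fL x y) ≡ (z₂ ^ 6) * Δ₁ w₀ w₁ w₃ w₄
    Δ≡ = trans (sym (unscale (λ a b c d → Δ (a ∷ b ∷ z₂ ∷ c ∷ d ∷ [])))) (Δ-scale z₂ w₀ w₁ w₃ w₄)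

    Δ₁≢0 : Δ₁ w₀ w₁ w₃ w₄ ≢ 0#
    Δ₁≢0 e = Δ≢0 (trans Δ≡ (trans (cong ((z₂ ^ 6) *_) e) (zeroʳ _)))

    z₂⁶≢0 : (z₂ ^ 6) ≢ 0#
    z₂⁶≢0 e = Δ≢0 (trans Δ≡ (trans (cong (_* Δ₁ w₀ w₁ w₃ w₄) e) (zeroˡ _)))

    -- In Δ(f_L) = z₂⁶ Δ₁ the power of z₂ cancels against the numerator of `ȷ`, which identifies the
    -- constant r⁻¹ of the curve.
    ȷ⁻¹≡Δ₁ : (ȷ (fL x y)) ⁻¹ ≡ Δ₁ w₀ w₁ w₃ w₄
    ȷ⁻¹≡Δ₁ = *-cancelˡ-≢0 ȷ≢0 (trans (inverseʳ _ ȷ≢0) (sym (trans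
      (solve 3 (λ s i d → s ⊗ i ⊗ d ⊜ s ⊗ d ⊗ i) (z₂ ^ 6) (Δ (fL x y) ⁻¹) (Δ₁ w₀ w₁ w₃ w₄))
      (trans (cong (_* (Δ (fL x y)) ⁻¹) (sym Δ≡)) (inverseʳ _ Δ≢0)))))
      where
      ȷ≢0 : ȷ (fL x y) ≢ 0#
      ȷ≢0 = *-≢0 z₂⁶≢0 (⁻¹-≢0 Δ≢0)

    open PencilCards w₀ w₁ w₃ w₄ Δ₁≢0

    quartic-scale : ∀ X Y → quartic z₀ z₁ z₂ z₃ z₄ X Y ≡ z₂ * Q X Y
    quartic-scale X Y = trans (sym (unscale (λ a b c d → quartic a b z₂ c d X Y)))
      (solve 7 (λ s a b c d X Y → quarticᴱ (s ⊗ a) (s ⊗ b) s (s ⊗ c) (s ⊗ d) X Y ⊜ s ⊗ quarticᴱ a b #1 c d X Y) z₂ w₀ w₁ w₃ w₄ X Y)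

    n-tangent≡ : n tangentᴷ ≡ zeros (quarticF (fL x y))
    n-tangent≡ = trans n-tangent (∑ℙ-cong λ X Y _ → 𝟙-cong (Q X Y ≟ 0#) (quartic z₀ z₁ z₂ z₃ z₄ X Y ≟ 0#)
      (λ e → trans (quartic-scale X Y) (trans (cong (z₂ *_) e) (zeroʳ _)))
      (λ e → xy≡0⇒y≡0 z₂≢0 (trans (sym (quartic-scale X Y)) e)))

    separable : SeparableF (fL x y)
    separable U V nz (e , e′) = ∂-Nonzero₂ U V nz
      ( xy≡0⇒y≡0 z₂≢0 (trans (trans
          (solve 5 (λ s a c U V → s ⊗ (⊝ (a ⊗ (U ⊗ U ⊗ U)) ⊕ U ⊗ V ⊗ V ⊕ ⊝ (c ⊗ (V ⊗ V ⊗ V))) ⊜ ⊝ ∂Xᴱ (s ⊗ a) s (s ⊗ c) U V) z₂ w₀ w₃ U V)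
          (cong -_ (trans (unscale (λ a b c d → ∂X′ a z₂ c U V)) e))) -0#≈0#)
      , xy≡0⇒y≡0 z₂≢0 (trans (trans
          (solve 5 (λ s b d U V → s ⊗ (⊝ (b ⊗ (U ⊗ U ⊗ U)) ⊕ U ⊗ U ⊗ V ⊕ ⊝ (d ⊗ (V ⊗ V ⊗ V))) ⊜ ⊝ ∂Yᴱ (s ⊗ b) s (s ⊗ d) U V) z₂ w₁ w₄ U V)
          (cong -_ (trans (unscale (λ a b c d → ∂Y′ b z₂ d U V)) e′))) -0#≈0#) )

    -- Cramer's rule: the multipliers y₃, -x₃ eliminate a₃ from the two incidences and -y₀, x₀
    -- eliminate a₀; the remaining minors are Plücker coordinates.
    PlaneThrough⇒InPencil : ∀ a → PlaneThrough x y a → InPencil a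
    PlaneThrough⇒InPencil (a₀ ∷ a₁ ∷ a₂ ∷ a₃ ∷ []) (e , e′) = *-cancelˡ-≢0 z₂≢0 (finish a₀ z₁ z₀ eq₀) , *-cancelˡ-≢0 z₂≢0 (finish a₃ z₄ z₃ eq₃)
      where
      eq₀ : z₂ * a₀ + (z₁ * a₁ + z₀ * a₂) ≡ 0#
      eq₀ = by₂ e e′ (solve 12 (λ a₀ a₁ a₂ a₃ x₀ x₁ x₂ x₃ y₀ y₁ y₂ y₃ →
        (x₀ ⊗ y₃ ⊖ x₃ ⊗ y₀) ⊗ a₀ ⊕ ((x₁ ⊗ y₃ ⊖ x₃ ⊗ y₁) ⊗ a₁ ⊕ (x₂ ⊗ y₃ ⊖ x₃ ⊗ y₂) ⊗ a₂) ⊕ y₃ ⊗ #0 ⊕ ⊝ x₃ ⊗ #0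
        ⊜ #0 ⊕ y₃ ⊗ (a₀ ⊗ x₀ ⊕ a₁ ⊗ x₁ ⊕ a₂ ⊗ x₂ ⊕ a₃ ⊗ x₃) ⊕ ⊝ x₃ ⊗ (a₀ ⊗ y₀ ⊕ a₁ ⊗ y₁ ⊕ a₂ ⊗ y₂ ⊕ a₃ ⊗ y₃)) a₀ a₁ a₂ a₃ x₀ x₁ x₂ x₃ y₀ y₁ y₂ y₃)
      eq₃ : z₂ * a₃ + (z₄ * a₁ + z₃ * a₂) ≡ 0#
      eq₃ = by₂ e e′ (solve 12 (λ a₀ a₁ a₂ a₃ x₀ x₁ x₂ x₃ y₀ y₁ y₂ y₃ →
        (x₀ ⊗ y₃ ⊖ x₃ ⊗ y₀) ⊗ a₃ ⊕ ((x₀ ⊗ y₁ ⊖ x₁ ⊗ y₀) ⊗ a₁ ⊕ (x₀ ⊗ y₂ ⊖ x₂ ⊗ y₀) ⊗ a₂) ⊕ ⊝ y₀ ⊗ #0 ⊕ x₀ ⊗ #0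
        ⊜ #0 ⊕ ⊝ y₀ ⊗ (a₀ ⊗ x₀ ⊕ a₁ ⊗ x₁ ⊕ a₂ ⊗ x₂ ⊕ a₃ ⊗ x₃) ⊕ x₀ ⊗ (a₀ ⊗ y₀ ⊕ a₁ ⊗ y₁ ⊕ a₂ ⊗ y₂ ⊕ a₃ ⊗ y₃)) a₀ a₁ a₂ a₃ x₀ x₁ x₂ x₃ y₀ y₁ y₂ y₃)
      finish : ∀ a p q → z₂ * a + (p * a₁ + q * a₂) ≡ 0# → z₂ * a ≡ z₂ * - (r * p * a₁ + r * q * a₂)
      finish a p q h = by₂ h (inverseʳ z₂ z₂≢0) (solve 7 (λ s r a p q a₁ a₂ → let k = p ⊗ a₁ ⊕ q ⊗ a₂ in
        s ⊗ a ⊕ #1 ⊗ #0 ⊕ k ⊗ #1 ⊜ s ⊗ ⊝ (r ⊗ p ⊗ a₁ ⊕ r ⊗ q ⊗ a₂) ⊕ #1 ⊗ (s ⊗ a ⊕ (p ⊗ a₁ ⊕ q ⊗ a₂)) ⊕ k ⊗ (s ⊗ r)) z₂ r a p q a₁ a₂)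

    -- Since x₀p₁₃ + x₃p₀₁ = x₁p₀₃ and x₀p₂₃ + x₃p₀₂ = x₂p₀₃, z₂ times the incidence with x is a
    -- combination of the equations for a₀ and a₃; likewise for y.
    InPencil⇒PlaneThrough : ∀ a → InPencil a → PlaneThrough x y a
    InPencil⇒PlaneThrough (a₀ ∷ a₁ ∷ a₂ ∷ a₃ ∷ []) (e₀ , e₃) =
        xy≡0⇒y≡0 z₂≢0 (by₂ (unfinish a₀ z₁ z₀ e₀) (unfinish a₃ z₄ z₃ e₃) (incidence x₀ x₁ x₂ x₃))
      , xy≡0⇒y≡0 z₂≢0 (by₂ (unfinish a₀ z₁ z₀ e₀) (unfinish a₃ z₄ z₃ e₃) (incidence′ y₀ y₁ y₂ y₃))
      where
      unfinish : ∀ a p q → a ≡ - (r * p * a₁ + r * q * a₂) → z₂ * a ≡ - (p * a₁ + q * a₂)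
      unfinish a p q h = by₂ h (inverseʳ z₂ z₂≢0) (solve 7 (λ s r a p q a₁ a₂ → let k = ⊝ (p ⊗ a₁ ⊕ q ⊗ a₂) in
        s ⊗ a ⊕ s ⊗ ⊝ (r ⊗ p ⊗ a₁ ⊕ r ⊗ q ⊗ a₂) ⊕ k ⊗ #1 ⊜ ⊝ (p ⊗ a₁ ⊕ q ⊗ a₂) ⊕ s ⊗ a ⊕ k ⊗ (s ⊗ r)) z₂ r a p q a₁ a₂)
      incidence : ∀ x₀ x₁ x₂ x₃ → _
      incidence = λ x₀ x₁ x₂ x₃ → solve 12 (λ a₀ a₁ a₂ a₃ x₀ x₁ x₂ x₃ y₀ y₁ y₂ y₃ →
        (x₀ ⊗ y₃ ⊖ x₃ ⊗ y₀) ⊗ (a₀ ⊗ x₀ ⊕ a₁ ⊗ x₁ ⊕ a₂ ⊗ x₂ ⊕ a₃ ⊗ x₃)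
          ⊕ x₀ ⊗ ⊝ ((x₁ ⊗ y₃ ⊖ x₃ ⊗ y₁) ⊗ a₁ ⊕ (x₂ ⊗ y₃ ⊖ x₃ ⊗ y₂) ⊗ a₂) ⊕ x₃ ⊗ ⊝ ((x₀ ⊗ y₁ ⊖ x₁ ⊗ y₀) ⊗ a₁ ⊕ (x₀ ⊗ y₂ ⊖ x₂ ⊗ y₀) ⊗ a₂)
        ⊜ #0 ⊕ x₀ ⊗ ((x₀ ⊗ y₃ ⊖ x₃ ⊗ y₀) ⊗ a₀) ⊕ x₃ ⊗ ((x₀ ⊗ y₃ ⊖ x₃ ⊗ y₀) ⊗ a₃)) a₀ a₁ a₂ a₃ x₀ x₁ x₂ x₃ y₀ y₁ y₂ y₃
      incidence′ : ∀ y₀ y₁ y₂ y₃ → _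
      incidence′ = λ y₀ y₁ y₂ y₃ → solve 12 (λ a₀ a₁ a₂ a₃ x₀ x₁ x₂ x₃ y₀ y₁ y₂ y₃ →
        (x₀ ⊗ y₃ ⊖ x₃ ⊗ y₀) ⊗ (a₀ ⊗ y₀ ⊕ a₁ ⊗ y₁ ⊕ a₂ ⊗ y₂ ⊕ a₃ ⊗ y₃)
          ⊕ y₀ ⊗ ⊝ ((x₁ ⊗ y₃ ⊖ x₃ ⊗ y₁) ⊗ a₁ ⊕ (x₂ ⊗ y₃ ⊖ x₃ ⊗ y₂) ⊗ a₂) ⊕ y₃ ⊗ ⊝ ((x₀ ⊗ y₁ ⊖ x₁ ⊗ y₀) ⊗ a₁ ⊕ (x₀ ⊗ y₂ ⊖ x₂ ⊗ y₀) ⊗ a₂)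
        ⊜ #0 ⊕ y₀ ⊗ ((x₀ ⊗ y₃ ⊖ x₃ ⊗ y₀) ⊗ a₀) ⊕ y₃ ⊗ ((x₀ ⊗ y₃ ⊖ x₃ ⊗ y₀) ⊗ a₃)) a₀ a₁ a₂ a₃ x₀ x₁ x₂ x₃ y₀ y₁ y₂ y₃

    toPlanes : ∀ {N : Vec4 → Set} {k} → Card (λ a → Normalized a × InPencil a × N a) k → Card (PlanesIn x y N) k
    toPlanes = Card-cong (λ a (na , ia , m) → na , InPencil⇒PlaneThrough a ia , m) (λ a (na , pa , m) → na , PlaneThrough⇒InPencil a pa , m)

    curve-count : ∀ {E} → Card (EPoint (ȷ (fL x y))) E → E ≡ 1 ℕ.+ cubicPoints (Δ₁ w₀ w₁ w₃ w₄)
    curve-count card = trans (Card-unique card (card-EPoint (ȷ (fL x y)))) (cong (λ d → 1 ℕ.+ cubicPoints d) ȷ⁻¹≡Δ₁)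

    abstract
      rooted-counts : ∀ {E i} → Card (EPoint (ȷ (fL x y))) E → zeros (quarticF (fL x y)) ≡ i → RootedCounts x y E i
      rooted-counts {E} card refl =
          toPlanes card-𝓝₁
        , subst (Card (PlanesIn x y 𝓝₂)) n-tangent≡ (toPlanes (card-class tangentᴷ))
        , (n mixedᴷ , toPlanes (card-class mixedᴷ) , subst (λ i → 2 ℕ.* n mixedᴷ ℕ.+ E ℕ.+ i ≡ 2 ℕ.* (length els ℕ.+ 1)) n-tangent≡ rel-mixed)
        , (n splitᴷ , toPlanes (card-class splitᴷ) , subst (λ i → 6 ℕ.* n splitᴷ ℕ.+ 3 ℕ.* i ≡ E) n-tangent≡ rel-split)
        , (n rootlessᴷ , toPlanes (card-class rootlessᴷ) , rel-rootless)
        where open Relations (curve-count card)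

      counts-𝓕₁ : ∀ {E} → Card (EPoint (ȷ (fL x y))) E → 𝓕₁ (fL x y) → RootedCounts x y E 1
      counts-𝓕₁ card f = rooted-counts card (zeros-𝓕₁ separable f)

      counts-𝓕₂ : ∀ {E} → Card (EPoint (ȷ (fL x y))) E → 𝓕₂ (fL x y) → RootedCounts x y E 2
      counts-𝓕₂ card f = rooted-counts card (zeros-𝓕₂ separable f)

      counts-𝓕₄ : ∀ {E} → Card (EPoint (ȷ (fL x y))) E → 𝓕₄ (fL x y) → RootedCounts x y E 4
      counts-𝓕₄ card f = rooted-counts card (zeros-𝓕₄ separable f)

      counts-𝓕₂′ : ∀ {E} → Card (EPoint (ȷ (fL x y))) E → 𝓕₂′ (fL x y) → RootlessCounts x y E
      counts-𝓕₂′ card f = RootedCounts⇒RootlessCounts {x} {y} (rooted-counts card (zeros-𝓕₂′ f))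

      counts-𝓕₄′ : ∀ {E} → Card (EPoint (ȷ (fL x y))) E → 𝓕₄′ (fL x y) → RootlessCounts x y E
      counts-𝓕₄′ card f = RootedCounts⇒RootlessCounts {x} {y} (rooted-counts card (zeros-𝓕₄′ f))

  abstract
    line-theorem : ∀ (x y : Vec4) (E : ℕ) → Card (EPoint (ȷ (fL x y))) E →
      ((i : ℕ) → ((i ≡ 1 × 𝓕₁ (fL x y)) ⊎ (i ≡ 2 × 𝓕₂ (fL x y)) ⊎ (i ≡ 4 × 𝓕₄ (fL x y))) → RootedCounts x y E i)
      × ((𝓕₂′ (fL x y) ⊎ 𝓕₄′ (fL x y)) → RootlessCounts x y E)
    line-theorem (x₀ ∷ x₁ ∷ x₂ ∷ x₃ ∷ []) (y₀ ∷ y₁ ∷ y₂ ∷ y₃ ∷ []) E card =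
      (λ where
        _ (inj₁ (refl , f@((_ , Δ≢0) , _)))        → Line.counts-𝓕₁ x₀ x₁ x₂ x₃ y₀ y₁ y₂ y₃ Δ≢0 card f
        _ (inj₂ (inj₁ (refl , f@((_ , Δ≢0) , _)))) → Line.counts-𝓕₂ x₀ x₁ x₂ x₃ y₀ y₁ y₂ y₃ Δ≢0 card f
        _ (inj₂ (inj₂ (refl , f@((_ , Δ≢0) , _)))) → Line.counts-𝓕₄ x₀ x₁ x₂ x₃ y₀ y₁ y₂ y₃ Δ≢0 card f) ,
      (λ where
        (inj₁ f@((_ , Δ≢0) , _)) → Line.counts-𝓕₂′ x₀ x₁ x₂ x₃ y₀ y₁ y₂ y₃ Δ≢0 card f
        (inj₂ f@((_ , Δ≢0) , _)) → Line.counts-𝓕₄′ x₀ x₁ x₂ x₃ y₀ y₁ y₂ y₃ Δ≢0 card f)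

open import Data.Nat using (_+_; _*_) renaming (_^_ to _^ℕ_)

theorem1p7 : (F : Field) (q : ℕ) → Card (λ (_ : Field.Carrier F) → ⊤) q → (∃ λ k → q ≡ 3 ^ℕ k) →
    let open Over F in
    (x y : Vec4) → DistinctPoints x y → Generic F x y →
    (E : ℕ) → Card (EPoint (ȷ (fL x y))) E →
    ((i : ℕ) → ((i ≡ 1 × 𝓕₁ (fL x y)) ⊎ (i ≡ 2 × 𝓕₂ (fL x y)) ⊎ (i ≡ 4 × 𝓕₄ (fL x y))) →
    Card (PlanesIn x y 𝓝₁) 0
    × Card (PlanesIn x y 𝓝₂) i
    × (∃ λ n₄ → Card (PlanesIn x y 𝓝₄) n₄ × 2 * n₄ + E + i ≡ 2 * (q + 1))
    × (∃ λ n₃ → Card (PlanesIn x y 𝓝₃) n₃ × 6 * n₃ + 3 * i ≡ E)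
    × (∃ λ n₅ → Card (PlanesIn x y 𝓝₅) n₅ × 3 * n₅ ≡ E))
    × ((𝓕₂′ (fL x y) ⊎ 𝓕₄′ (fL x y)) →
    Card (PlanesIn x y 𝓝₁) 0
    × Card (PlanesIn x y 𝓝₂) 0
    × (∃ λ n₄ → Card (PlanesIn x y 𝓝₄) n₄ × 2 * n₄ + E ≡ 2 * (q + 1))
    × (∃ λ n₃ → Card (PlanesIn x y 𝓝₃) n₃ × 6 * n₃ ≡ E)
    × (∃ λ n₅ → Card (PlanesIn x y 𝓝₅) n₅ × 3 * n₅ ≡ E))
theorem1p7 F .(length els) (els , unique , ⊤⇔∈ , refl) (k , q≡3^k) x y _ _ E card =
  FiniteField₃.line-theorem F (1+1+1≡0 k (trans (cong fromℕ (sym q≡3^k)) fromℕ-card≡0)) els unique ∈els x y E card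
  where
  ∈els : ∀ a → a ∈ els
  ∈els a = Equivalence.to (⊤⇔∈ a) tt
  open Characteristic F els unique ∈els
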